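{- For every integer $\ell\geq 1$, every $2$-connected graph $G$ of pathwidth at least $2^{9\ell^2 - 3\ell +2}-2$ contains $\Gamma_{\ell}^{+}$ or $\nabla_\ell$ as a minor.
   Context: All graphs are finite and simple. For $\ell\ge 0$, $\Gamma_\ell$ denotes the complete binary tree of height $\ell$ (every non-leaf vertex has two children, $2^\ell$ leaves, every root-to-leaf path has $\ell$ edges). $\Gamma_\ell^+$ is obtained from $\Gamma_\ell$ by adding one new vertex adjacent to all leaves. The graphs $\nabla_\ell$ ($\ell\ge1$), each with a designated root edge, are defined recursively: $\nabla_1$ is a triangle with one edge designated as root edge; $\nabla_{\ell+1}$ is obtained by taking two disjoint copies of $\nabla_\ell$ with root edges $e_1,e_2$ and a triangle with edges $e_1',e_2',e_3$, identifying $e_i$ with $e_i'$ for $i=1,2$, and declaring $e_3$ the root edge. The pathwidth of $G$ is the minimum $k$ such that there are sets $B_1,\dots,B_n\subseteq V(G)$ with $|B_i|\le k+1$, each vertex lying in a non-empty interval of consecutive $B_i$'s, and each edge contained in some $B_i$. -}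

module Defs where

open import Data.Nat using (ℕ; zero; suc; _+_; _*_; _∸_; _^_; _≤_; _<_; _⊔_; _≡ᵇ_; s≤s; z≤n)
open import Data.Bool using (Bool; true; false; _∧_; _∨_; not; T)
open import Data.Fin using (Fin; toℕ)
open import Data.Fin.Subset using (Subset; _∈_; ∁; ⁅_⁆; ∣_∣) renaming (⊤ to Full)
open import Data.List using (List; []; _∷_; _++_; map; concatMap; upTo; allFin; foldr)
open import Data.Bool.ListAction using (any)
open import Data.Product using (Σ; ∃; _×_; _,_; proj₁; proj₂)
open import Relation.Binary.PropositionalEquality using (_≡_; _≢_)
open import Data.Empty using (⊥)

record Graph : Set where
  field
    size : ℕ
    adj  : Fin size → Fin size → Bool
open Graph public

Adj : (G : Graph) → Fin (size G) → Fin (size G) → Set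
Adj G u v = adj G u v ≡ true

IsSimple : Graph → Set
IsSimple G = (∀ u v → adj G u v ≡ adj G v u) × (∀ u → adj G u u ≡ false)

data WalkIn (G : Graph) (S : Subset (size G)) : Fin (size G) → Fin (size G) → Set where
  stop : ∀ {x} → x ∈ S → WalkIn G S x x
  step : ∀ {x y z} → x ∈ S → Adj G x y → WalkIn G S y z → WalkIn G S x z

ConnectedSet : (G : Graph) → Subset (size G) → Set
ConnectedSet G S = (∃ λ x → x ∈ S) × (∀ x y → x ∈ S → y ∈ S → WalkIn G S x y)

TwoConnected : Graph → Set
TwoConnected G = (3 ≤ size G) × ConnectedSet G Full × (∀ v → ConnectedSet G (∁ ⁅ v ⁆))

record Minor (H G : Graph) : Set where
  field
    branch    : Fin (size H) → Subset (size G)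
    connected : ∀ u → ConnectedSet G (branch u)
    disjoint  : ∀ u v → u ≢ v → ∀ x → x ∈ branch u → x ∈ branch v → ⊥
    edges     : ∀ u v → Adj H u v →
                Σ (Fin (size G)) λ x → Σ (Fin (size G)) λ y →
                  x ∈ branch u × y ∈ branch v × Adj G x y

record PathDecomposition (G : Graph) : Set where
  field
    len  : ℕ
    bag  : Fin len → Subset (size G)
    covers   : ∀ v → ∃ λ i → v ∈ bag i
    interval : ∀ v (i j k : Fin len) → toℕ i ≤ toℕ j → toℕ j ≤ toℕ k →
               v ∈ bag i → v ∈ bag k → v ∈ bag j
    edgeIn   : ∀ u v → Adj G u v → ∃ λ i → u ∈ bag i × v ∈ bag i
open PathDecomposition public

width : {G : Graph} → PathDecomposition G → ℕ
width D = foldr _⊔_ 0 (map (λ i → ∣ bag D i ∣) (allFin (len D))) ∸ 1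

PathwidthAtLeast : Graph → ℕ → Set
PathwidthAtLeast G p = (D : PathDecomposition G) → p ≤ width D

fromEdges : (n : ℕ) → List (ℕ × ℕ) → Graph
fromEdges n es = record
  { size = n
  ; adj  = λ u v → not (toℕ u ≡ᵇ toℕ v) ∧
                   any (λ e → ((toℕ u ≡ᵇ proj₁ e) ∧ (toℕ v ≡ᵇ proj₂ e))
                            ∨ ((toℕ u ≡ᵇ proj₂ e) ∧ (toℕ v ≡ᵇ proj₁ e))) es }

-- Γ_ℓ^+ : complete binary tree of height ℓ in heap order (vertex i has
-- children 2i+1, 2i+2; vertices 0 .. 2^(ℓ+1)-2), leaves 2^ℓ-1 .. 2^(ℓ+1)-2,
-- plus apex vertex 2^(ℓ+1)-1 adjacent to all leaves.

GammaPlusEdges : ℕ → List (ℕ × ℕ)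
GammaPlusEdges ℓ =
  concatMap (λ i → (i , 2 * i + 1) ∷ (i , 2 * i + 2) ∷ []) (upTo (2 ^ ℓ ∸ 1))
  ++ map (λ j → (2 ^ ℓ ∸ 1 + j , 2 ^ suc ℓ ∸ 1)) (upTo (2 ^ ℓ))

GammaPlus : ℕ → Graph
GammaPlus ℓ = fromEdges (2 ^ suc ℓ) (GammaPlusEdges ℓ)

-- ∇_ℓ : nabla k represents ∇_(k+1); root edge is always {0,1}.
-- ∇_1 = triangle 0,1,2.  For ∇_(ℓ+1) with n = |∇_ℓ|: new triangle
-- b = 0, c = 1, a = 2 with root edge bc = {0,1};
-- copy 1 of ∇_ℓ via 0 ↦ 2, 1 ↦ 0, v ↦ v + 1 (v ≥ 2)   (root ↦ ab),
-- copy 2 of ∇_ℓ via 0 ↦ 2, 1 ↦ 1, v ↦ v + n ∸ 1 (v ≥ 2) (root ↦ ac).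
-- Vertex count 2n - 1.

nablaSize : ℕ → ℕ
nablaSize zero    = 3
nablaSize (suc k) = 2 * nablaSize k ∸ 1

copy₁ : ℕ → ℕ
copy₁ zero          = 2
copy₁ (suc zero)    = 0
copy₁ (suc (suc v)) = suc (suc (suc v))

copy₂ : ℕ → ℕ → ℕ
copy₂ n zero          = 2
copy₂ n (suc zero)    = 1
copy₂ n (suc (suc v)) = suc (suc v) + n ∸ 1

nablaEdges : ℕ → List (ℕ × ℕ)
nablaEdges zero    = (0 , 1) ∷ (1 , 2) ∷ (0 , 2) ∷ []
nablaEdges (suc k) =
  (0 , 1) ∷ (0 , 2) ∷ (1 , 2) ∷
  (map (λ e → (copy₁ (proj₁ e) , copy₁ (proj₂ e))) (nablaEdges k)
   ++ map (λ e → (copy₂ (nablaSize k) (proj₁ e) , copy₂ (nablaSize k) (proj₂ e))) (nablaEdges k))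

Nabla : (ℓ : ℕ) → 1 ≤ ℓ → Graph
Nabla (suc k) _ = fromEdges (nablaSize k) (nablaEdges k)

{-# OPTIONS --safe #-}
-- A graph of large pathwidth has a model of a large complete binary tree (Bienstock, Robertson, Seymour
-- and Thomas).  By Diestel's argument the model grows vertex by vertex inside sets X that have a narrow
-- path decomposition ending in the boundary ∂ X; every bag keeps a vertex of ∂ X, and Menger's theorem
-- carries the model from X to larger sets.
--
-- Let O be 2-connected and split into connected halves K and R, with a model of Γ_{ℓ+m} inside K.  Either
-- each of the 2^ℓ subtrees at depth ℓ reaches R, and R is the apex of a Γ_ℓ⁺, or one of them lies in a
-- 2-connected B ⊆ K with O ∖ B connected.  So, unless O has a Γ_ℓ⁺ minor, it contains two disjoint such
-- sets B₁, B₂ whose trees are lower by O(ℓ) only.  Given p, q ∈ O, contract B₁ and B₂ and order the vertices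
-- from p to q by an st-numbering: then B₁ and B₂ either occur in series on a path from p to q, or
-- in parallel between a connected L ∋ p and a connected R ∋ q.  Iterate in B₁ and B₂.  By Ramsey's theorem
-- for binary trees some ℓ nested levels are parallel or some ℓ - 1 are series.  In the first case the sets
-- L form a binary tree and the union of the sets R is an apex: Γ_ℓ⁺.  In the second case we get ∇_ℓ.
module Submission where

open import Defs
open import Data.Nat using (ℕ; zero; suc; pred; _+_; _*_; _∸_; _^_; _≤_; _<_; _≤?_; _<?_; _⊔_; ⌊_/2⌋; z≤n; s≤s; >-nonZero)
open import Data.Nat.Properties as ℕₚ using
  (≤-refl; ≤-trans; ≤-reflexive; ≤-pred; <-≤-trans; ≤-<-trans; n≤1+n; m≤n⇒m≤1+n; m≤m+n;
   <⇒≱; <⇒≤; ≰⇒>; +-comm; +-suc; +-mono-≤; +-mono-<-≤; +-mono-≤-<; +-monoʳ-≤)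
open import Data.Nat.Induction using (<-rec)
open import Data.Nat.Solver using (module +-*-Solver)
open import Data.Bool as Bool using (Bool; true; false)
open import Data.Bool.Properties using (T-≡; T-∧; T-∨)
open import Data.Fin as Fin using (Fin; zero; suc; toℕ; combine; remQuot)
open import Data.Fin.Properties using (_≟_; any?; all?; suc-injective; combine-injective; remQuot-combine; toℕ<n; toℕ-injective; toℕ-fromℕ<)
import Data.Fin.Subset as FS
import Data.Fin.Subset.Properties as FSₚ
import Data.Vec as Vec
import Data.Vec.Properties as Vecₚ
open import Data.List using (List; []; _∷_; _++_; length; map; foldr; concatMap; allFin; upTo)
open import Data.List.Properties using (length-++)
open import Data.List.Relation.Unary.Any using (here; there)
open import Data.List.Relation.Unary.Any.Properties using (any⁻)
open import Data.List.Membership.Propositional using (find) renaming (_∈_ to _∈ˡ_)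
open import Data.List.Membership.Propositional.Properties using (∈-map⁻; ∈-++⁻; ∈-concatMap⁻; ∈-upTo⁻)
open import Data.Product using (Σ; ∃; ∃₂; _×_; _,_; proj₁; proj₂)
open import Data.Sum using (_⊎_; inj₁; inj₂; [_,_]; map₂; swap)
open import Data.Empty using (⊥; ⊥-elim)
open import Function using (_∘_; id)
open import Function.Bundles using (module Equivalence)
open import Relation.Binary.Definitions using (tri<; tri≈; tri>)
open import Relation.Binary.PropositionalEquality using (_≡_; _≢_; refl; sym; trans; cong; cong₂; subst; subst₂)
open import Relation.Nullary using (¬_; Dec; yes; no; does)
open import Relation.Nullary.Decidable using (_×-dec_; _⊎-dec_; _→-dec_; ¬?; map′; dec-true)

-- A path from p to q has to run through a blob and still leave a large tree inside it untouched.
-- This is the purpose of an ear: for vertices x and y of a blob it consists of touching connected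
-- sets L containing x and R containing y, and of a smaller blob disjoint from both and attached to
-- L and to R at distinct vertices. The nested construction goes on in the smaller blob. The
-- complement of a blob has to be connected because the st-numbering is taken after contraction:
-- deleting a contracted node means deleting a whole blob, and this must not disconnect the rest.
-- One branching uses 2ℓ + 5 levels of the tree. As ∇_1 exists in every 2-connected set and costs no
-- branching, 2(ℓ - 1) nested branchings are enough. A tree of height 4ℓ² + 6ℓ - 9 therefore
-- suffices, while pathwidth at least 2^(h+1) - 2 yields height h, here with h = 9ℓ² - 3ℓ + 1.

-- Finite sets and their cardinalities

-- Decidable sets whose membership in unions, differences, … reduces definitionally.
record DSet (n : ℕ) : Set₁ where
  field
    has  : Fin n → Set
    has? : ∀ x → Dec (has x)
open DSet

infix 4 _∈_ _∉_ _⊆_ _∈?_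
infixl 6 _∪_ _∖_ _-_

_∈_ _∉_ : ∀ {n} → Fin n → DSet n → Set
x ∈ A = has A x
x ∉ A = ¬ (x ∈ A)

_∈?_ : ∀ {n} (x : Fin n) (A : DSet n) → Dec (x ∈ A)
x ∈? A = has? A x

_⊆_ : ∀ {n} → DSet n → DSet n → Set
A ⊆ B = ∀ x → x ∈ A → x ∈ B

_∪_ _∖_ _∩_ : ∀ {n} → DSet n → DSet n → DSet n
has  (A ∪ B) x = x ∈ A ⊎ x ∈ B
has? (A ∪ B) x = (x ∈? A) ⊎-dec (x ∈? B)
has  (A ∖ B) x = x ∈ A × x ∉ B
has? (A ∖ B) x = (x ∈? A) ×-dec ¬? (x ∈? B)
has  (A ∩ B) x = x ∈ A × x ∈ B
has? (A ∩ B) x = (x ∈? A) ×-dec (x ∈? B)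

｛_｝ : ∀ {n} → Fin n → DSet n
has  ｛ v ｝ x = x ≡ v
has? ｛ v ｝ x = x ≟ v

_-_ : ∀ {n} → DSet n → Fin n → DSet n
A - v = A ∖ ｛ v ｝

All : ∀ {n} → DSet n
has  All x = x ≡ x
has? All x = yes refl

None : ∀ {n} → DSet n
has  None x = ⊥
has? None x = no id

Disj : ∀ {n} → DSet n → DSet n → Set
Disj A B = ∀ x → x ∈ A → x ∈ B → ⊥

Disj-∪ : ∀ {n} (A B C : DSet n) → Disj A C → Disj B C → Disj (A ∪ B) C
Disj-∪ A B C d e x (inj₁ a) c = d x a c
Disj-∪ A B C d e x (inj₂ b) c = e x b c

∪-least : ∀ {n} (A B C : DSet n) → A ⊆ C → B ⊆ C → A ∪ B ⊆ C
∪-least A B C f g x (inj₁ a) = f x a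
∪-least A B C f g x (inj₂ b) = g x b

threeElements : ∀ {n} (N : DSet n) {a b c} → a ∈ N → b ∈ N → c ∈ N → a ≢ b → a ≢ c → b ≢ c →
                ∀ p q → ∃ λ r → r ∈ N × r ≢ p × r ≢ q
threeElements N {a} {b} {c} a∈ b∈ c∈ a≢b a≢c b≢c p q with a ≟ p | a ≟ q | b ≟ p | b ≟ q
... | no a≢p | no a≢q | _ | _ = a , a∈ , a≢p , a≢q
... | _ | _ | no b≢p | no b≢q = b , b∈ , b≢p , b≢q
... | yes refl | _ | yes eq | _ = ⊥-elim (a≢b (sym eq))
... | _ | yes refl | _ | yes eq = ⊥-elim (a≢b (sym eq))
... | yes refl | _ | no _ | yes refl = c , c∈ , a≢c ∘ sym , b≢c ∘ sym
... | no _ | yes refl | yes refl | _ = c , c∈ , b≢c ∘ sym , a≢c ∘ sym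

private
  bit : ∀ {P : Set} → Dec P → ℕ
  bit (yes _) = 1
  bit (no _)  = 0

  bit-mono : ∀ {P Q : Set} (p? : Dec P) (q? : Dec Q) → (P → Q) → bit p? ≤ bit q?
  bit-mono (yes p) (yes q) f = ≤-refl
  bit-mono (yes p) (no ¬q) f = ⊥-elim (¬q (f p))
  bit-mono (no ¬p) q? f = z≤n

tail : ∀ {n} → DSet (suc n) → DSet n
has  (tail A) x = suc x ∈ A
has? (tail A) x = suc x ∈? A

card : ∀ {n} → DSet n → ℕ
card {zero}  A = 0
card {suc n} A = bit (zero ∈? A) + card (tail A)

card-mono : ∀ {n} (A B : DSet n) → A ⊆ B → card A ≤ card B
card-mono {zero}  A B s = z≤n
card-mono {suc n} A B s =
  +-mono-≤ (bit-mono (zero ∈? A) (zero ∈? B) (s zero)) (card-mono (tail A) (tail B) (s ∘ suc))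

card-strict : ∀ {n} (A B : DSet n) → A ⊆ B → ∀ v → v ∈ B → v ∉ A → card A < card B
card-strict {suc n} A B s zero b ¬a = +-mono-<-≤ lem (card-mono (tail A) (tail B) (s ∘ suc))
  where
  lem : bit (zero ∈? A) < bit (zero ∈? B)
  lem with zero ∈? A | zero ∈? B
  ... | yes a | _     = ⊥-elim (¬a a)
  ... | no _  | yes _ = s≤s z≤n
  ... | no _  | no ¬b = ⊥-elim (¬b b)
card-strict {suc n} A B s (suc v) b ¬a =
  +-mono-≤-< (bit-mono (zero ∈? A) (zero ∈? B) (s zero))
             (card-strict (tail A) (tail B) (s ∘ suc) v b ¬a)

card-add : ∀ {n} (A B : DSet n) v → (∀ x → x ∈ B → x ≢ v → x ∈ A) → card B ≤ suc (card A)
card-add {suc n} A B zero s =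
  +-mono-≤ (bit≤1 (zero ∈? B))
    (≤-trans (card-mono (tail B) (tail A) (λ x b → s (suc x) b (λ ()))) (m≤n+m′ (bit (zero ∈? A))))
  where
  bit≤1 : ∀ {P : Set} (p? : Dec P) → bit p? ≤ 1
  bit≤1 (yes _) = ≤-refl
  bit≤1 (no _)  = z≤n
  m≤n+m′ : ∀ k {m} → m ≤ k + m
  m≤n+m′ k {m} = ℕₚ.m≤n+m m k
card-add {suc n} A B (suc v) s = ≤-trans
  (+-mono-≤ (bit-mono (zero ∈? B) (zero ∈? A) (λ b → s zero b (λ ())))
            (card-add (tail A) (tail B) v (λ x b x≢v → s (suc x) b (x≢v ∘ suc-injective))))
  (≤-reflexive (+-suc _ _))

card-drop : ∀ {n k} (A B : DSet n) → A ⊆ B → ∀ v → v ∈ B → v ∉ A → card B ≤ suc k → card A ≤ k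
card-drop A B s v b ¬a le = ≤-pred (<-≤-trans (card-strict A B s v b ¬a) le)

card-minus : ∀ {n} (A : DSet n) v → v ∈ A → card (A - v) < card A
card-minus A v v∈ = card-strict (A - v) A (λ _ → proj₁) v v∈ (λ p → proj₂ p refl)

card-0 : ∀ {n} (A : DSet n) v → v ∈ A → ¬ card A ≤ 0
card-0 A v v∈ le with () ← ≤-trans (card-strict None A (λ _ ()) v v∈ id) le

card-None : ∀ n → card {n} None ≡ 0
card-None zero    = refl
card-None (suc n) = card-None n

card-inj : ∀ {n} (A B : DSet n) (f : ∀ x → x ∈ A → Fin n) → (∀ x a → f x a ∈ B) →
           (∀ x y a b → f x a ≡ f y b → x ≡ y) → card A ≤ card B
card-inj {n} A B f into inj = go (card A) A B f into inj ≤-refl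
  where
  go : ∀ k (A B : DSet n) (f : ∀ x → x ∈ A → Fin n) → (∀ x a → f x a ∈ B) →
       (∀ x y a b → f x a ≡ f y b → x ≡ y) → card A ≤ k → card A ≤ card B
  go zero A B f into inj le = ≤-trans le z≤n
  go (suc k) A B f into inj le with any? (has? A)
  ... | no empty = ≤-trans (card-mono A None (λ x a → empty (x , a))) (≤-trans (≤-reflexive (card-None n)) z≤n)
  ... | yes (v , v∈A) =
    ≤-trans (card-add (A - v) A v (λ x a x≢v → a , x≢v))
      (≤-trans (s≤s (go k (A - v) (B - f v v∈A) (λ x a → f x (proj₁ a))
                        (λ x a → into x (proj₁ a) , λ eq → proj₂ a (inj x v (proj₁ a) v∈A eq))
                        (λ x y a b → inj x y (proj₁ a) (proj₁ b))
                        (card-drop (A - v) A (λ x → proj₁) v v∈A (λ p → proj₂ p refl) le)))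
        (card-strict (B - f v v∈A) B (λ x → proj₁) (f v v∈A) (into v v∈A) (λ p → proj₂ p refl)))

fromSubset : ∀ {n} → FS.Subset n → DSet n
has  (fromSubset s) x = x FS.∈ s
has? (fromSubset s) x = x FSₚ.∈? s

toSubset : ∀ {n} → DSet n → FS.Subset n
toSubset A = Vec.tabulate (does ∘ has? A)

toSubset⁺ : ∀ {n} (A : DSet n) {x} → x ∈ A → x FS.∈ toSubset A
toSubset⁺ A {x} a = Vecₚ.lookup⇒[]= x (toSubset A) (trans (Vecₚ.lookup∘tabulate _ x) (dec-true (x ∈? A) a))

toSubset⁻ : ∀ {n} (A : DSet n) {x} → x FS.∈ toSubset A → x ∈ A
toSubset⁻ A {x} s with x ∈? A | trans (sym (Vecₚ.lookup∘tabulate (does ∘ has? A) x)) (Vecₚ.[]=⇒lookup s)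
... | yes a | _ = a
... | no _ | ()

∣toSubset∣ : ∀ {n} (A : DSet n) → FS.∣ toSubset A ∣ ≡ card A
∣toSubset∣ {zero}  A = refl
∣toSubset∣ {suc n} A with zero ∈? A
... | yes _ = cong suc (∣toSubset∣ (tail A))
... | no _  = ∣toSubset∣ (tail A)

abstract
  -- Sets of type `DSet n` cannot be enumerated, as `has` is an arbitrary predicate, so the search
  -- runs through `Subset n`. The last hypothesis on `P` transports a result between extensionally
  -- equal sets.
  searchSets : ∀ {n} (P : DSet n → Set) → (∀ U → Dec (P U)) → (∀ U V → U ⊆ V → V ⊆ U → P U → P V) →
               Σ (DSet n) P ⊎ (∀ U → ¬ P U)
  searchSets P P? ext with FSₚ.anySubset? (P? ∘ fromSubset)
  ... | yes (s , p) = inj₁ (fromSubset s , p)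
  ... | no none = inj₂ λ U p → none (toSubset U , ext U _ (λ _ → toSubset⁺ U) (λ _ → toSubset⁻ U) p)

_⊆?_ : ∀ {n} (A B : DSet n) → Dec (A ⊆ B)
A ⊆? B = all? λ x → (x ∈? A) →-dec (x ∈? B)

-- Heap numbering of the binary tree

kid : Bool → ℕ → ℕ
kid false v = suc (v + v)
kid true  v = suc (suc (v + v))

half-kid : ∀ b v → ⌊ pred (kid b v) /2⌋ ≡ v
half-kid false v = sym (ℕₚ.n≡⌊n+n/2⌋ v)
half-kid true  v = sym (ℕₚ.n≡⌈n+n/2⌉ v)

isKid : ∀ u → ∃ λ b → suc u ≡ kid b ⌊ u /2⌋
isKid zero = false , refl
isKid (suc zero) = true , refl
isKid (suc (suc u)) with isKid u
... | false , eq = false , cong suc (trans (cong suc eq) (cong suc (sym (+-suc ⌊ u /2⌋ ⌊ u /2⌋))))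
... | true , eq = true , cong (2 +_) (trans eq (cong suc (sym (+-suc ⌊ u /2⌋ ⌊ u /2⌋))))

kid-induction : (P : ℕ → Set) → P 0 → (∀ b v → P v → P (kid b v)) → ∀ v → P v
kid-induction P p₀ pk = <-rec P λ
  { zero _ → p₀
  ; (suc u) rec → let (b , eq) = isKid u in subst P (sym eq) (pk b ⌊ u /2⌋ (rec (s≤s (ℕₚ.⌊n/2⌋≤n u)))) }

-- Nodes of a binary tree as paths from the root, enumerated in heap order.
addrBelow : ℕ → ℕ → List Bool
addrBelow zero    v       = []
addrBelow (suc f) zero    = []
addrBelow (suc f) (suc u) = addrBelow f ⌊ u /2⌋ ++ (proj₁ (isKid u) ∷ [])

addr : ℕ → List Bool
addr v = addrBelow v v

-- The first argument of `addrBelow` is fuel, since `⌊ u /2⌋` is not structurally below `suc u`.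
-- Independence of the fuel is what gives `addr` its recursion in `addr-kid`.
addrBelow-irr : ∀ f g v → v ≤ f → v ≤ g → addrBelow f v ≡ addrBelow g v
addrBelow-irr zero zero zero _ _ = refl
addrBelow-irr zero (suc g) zero _ _ = refl
addrBelow-irr (suc f) zero zero _ _ = refl
addrBelow-irr (suc f) (suc g) zero _ _ = refl
addrBelow-irr (suc f) (suc g) (suc u) (s≤s p) (s≤s q) =
  cong (_++ (proj₁ (isKid u) ∷ [])) (addrBelow-irr f g ⌊ u /2⌋ (≤-trans (ℕₚ.⌊n/2⌋≤n u) p) (≤-trans (ℕₚ.⌊n/2⌋≤n u) q))

kid-injective : ∀ a b v w → kid a v ≡ kid b w → a ≡ b × v ≡ w
kid-injective a b v w eq with trans (sym (half-kid a v)) (trans (cong (λ z → ⌊ pred z /2⌋) eq) (half-kid b w))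
kid-injective false false v .v eq | refl = refl , refl
kid-injective true true v .v eq | refl = refl , refl
kid-injective false true v .v eq | refl = ⊥-elim (ℕₚ.1+n≢n (sym eq))
kid-injective true false v .v eq | refl = ⊥-elim (ℕₚ.1+n≢n eq)

addr-kid : ∀ b v → addr (kid b v) ≡ addr v ++ (b ∷ [])
addr-kid b v = trans (unfold (pred (kid b v)) (kid≡ b)) (cong₂ (λ p c → p ++ (c ∷ [])) (cong addr (half-kid b v)) bitEq)
  where
  kid≡ : ∀ b → kid b v ≡ suc (pred (kid b v))
  kid≡ false = refl
  kid≡ true  = refl
  unfold : ∀ u → kid b v ≡ suc u → addr (kid b v) ≡ addr ⌊ u /2⌋ ++ (proj₁ (isKid u) ∷ [])
  unfold u eq rewrite eq = cong (_++ (proj₁ (isKid u) ∷ [])) (addrBelow-irr u ⌊ u /2⌋ ⌊ u /2⌋ (ℕₚ.⌊n/2⌋≤n u) ≤-refl)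
  bitEq : proj₁ (isKid (pred (kid b v))) ≡ b
  bitEq = sym (proj₁ (kid-injective b _ v _ (trans (kid≡ b) (proj₂ (isKid (pred (kid b v)))))))

number : List Bool → ℕ → ℕ
number []      v = v
number (b ∷ p) v = number p (kid b v)

number-snoc : ∀ p b v → number (p ++ (b ∷ [])) v ≡ kid b (number p v)
number-snoc []      b v = refl
number-snoc (a ∷ p) b v = number-snoc p b (kid a v)

number-addr : ∀ v → number (addr v) 0 ≡ v
number-addr = kid-induction (λ v → number (addr v) 0 ≡ v) refl λ b v ih →
  trans (cong (λ p → number p 0) (addr-kid b v)) (trans (number-snoc (addr v) b 0) (cong (kid b) ih))

addr-injective : ∀ v w → addr v ≡ addr w → v ≡ w
addr-injective v w eq = trans (sym (number-addr v)) (trans (cong (λ p → number p 0) eq) (number-addr w))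

length-snoc : ∀ (p : List Bool) b → length (p ++ (b ∷ [])) ≡ suc (length p)
length-snoc p b = trans (length-++ p) (+-comm (length p) 1)

-- The level of node `v` is the integer part of the binary logarithm of `suc v`. In the form of two
-- inequalities it combines with bounds on `v` through `pow-cancel`.
addr-length : ∀ v → 2 ^ length (addr v) ≤ suc v × suc v < 2 * 2 ^ length (addr v)
addr-length = kid-induction (λ v → 2 ^ length (addr v) ≤ suc v × suc v < 2 * 2 ^ length (addr v)) (s≤s z≤n , s≤s (s≤s z≤n))
  λ b v (lo , hi) → subst (λ k → 2 ^ k ≤ suc (kid b v) × suc (kid b v) < 2 * 2 ^ k)
    (sym (trans (cong length (addr-kid b v)) (length-snoc (addr v) b)))
    ( ≤-trans (ℕₚ.*-monoʳ-≤ 2 lo) (≤-trans (≤-reflexive (double v)) (lower b v))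
    , ≤-trans (upper b v) (≤-trans (≤-reflexive (sym (double (suc v)))) (ℕₚ.*-monoʳ-≤ 2 hi)))
  where
  double : ∀ v → 2 * suc v ≡ suc (suc (v + v))
  double v = cong suc (trans (cong (λ z → v + suc z) (ℕₚ.+-identityʳ v)) (+-suc v v))
  lower : ∀ b v → suc (suc (v + v)) ≤ suc (kid b v)
  lower false v = ≤-refl
  lower true v = n≤1+n _
  upper : ∀ b v → suc (suc (kid b v)) ≤ suc (suc (suc v + suc v))
  upper false v = s≤s (s≤s (s≤s (≤-trans (n≤1+n _) (≤-reflexive (sym (+-suc v v))))))
  upper true v = ≤-reflexive (cong (3 +_) (sym (+-suc v v)))

pow-cancel : ∀ a b {m} → 2 ^ a ≤ m → m < 2 * 2 ^ b → a ≤ b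
pow-cancel a b lo hi with a ≤? b
... | yes p = p
... | no ¬p = ⊥-elim (<⇒≱ hi (≤-trans (ℕₚ.^-monoʳ-≤ 2 (≰⇒> ¬p)) lo))

-- Sizes and edges of ∇

3≤nablaSize : ∀ k → 3 ≤ nablaSize k
suc-nablaSize : ∀ k → suc (nablaSize (suc k)) ≡ nablaSize k + nablaSize k

3≤nablaSize zero = ≤-refl
3≤nablaSize (suc k) = ≤-pred (≤-trans (≤-trans (s≤s (s≤s (s≤s (s≤s z≤n)))) (ℕₚ.+-mono-≤ (3≤nablaSize k) (3≤nablaSize k))) (≤-reflexive (sym (suc-nablaSize k))))

suc-nablaSize k with nablaSize k | 3≤nablaSize k
... | suc m | _ = cong suc (trans (cong (m +_) (cong suc (ℕₚ.+-identityʳ m))) refl)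

copy₁< : ∀ k u → u < nablaSize k → copy₁ u < nablaSize (suc k)
copy₁< k zero lt = 3≤nablaSize (suc k)
copy₁< k (suc zero) lt = ≤-trans (s≤s z≤n) (3≤nablaSize (suc k))
copy₁< k (suc (suc v)) lt = ≤-pred (≤-trans (s≤s (s≤s lt)) (≤-trans (ℕₚ.+-monoˡ-≤ (nablaSize k) (≤-trans (n≤1+n 2) (3≤nablaSize k))) (≤-reflexive (sym (suc-nablaSize k)))))

copy₂< : ∀ k u → u < nablaSize k → copy₂ (nablaSize k) u < nablaSize (suc k)
copy₂< k zero lt = 3≤nablaSize (suc k)
copy₂< k (suc zero) lt = ≤-trans (s≤s (s≤s z≤n)) (3≤nablaSize (suc k))
copy₂< k (suc (suc v)) lt = ≤-pred (≤-trans (ℕₚ.+-monoˡ-≤ (nablaSize k) lt) (≤-reflexive (sym (suc-nablaSize k))))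

nablaEdges< : ∀ k e → e ∈ˡ nablaEdges k → proj₁ e < nablaSize k × proj₂ e < nablaSize k
nablaEdges< zero _ (here refl) = s≤s z≤n , s≤s (s≤s z≤n)
nablaEdges< zero _ (there (here refl)) = s≤s (s≤s z≤n) , ≤-refl
nablaEdges< zero _ (there (there (here refl))) = s≤s z≤n , ≤-refl
nablaEdges< (suc k) _ (here refl) = ≤-trans (s≤s z≤n) (3≤nablaSize (suc k)) , ≤-trans (s≤s (s≤s z≤n)) (3≤nablaSize (suc k))
nablaEdges< (suc k) _ (there (here refl)) = ≤-trans (s≤s z≤n) (3≤nablaSize (suc k)) , 3≤nablaSize (suc k)
nablaEdges< (suc k) _ (there (there (here refl))) = ≤-trans (s≤s (s≤s z≤n)) (3≤nablaSize (suc k)) , 3≤nablaSize (suc k)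
nablaEdges< (suc k) _ (there (there (there i))) with ∈-++⁻ (map (λ e → (copy₁ (proj₁ e) , copy₁ (proj₂ e))) (nablaEdges k)) i
... | inj₁ j with ∈-map⁻ _ j
...   | e , e∈ , refl = let (p , q) = nablaEdges< k e e∈ in copy₁< k _ p , copy₁< k _ q
nablaEdges< (suc k) _ (there (there (there i))) | inj₂ j with ∈-map⁻ _ j
...   | e , e∈ , refl = let (p , q) = nablaEdges< k e e∈ in copy₂< k _ p , copy₂< k _ q

-- The height used up by `k` nested branchings, short of a `suc` that is added in `redOrBlue`. In
-- `suc (depth ℓ (suc k))` the leading 3 serves to avoid p and q and to split into two subtrees,
-- each `ℓ` is the price of a blob, and the 2 serves to avoid the ends of an ear. What remains is a
-- successor, so the tree in a blob has a branching node and the blob has three vertices.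
depth : ℕ → ℕ → ℕ
depth ℓ zero    = 0
depth ℓ (suc k) = 2 + (ℓ + (2 + (ℓ + suc (depth ℓ k))))

-- Separations and st-numberings

-- The adjacency relation is a parameter because st-numberings are taken in a contracted graph,
-- where adjacency is `F` and not `E`.
module Separation {n : ℕ} (E : Fin n → Fin n → Set) (E? : ∀ x y → Dec (E x y))
                  (E-sym : ∀ {x y} → E x y → E y x) where

  data Walk (A : DSet n) : Fin n → Fin n → Set where
    stop : ∀ {x} → x ∈ A → Walk A x x
    step : ∀ {x y z} → x ∈ A → E x y → Walk A y z → Walk A x z

  start∈ : ∀ {A x y} → Walk A x y → x ∈ A
  start∈ (stop a) = a
  start∈ (step a _ _) = a

  end∈ : ∀ {A x y} → Walk A x y → y ∈ A
  end∈ (stop a) = a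
  end∈ (step _ _ w) = end∈ w

  _◅◅_ : ∀ {A x y z} → Walk A x y → Walk A y z → Walk A x z
  stop _ ◅◅ w = w
  step a e v ◅◅ w = step a e (v ◅◅ w)

  edge : ∀ {A x y} → x ∈ A → y ∈ A → E x y → Walk A x y
  edge a b e = step a e (stop b)

  reverse : ∀ {A x y} → Walk A x y → Walk A y x
  reverse (stop a) = stop a
  reverse (step a e w) = reverse w ◅◅ edge (start∈ w) a (E-sym e)

  widen : ∀ A B → A ⊆ B → ∀ {x y} → Walk A x y → Walk B x y
  widen A B s (stop a) = stop (s _ a)
  widen A B s (step a e w) = step (s _ a) e (widen A B s w)

  -- `WConn` admits the empty set, which occurs as the complement of a spanning tree model.
  WConn Conn : DSet n → Set
  WConn A = ∀ x y → x ∈ A → y ∈ A → Walk A x y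
  Conn A = ∃ (_∈ A) × WConn A

  record Touch (A B : DSet n) : Set where
    constructor touch
    field
      {from to} : Fin n
      from∈ : from ∈ A
      to∈   : to ∈ B
      joins : E from to

  Touch-sym : ∀ {A B} → Touch A B → Touch B A
  Touch-sym (touch a b e) = touch b a (E-sym e)

  Touch-mono : ∀ {A A′ B B′} → A ⊆ A′ → B ⊆ B′ → Touch A B → Touch A′ B′
  Touch-mono s t (touch a b e) = touch (s _ a) (t _ b) e

  Touch-from : ∀ {p A B} → p ∈ A → Touch ｛ p ｝ B → Touch A B
  Touch-from a (touch refl b e) = touch a b e

  hub : ∀ A z → z ∈ A → (∀ x → x ∈ A → Walk A x z) → Conn A
  hub A z z∈A f = (z , z∈A) , λ x y a b → f x a ◅◅ reverse (f y b)

  WConn-∪ : ∀ A B → WConn A → WConn B → (∀ x y → x ∈ A → y ∈ B → Walk (A ∪ B) x y) → WConn (A ∪ B)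
  WConn-∪ A B ca cb j x y (inj₁ a) (inj₁ b) = widen A (A ∪ B) (λ _ → inj₁) (ca x y a b)
  WConn-∪ A B ca cb j x y (inj₁ a) (inj₂ b) = j x y a b
  WConn-∪ A B ca cb j x y (inj₂ a) (inj₁ b) = reverse (j y x b a)
  WConn-∪ A B ca cb j x y (inj₂ a) (inj₂ b) = widen B (A ∪ B) (λ _ → inj₂) (cb x y a b)

  WConn-touch : ∀ {A B} → WConn A → WConn B → Touch A B → WConn (A ∪ B)
  WConn-touch {A} {B} ca cb (touch {a} {b} a∈ b∈ e) = WConn-∪ A B ca cb λ x y x∈ y∈ →
    widen A (A ∪ B) (λ _ → inj₁) (ca x a x∈ a∈) ◅◅
    step (inj₁ a∈) e (widen B (A ∪ B) (λ _ → inj₂) (cb b y b∈ y∈))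

  Conn-touch : ∀ {A B} → Conn A → Conn B → Touch A B → Conn (A ∪ B)
  Conn-touch {A} {B} ((a , a∈) , ca) (_ , cb) t = (a , inj₁ a∈) , WConn-touch ca cb t

  Conn-share : ∀ {A B} → Conn A → Conn B → ∀ z → z ∈ A → z ∈ B → Conn (A ∪ B)
  Conn-share {A} {B} (_ , ca) (_ , cb) z z∈A z∈B = (z , inj₁ z∈A) , WConn-∪ A B ca cb λ x y x∈ y∈ →
    widen A (A ∪ B) (λ _ → inj₁) (ca x z x∈ z∈A) ◅◅ widen B (A ∪ B) (λ _ → inj₂) (cb z y z∈B y∈)

  Conn-single : ∀ v → Conn ｛ v ｝
  Conn-single v = (v , refl) , λ { _ _ refl refl → stop refl }

  Conn-≐ : ∀ A B → A ⊆ B → B ⊆ A → Conn A → Conn B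
  Conn-≐ A B s t ((a , a∈) , c) = (a , s a a∈) , λ x y x∈ y∈ → widen A B s (c x y (t x x∈) (t y y∈))

  record Exit (S A : DSet n) (x : Fin n) : Set where
    constructor exiting
    field
      {out-from out-to} : Fin n
      out-from∈ : out-from ∈ A
      out-to∈   : out-to ∈ S
      out-to∉   : out-to ∉ A
      leaves    : E out-from out-to
      before    : Walk (S ∩ A) x out-from

  exit : ∀ S A {x y} → Walk S x y → x ∈ A → y ∉ A → Exit S A x
  exit S A (stop s) a ¬a = ⊥-elim (¬a a)
  exit S A (step {x} {y} s e w) a ¬a with y ∈? A
  ... | no y∉  = exiting a (start∈ w) y∉ e (stop (s , a))
  ... | yes y∈ with exit S A w y∈ ¬a
  ...   | exiting p q r e′ b = exiting p q r e′ (step (s , a) e b)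

  -- Only walks that leave x once and for all matter, which bounds the search for a walk.
  private
    lastExit : ∀ S v {x z} → Walk S x z →
               Walk (S - v) x z ⊎ (v ≡ z ⊎ ∃ λ y → E v y × Walk (S - v) y z)
    lastExit S v (stop {x} s) with x ≟ v
    ... | yes refl = inj₂ (inj₁ refl)
    ... | no x≢v   = inj₁ (stop (s , x≢v))
    lastExit S v (step {x} {y} s e w) with lastExit S v w
    ... | inj₂ r = inj₂ r
    ... | inj₁ w′ with x ≟ v
    ...   | yes refl = inj₂ (inj₂ (y , e , w′))
    ...   | no x≢v   = inj₁ (step (s , x≢v) e w′)

    search : ∀ k S → card S ≤ k → ∀ x z → Dec (Walk S x z)
    search k S le x z with x ∈? S
    search k S le x z | no x∉ = no (x∉ ∘ start∈)
    search zero S le x z | yes x∈ = ⊥-elim (card-0 S x x∈ le)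
    search (suc k) S le x z | yes x∈ with x ≟ z
    ... | yes refl = yes (stop x∈)
    ... | no x≢z with any? (λ y → E? x y ×-dec search k (S - x) smaller y z)
      where
      smaller : card (S - x) ≤ k
      smaller = ≤-pred (<-≤-trans (card-minus S x x∈) le)
    ...   | yes (y , e , w) = yes (step x∈ e (widen (S - x) S (λ _ → proj₁) w))
    ...   | no none = no λ w → [ (λ w′ → proj₂ (start∈ w′) refl) , [ x≢z , none ] ] (lastExit S x w)

  abstract
    walk? : ∀ S x z → Dec (Walk S x z)
    walk? S = search (card S) S ≤-refl

    WConn? : ∀ S → Dec (WConn S)
    WConn? S = all? λ x → all? λ y → (x ∈? S) →-dec ((y ∈? S) →-dec walk? S x y)

  unlinked : ∀ S → ¬ WConn S → ∃₂ λ x y → x ∈ S × y ∈ S × ¬ Walk S x y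
  unlinked S ¬c with any? (λ x → any? λ y → (x ∈? S) ×-dec ((y ∈? S) ×-dec ¬? (walk? S x y)))
  ... | yes (x , y , p) = x , y , p
  ... | no none = ⊥-elim (¬c λ x y x∈ y∈ → decide x y x∈ y∈)
    where
    decide : ∀ x y → x ∈ S → y ∈ S → Walk S x y
    decide x y x∈ y∈ with walk? S x y
    ... | yes w = w
    ... | no ¬w = ⊥-elim (none (x , y , x∈ , y∈ , ¬w))

  comp : DSet n → Fin n → DSet n
  has  (comp S x) = Walk S x
  has? (comp S x) = walk? S x

  comp-closed : ∀ S x {y z} → y ∈ comp S x → z ∈ S → E y z → z ∈ comp S x
  comp-closed S x w z∈ e = w ◅◅ edge (end∈ w) z∈ e

  comp-walk : ∀ S x {y} → Walk S x y → Walk (comp S x) x y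
  comp-walk S x w = go (stop (start∈ w)) w
    where
    go : ∀ {y z} → Walk S x y → Walk S y z → Walk (comp S x) y z
    go v (stop _) = stop v
    go v (step s e w) = step v e (go (v ◅◅ edge s (start∈ w) e) w)

  comp-conn : ∀ S x → x ∈ S → Conn (comp S x)
  comp-conn S x x∈ = hub (comp S x) x (stop x∈) λ y w → reverse (comp-walk S x w)

  WConn-≐ : ∀ A B → A ⊆ B → B ⊆ A → WConn A → WConn B
  WConn-≐ A B s t c x y x∈ y∈ = widen A B s (c x y (t x x∈) (t y y∈))

  record TwoConn (N : DSet n) : Set where
    field
      conn  : Conn N
      cut   : ∀ v → v ∈ N → WConn (N - v)
      third : ∀ p q → ∃ λ r → r ∈ N × r ≢ p × r ≢ q

  abstract
    -- Two vertices of `S` that no walk joins lie in different components, and the connected set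
    -- `Out` meets at most one of these.
    away : ∀ S Out → ¬ WConn S → WConn Out → Out ⊆ S → ∃ λ w → w ∈ S × Disj (comp S w) Out
    away S Out ¬c co s with unlinked S ¬c
    ... | x , y , x∈ , y∈ , ¬w with any? (λ o → (o ∈? Out) ×-dec walk? S x o)
    ...   | no none = x , x∈ , λ o w o∈ → none (o , o∈ , w)
    ...   | yes (o , o∈ , w) = y , y∈ , λ o′ w′ o′∈ →
              ¬w (w ◅◅ (widen Out S s (co o o′ o∈ o′∈) ◅◅ reverse w′))

  -- An st-numbering is never stored as a whole, only its cut just before the earliest element `v`
  -- of `T`. The numbering starts with `L` and ends with `q`: `L⁺` holds the vertices before `v`,
  -- and the vertices from `v` on are connected with and without `v`. By `no-new`, `v` really is the
  -- earliest.
  record Grown (N L T : DSet n) (q : Fin n) : Set₁ where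
    field
      L⁺        : DSet n
      v         : Fin n
      L⊆        : L ⊆ L⁺
      L⁺⊆       : L⁺ ⊆ N
      q∉        : q ∉ L⁺
      v∈T       : v ∈ T
      v∈        : v ∈ N ∖ L⁺
      v≢q       : v ≢ q
      conn      : Conn L⁺
      co-conn   : WConn (N ∖ L⁺)
      touches   : Touch L⁺ ｛ v ｝
      co-conn-v : WConn ((N ∖ L⁺) - v)
      no-new    : ∀ x → x ∈ L⁺ → x ∈ T → x ∈ L

  module Growing (N : DSet n) (cut : ∀ v → v ∈ N → WConn (N - v)) (p q : Fin n) (q∈N : q ∈ N) where

    record Next (L : DSet n) : Set where
      constructor next
      field
        v         : Fin n
        v∈        : v ∈ N ∖ L
        v≢q       : v ≢ q
        touches   : Touch L ｛ v ｝
        co-conn-v : WConn ((N ∖ L) - v)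

    -- If deleting v from S = N ∖ L cuts off D ∌ q, then some v′ ∈ D touches L, and deleting v′
    -- instead leaves a larger component around q.
    module _ (L : DSet n) (L⊆N : L ⊆ N) (p∈L : p ∈ L) (q∉L : q ∉ L) (c : WConn (N ∖ L)) where
      private
        S = N ∖ L

        abstract
          improve : ∀ v → v ∈ S → ¬ WConn (S - v) → v ≢ q →
                    ∃ λ v′ → v′ ∈ S × v′ ≢ q × Touch L ｛ v′ ｝ ×
                             card (comp (S - v) q) < card (comp (S - v′) q)
          improve v v∈ ¬c v≢q with away (S - v) ｛ q ｝ ¬c (proj₂ (Conn-single q)) (λ { _ refl → (q∈N , q∉L) , (v≢q ∘ sym) })
          ... | w , w∈ , dj with exit (N - v) (comp (S - v) w)
                                   (cut v (proj₁ v∈) w p (proj₁ (proj₁ w∈) , proj₂ w∈) (L⊆N p p∈L , λ { refl → proj₂ v∈ p∈L }))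
                                   (stop w∈) (λ d → proj₂ (proj₁ (end∈ d)) p∈L)
          ...   | exiting {v′} {u} v′∈D u∈ u∉D e _ = v′ , proj₁ (end∈ v′∈D) , (λ { refl → dj v′ v′∈D refl }) ,
                    touch u∈L refl (E-sym e) ,
                    card-strict (comp (S - v) q) (comp (S - v′) q) sub v v-new (λ b → proj₂ (end∈ b) refl)
            where
            u∈L : u ∈ L
            u∈L with u ∈? L
            ... | yes l = l
            ... | no ¬l = ⊥-elim (u∉D (comp-closed (S - v) w v′∈D ((proj₁ u∈ , ¬l) , proj₂ u∈) e))
            sub : comp (S - v) q ⊆ comp (S - v′) q
            sub y b = widen (comp (S - v) q) (S - v′)
              (λ z bz → proj₁ (end∈ bz) , λ { refl → dj q (v′∈D ◅◅ reverse bz) refl }) (comp-walk (S - v) q b)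
            -- `S` is connected, so a walk from `q` stays in the component of `q` in `S - v` until
            -- it steps to `v`; this component does not contain `v′`.
            v-new : v ∈ comp (S - v′) q
            v-new with exit S (S - v) (c q v (q∈N , q∉L) v∈) ((q∈N , q∉L) , (v≢q ∘ sym)) (λ z → proj₂ z refl)
            ... | exiting {a} {b} a∈ b∈ b∉ e′ w′ with b ≟ v
            ...   | no b≢v = ⊥-elim (b∉ (b∈ , b≢v))
            ...   | yes refl = sub a (widen (S ∩ (S - v)) (S - v) (λ _ → proj₂) w′) ◅◅
                      edge (end∈ (sub a (widen (S ∩ (S - v)) (S - v) (λ _ → proj₂) w′)))
                           (v∈ , λ { refl → proj₂ (end∈ v′∈D) refl }) e′

        climb : ∀ k v → v ∈ S → v ≢ q → Touch L ｛ v ｝ → card S ≤ k + card (comp (S - v) q) → Next L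
        climb k v v∈ v≢q t le with WConn? (S - v)
        ... | yes co = next v v∈ v≢q t co
        climb k v v∈ v≢q t le | no ¬co with improve v v∈ ¬co v≢q
        climb zero v v∈ v≢q t le | no ¬co | v′ , v′∈ , _ , _ , lt =
          ⊥-elim (<⇒≱ lt (≤-trans (card-mono (comp (S - v′) q) S (λ x b → proj₁ (end∈ b))) le))
        climb (suc k) v v∈ v≢q t le | no ¬co | v′ , v′∈ , v′≢q , t′ , lt =
          climb k v′ v′∈ v′≢q t′ (≤-trans le (≤-trans (≤-reflexive (sym (+-suc k _))) (+-monoʳ-≤ k lt)))

      abstract
        -- `N - q` is connected, so a walk in it from `t` to `p` supplies a vertex other than `q`
        -- that touches `L`. `climb` exchanges this vertex until its deletion leaves `S` connected.
        nextVertex : ∀ t → t ∈ S → t ≢ q → Next L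
        nextVertex t t∈ t≢q with exit (N - q) (S - q)
            (cut q q∈N t p (proj₁ t∈ , t≢q) (L⊆N p p∈L , λ { refl → q∉L p∈L })) (t∈ , t≢q) (λ z → proj₂ (proj₁ z) p∈L)
        ... | exiting {v} {u} v∈ u∈ u∉ e _ with u ∈? L
        ...   | yes u∈L = climb (card S) v (proj₁ v∈) (proj₂ v∈) (touch u∈L refl (E-sym e)) (m≤m+n _ _)
        ...   | no u∉L  = ⊥-elim (u∉ ((proj₁ u∈ , u∉L) , proj₂ u∈))

    abstract
      -- Vertices move into `L` one at a time until the next one lies in `T`. Since an element of
      -- `T` stops the process, `t` stays outside, and so a vertex other than `q` is always left for
      -- `nextVertex`.
      grow : ∀ T L → L ⊆ N → Conn L → p ∈ L → q ∉ L → WConn (N ∖ L) →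
             ∀ t → t ∈ T → t ∈ N ∖ L → t ≢ q → Grown N L T q
      grow T L₀ L₀⊆ c₀ p∈ q∉ co₀ t t∈T t∈ t≢q = go (card (N ∖ L₀)) L₀ ≤-refl (λ _ → id) L₀⊆ c₀ p∈ q∉ co₀ t∈ (λ x x∈ _ → x∈)
        where
        go : ∀ k L → card (N ∖ L) ≤ k → L₀ ⊆ L → L ⊆ N → Conn L → p ∈ L → q ∉ L → WConn (N ∖ L) →
             t ∈ N ∖ L → (∀ x → x ∈ L → x ∈ T → x ∈ L₀) → Grown N L₀ T q
        go k L le L₀⊆L L⊆ c p∈ q∉ co t∈ nn with nextVertex L L⊆ p∈ q∉ co t t∈ t≢q
        ... | next v v∈ v≢q tc cov with v ∈? T
        ...   | yes v∈T = record { L⁺ = L ; v = v ; L⊆ = L₀⊆L ; L⁺⊆ = L⊆ ; q∉ = q∉ ; v∈T = v∈T ; v∈ = v∈ ; v≢q = v≢q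
                                 ; conn = c ; co-conn = co ; touches = tc ; co-conn-v = cov ; no-new = nn }
        go zero L le L₀⊆L L⊆ c p∈ q∉ co t∈ nn | next v v∈ v≢q tc cov | no v∉T = ⊥-elim (card-0 (N ∖ L) v v∈ le)
        go (suc k) L le L₀⊆L L⊆ c p∈ q∉ co t∈ nn | next v v∈ v≢q tc cov | no v∉T =
          go k (L ∪ ｛ v ｝)
            (card-drop (N ∖ (L ∪ ｛ v ｝)) (N ∖ L) (λ x z → proj₁ z , proj₂ z ∘ inj₁) v v∈ (λ z → proj₂ z (inj₂ refl)) le)
            (λ x → inj₁ ∘ L₀⊆L x)
            (λ { x (inj₁ l) → L⊆ x l ; x (inj₂ refl) → proj₁ v∈ })
            (Conn-touch c (Conn-single v) tc)
            (inj₁ p∈)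
            [ q∉ , v≢q ∘ sym ]
            (WConn-≐ ((N ∖ L) - v) (N ∖ (L ∪ ｛ v ｝))
              (λ x z → proj₁ (proj₁ z) , [ proj₂ (proj₁ z) , proj₂ z ])
              (λ x z → (proj₁ z , proj₂ z ∘ inj₁) , proj₂ z ∘ inj₂) cov)
            (proj₁ t∈ , [ proj₂ t∈ , (λ { refl → v∉T t∈T }) ])
            (λ { x (inj₁ l) x∈T → nn x l x∈T ; x (inj₂ refl) x∈T → ⊥-elim (v∉T x∈T) })

  record Halves (O K R : DSet n) : Set where
    field
      K⊆ : K ⊆ O
      R⊆ : R ⊆ O
      KR : Disj K R
      spans : ∀ x → x ∈ O → x ∈ K ⊎ x ∈ R
      Kconn : Conn K
      Rconn : Conn R

  module CutOff {O K R} (2c : TwoConn O) (H : Halves O K R) (c w : Fin n) (c∈ : c ∈ K) (w∈ : w ∈ K - c) where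
    open Halves H
    D = comp (K - c) w

    D⊆K : D ⊆ K
    D⊆K x d = proj₁ (end∈ d)

    D∌c : c ∉ D
    D∌c d = proj₂ (end∈ d) refl

    touches-far : Touch D R
    touches-far with Rconn
    ... | (r , r∈) , _ with exit (O - c) D
            (TwoConn.cut 2c c (K⊆ c c∈) w r (K⊆ w (proj₁ w∈) , proj₂ w∈) (R⊆ r r∈ , λ { refl → KR r c∈ r∈ }))
            (stop w∈) (λ d → KR r (D⊆K r d) r∈)
    ...   | exiting {a} {b} a∈ b∈ b∉ e _ with spans b (proj₁ b∈)
    ...     | inj₁ b∈K = ⊥-elim (b∉ (comp-closed (K - c) w a∈ (b∈K , proj₂ b∈) e))
    ...     | inj₂ b∈R = touch a∈ b∈R e

    touches-c : Touch D ｛ c ｝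
    touches-c with exit K D (proj₂ Kconn w c (proj₁ w∈) c∈) (stop w∈) D∌c
    ... | exiting {a} {b} a∈ b∈ b∉ e _ with b ≟ c
    ...   | yes b≡c = touch a∈ b≡c e
    ...   | no b≢c  = ⊥-elim (b∉ (comp-closed (K - c) w a∈ (b∈ , b≢c) e))

    -- `D` is joined to the rest of `K` only at `c`. A walk inside `K` can therefore enter `D` only
    -- from `c`, and it may be cut short there.
    retreat : ∀ S → S ⊆ K → ∀ {x} → x ∉ D → Walk S x c → Walk (S ∖ D) x c
    retreat S s x∉ (stop c∈S) = stop (c∈S , x∉)
    retreat S s x∉ (step {x} {y} x∈ e v) with y ∈? D
    ... | no y∉  = step (x∈ , x∉) e (retreat S s y∉ v)
    ... | yes y∈ with x ≟ c
    ...   | yes refl = stop (x∈ , x∉)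
    ...   | no x≢c   = ⊥-elim (x∉ (comp-closed (K - c) w y∈ (s _ x∈ , x≢c) (E-sym e)))

    keep-WConn : ∀ S → S ⊆ K → c ∈ S → WConn S → WConn (S ∖ D)
    keep-WConn S s c∈S cs x y x∈ y∈ =
      retreat S s (proj₂ x∈) (cs x c (proj₁ x∈) c∈S) ◅◅
      reverse (retreat S s (proj₂ y∈) (cs y c (proj₁ y∈) c∈S))

    moved : Halves O (K ∖ D) (R ∪ D)
    moved = record
      { K⊆ = λ x → K⊆ x ∘ proj₁
      ; R⊆ = λ { x (inj₁ r) → R⊆ x r ; x (inj₂ d) → K⊆ x (D⊆K x d) }
      ; KR = λ { x k (inj₁ r) → KR x (proj₁ k) r ; x k (inj₂ d) → proj₂ k d }
      ; spans = spans′
      ; Kconn = (c , c∈ , D∌c) , keep-WConn K (λ _ → id) c∈ (proj₂ Kconn)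
      ; Rconn = Conn-touch Rconn (comp-conn (K - c) w w∈) (Touch-sym touches-far) }
      where
      spans′ : ∀ x → x ∈ O → x ∈ K ∖ D ⊎ x ∈ R ∪ D
      spans′ x x∈ with x ∈? D | spans x x∈
      ... | yes d | _ = inj₂ (inj₂ d)
      ... | no ¬d | inj₁ k = inj₁ (k , ¬d)
      ... | no ¬d | inj₂ r = inj₂ (inj₁ r)

  record Blob (O K U : DSet n) : Set₁ where
    field
      B       : DSet n
      U⊆      : U ⊆ B
      B⊆      : B ⊆ K
      conn    : Conn B
      cut     : ∀ c → c ∈ B → WConn (B - c)
      co-conn : Conn (O ∖ B)

  abstract
    -- A cut vertex `c` of `K` lies outside `U`, so the connected set `U` misses a component of
    -- `K - c`. This component reaches the other half and is moved over to it. When no cut vertex is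
    -- left, `U` is still inside and the complement is still connected.
    blobAround : ∀ {O K R} → TwoConn O → Halves O K R → ∀ U → Conn U → U ⊆ K →
                 (∀ c → c ∈ U → WConn (K - c)) → Blob O K U
    blobAround {O} {K₀} {R₀} 2c H₀ U cU = λ s → go (card K₀) K₀ R₀ ≤-refl (λ _ → id) H₀ s
      where
      go : ∀ k K R → card K ≤ k → K ⊆ K₀ → Halves O K R → U ⊆ K → (∀ c → c ∈ U → WConn (K - c)) → Blob O K₀ U
      go k K R le K⊆K₀ H U⊆K uncut with any? (λ c → (c ∈? K) ×-dec ¬? (WConn? (K - c)))
      go k K R le K⊆K₀ H U⊆K uncut | no none = record
        { B = K ; U⊆ = U⊆K ; B⊆ = K⊆K₀ ; conn = Kconn ; cut = cutK
        ; co-conn = Conn-≐ R (O ∖ K) (λ x r → R⊆ x r , λ k → KR x k r) (λ x z → [ ⊥-elim ∘ proj₂ z , id ] (spans x (proj₁ z))) Rconn }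
        where
        open Halves H
        cutK : ∀ c → c ∈ K → WConn (K - c)
        cutK c c∈ with WConn? (K - c)
        ... | yes w = w
        ... | no ¬w = ⊥-elim (none (c , c∈ , ¬w))
      go k K R le K⊆K₀ H U⊆K uncut | yes (c , c∈ , ¬w) with c ∈? U
      ... | yes c∈U = ⊥-elim (¬w (uncut c c∈U))
      ... | no c∉U with away (K - c) U ¬w (proj₂ cU) (λ x u → U⊆K x u , λ { refl → c∉U u })
      go zero K R le K⊆K₀ H U⊆K uncut | yes (c , c∈ , ¬w) | no c∉U | _ = ⊥-elim (card-0 K c c∈ le)
      go (suc k) K R le K⊆K₀ H U⊆K uncut | yes (c , c∈ , ¬w) | no c∉U | w , w∈ , dj =
        go k (K ∖ D) (R ∪ D)
          (card-drop (K ∖ D) K (λ _ → proj₁) w (proj₁ w∈) (λ z → proj₂ z (stop w∈)) le)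
          (λ x → K⊆K₀ x ∘ proj₁) moved (λ x u → U⊆K x u , λ d → dj x d u)
          -- That no vertex `u` of `U` separates `K` is inherited: `c` survives in `K - u`, and `D`
          -- hangs on the rest only at `c`.
          (λ u u∈U → WConn-≐ ((K - u) ∖ D) ((K ∖ D) - u)
            (λ x z → (proj₁ (proj₁ z) , proj₂ z) , proj₂ (proj₁ z))
            (λ x z → (proj₁ (proj₁ z) , proj₂ z) , proj₂ (proj₁ z))
            (keep-WConn (K - u) (λ _ → proj₁) (c∈ , λ { refl → c∉U u∈U }) (uncut u u∈U)))
        where open CutOff 2c H c w c∈ w∈

module Structure {n : ℕ} (E : Fin n → Fin n → Set) (E? : ∀ x y → Dec (E x y))
                 (E-sym : ∀ {x y} → E x y → E y x) where
  open Separation E E? E-sym public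

  -- Tree models

  -- Tr P h R S: a model of Γ_h with root bag R and support S, where a leaf with root bag R′ and
  -- support S′ satisfies P R′ S′ (so a leaf may itself stand for a whole subtree).
  data Tr (P : DSet n → DSet n → Set₁) : ℕ → DSet n → DSet n → Set₁ where
    leaf : ∀ {R S} → P R S → Tr P 0 R S
    node : ∀ {h R R₁ S₁ R₂ S₂} → Conn R → Tr P h R₁ S₁ → Tr P h R₂ S₂ → Touch R R₁ → Touch R R₂ →
           Disj R S₁ → Disj R S₂ → Disj S₁ S₂ → Tr P (suc h) R (R ∪ (S₁ ∪ S₂))

  Bag : DSet n → DSet n → Set₁
  Bag R S = R ≡ S × Conn S

  TouchBag : DSet n → DSet n → DSet n → Set₁
  TouchBag A R S = R ≡ S × Conn S × Touch S A

  record Shape (R S : DSet n) : Set where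
    constructor shape
    field
      root⊆     : R ⊆ S
      root-conn : Conn R
      supp-conn : Conn S
  open Shape public

  Bag-shape : ∀ R S → Bag R S → Shape R S
  Bag-shape R .R (refl , c) = shape (λ _ → id) c c

  TouchBag-shape : ∀ A R S → TouchBag A R S → Shape R S
  TouchBag-shape A R .R (refl , c , _) = shape (λ _ → id) c c

  Tr-shape : ∀ {P} → (∀ R S → P R S → Shape R S) → ∀ {h} R S → Tr P h R S → Shape R S
  Tr-shape f R S (leaf p) = f R S p
  Tr-shape f R _ (node {R₁ = R₁} {S₁} {R₂} {S₂} c t₁ t₂ x₁ x₂ _ _ _)
    with shape r₁ _ c₁ ← Tr-shape f R₁ S₁ t₁ | shape r₂ _ c₂ ← Tr-shape f R₂ S₂ t₂ =
    shape (λ _ → inj₁) c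
      (Conn-≐ ((R ∪ S₁) ∪ (R ∪ S₂)) (R ∪ (S₁ ∪ S₂))
        (λ { _ (inj₁ (inj₁ r)) → inj₁ r ; _ (inj₁ (inj₂ s)) → inj₂ (inj₁ s) ; _ (inj₂ (inj₁ r)) → inj₁ r ; _ (inj₂ (inj₂ s)) → inj₂ (inj₂ s) })
        (λ { _ (inj₁ r) → inj₁ (inj₁ r) ; _ (inj₂ (inj₁ s)) → inj₁ (inj₂ s) ; _ (inj₂ (inj₂ s)) → inj₂ (inj₂ s) })
        (Conn-share
          (Conn-touch c c₁ (Touch-mono (λ _ → id) r₁ x₁))
          (Conn-touch c c₂ (Touch-mono (λ _ → id) r₂ x₂))
          (proj₁ (proj₁ c)) (inj₁ (proj₂ (proj₁ c))) (inj₁ (proj₂ (proj₁ c)))))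

  Tr-map : ∀ {P Q} → (∀ R S → P R S → Q R S) → ∀ {h R S} → Tr P h R S → Tr Q h R S
  Tr-map f (leaf p) = leaf (f _ _ p)
  Tr-map f (node c t₁ t₂ x₁ x₂ d₁ d₂ d₃) = node c (Tr-map f t₁) (Tr-map f t₂) x₁ x₂ d₁ d₂ d₃

  nest : ∀ {P} a b {R S} → Tr P (a + b) R S → Tr (Tr P b) a R S
  nest zero b t = leaf t
  nest (suc a) b (node c t₁ t₂ x₁ x₂ d₁ d₂ d₃) = node c (nest a b t₁) (nest a b t₂) x₁ x₂ d₁ d₂ d₃

  record Apex (ℓ : ℕ) : Set₁ where
    constructor apex
    field
      {A R S} : DSet n
      A-conn  : Conn A
      S∌A     : Disj S A
      tree    : Tr (TouchBag A) ℓ R S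

  -- For each leaf of the tree: if K - c is disconnected for some c in its support, then a component
  -- of K - c lies away from the rest of the tree and reaches the other half of O; otherwise the
  -- support lies inside a 2-connected part of K.
  module _ {O K R : DSet n} (2c : TwoConn O) (H : Halves O K R)
           {P : DSet n → DSet n → Set₁} (P-shape : ∀ R S → P R S → Shape R S) where
    open Halves H

    HeavyBlob : Set₁
    HeavyBlob = ∃₂ λ R′ S′ → P R′ S′ × Blob O K S′

    record Reaching (j : ℕ) (R₀ Out : DSet n) : Set₁ where
      constructor reaching
      field
        {R′ S′} : DSet n
        tree    : Tr (TouchBag R) j R′ S′
        R₀⊆     : R₀ ⊆ R′
        S′⊆     : S′ ⊆ K
        Out∌    : Disj Out S′

    abstract
      -- `Out` is the part of the model outside the current subtree. At a leaf its connectedness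
      -- lets `away` find a component of `K - c` disjoint from it. Connectedness of `Out ∪ R₀` is
      -- what makes the outside of each child connected in turn.
      blobOrReach : ∀ j {R₀ S₀} → Tr P j R₀ S₀ → S₀ ⊆ K → ∀ Out → Out ⊆ K → WConn Out → WConn (Out ∪ R₀) →
                    Disj Out S₀ → HeavyBlob ⊎ Reaching j R₀ Out
      blobOrReach zero {R₀} {S₀} (leaf p) S₀⊆ Out Out⊆ wo wor dj
        with any? (λ c → (c ∈? S₀) ×-dec ¬? (WConn? (K - c)))
      ... | no none = inj₁ (R₀ , S₀ , p , blobAround 2c H S₀ (supp-conn (P-shape R₀ S₀ p)) S₀⊆ uncut)
        where
        uncut : ∀ c → c ∈ S₀ → WConn (K - c)
        uncut c c∈ with WConn? (K - c)
        ... | yes w = w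
        ... | no ¬w = ⊥-elim (none (c , c∈ , ¬w))
      ... | yes (c , c∈ , ¬w) with away (K - c) Out ¬w wo (λ x o → Out⊆ x o , λ { refl → dj c o c∈ })
      ...   | w , w∈ , dj′ = inj₂ (reaching
                (leaf (refl , Conn-touch (supp-conn sh) (comp-conn (K - c) w w∈) (Touch-sym (Touch-mono (λ _ → id) (λ { _ refl → c∈ }) touches-c))
                            , Touch-mono (λ _ → inj₂) (λ _ → id) touches-far))
                (λ x r → inj₁ (root⊆ sh x r))
                (∪-least S₀ D K S₀⊆ D⊆K)
                (λ { x o (inj₁ s) → dj x o s ; x o (inj₂ d) → dj′ x d o }))
        where
        open CutOff 2c H c w (S₀⊆ c c∈) w∈
        sh : Shape R₀ S₀
        sh = P-shape R₀ S₀ p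
      blobOrReach (suc j) {Rt} (node {R₁ = R₁} {S₁} {R₂} {S₂} c t₁ t₂ x₁ x₂ d₁ d₂ d₃) S₀⊆ Out Out⊆ wo wor dj =
        afterLeft (blobOrReach j t₁ (λ x → S₀⊆ x ∘ inj₂ ∘ inj₁) Outˡ
          (∪-least (Out ∪ Rt) S₂ K (∪-least Out Rt K Out⊆ (λ x → S₀⊆ x ∘ inj₁)) (λ x → S₀⊆ x ∘ inj₂ ∘ inj₂))
          woˡ
          (WConn-touch woˡ (proj₂ (root-conn sh₁)) (Touch-mono (λ _ → inj₁ ∘ inj₂) (λ _ → id) x₁))
          (λ { x (inj₁ (inj₁ o)) s → dj x o (inj₂ (inj₁ s)) ; x (inj₁ (inj₂ r)) s → d₁ x r s ; x (inj₂ s₂) s → d₃ x s s₂ }))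
        where
        sh₁ : Shape R₁ S₁
        sh₁ = Tr-shape P-shape R₁ S₁ t₁
        sh₂ : Shape R₂ S₂
        sh₂ = Tr-shape P-shape R₂ S₂ t₂
        Outˡ : DSet n
        Outˡ = (Out ∪ Rt) ∪ S₂
        woˡ : WConn Outˡ
        woˡ = WConn-touch wor (proj₂ (supp-conn sh₂)) (Touch-mono (λ _ → inj₂) (root⊆ sh₂) x₂)
        afterLeft : HeavyBlob ⊎ Reaching j R₁ Outˡ → HeavyBlob ⊎ Reaching (suc j) Rt Out
        afterLeft (inj₁ b) = inj₁ b
        afterLeft (inj₂ (reaching {R₁′} {S₁′} t₁′ R₁⊆ S₁′⊆ dj₁)) =
          afterRight (blobOrReach j t₂ (λ x → S₀⊆ x ∘ inj₂ ∘ inj₂) Outʳ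
            (∪-least (Out ∪ Rt) S₁′ K (∪-least Out Rt K Out⊆ (λ x → S₀⊆ x ∘ inj₁)) S₁′⊆)
            woʳ
            (WConn-touch woʳ (proj₂ (root-conn sh₂)) (Touch-mono (λ _ → inj₁ ∘ inj₂) (λ _ → id) x₂))
            (λ { x (inj₁ (inj₁ o)) s → dj x o (inj₂ (inj₂ s)) ; x (inj₁ (inj₂ r)) s → d₂ x r s ; x (inj₂ s₁) s → dj₁ x (inj₂ s) s₁ }))
          where
          sh₁′ : Shape R₁′ S₁′
          sh₁′ = Tr-shape (TouchBag-shape R) R₁′ S₁′ t₁′
          -- The left subtree enters together with the components it has just acquired, so whatever
          -- is attached on the right avoids them.
          Outʳ : DSet n
          Outʳ = (Out ∪ Rt) ∪ S₁′
          woʳ : WConn Outʳ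
          woʳ = WConn-touch wor (proj₂ (supp-conn sh₁′))
                  (Touch-mono (λ _ → inj₂) (λ x → root⊆ sh₁′ x ∘ R₁⊆ x) x₁)
          afterRight : HeavyBlob ⊎ Reaching j R₂ Outʳ → HeavyBlob ⊎ Reaching (suc j) Rt Out
          afterRight (inj₁ b) = inj₁ b
          afterRight (inj₂ (reaching {R₂′} {S₂′} t₂′ R₂⊆ S₂′⊆ dj₂)) = inj₂ (reaching
            (node c t₁′ t₂′ (Touch-mono (λ _ → id) R₁⊆ x₁) (Touch-mono (λ _ → id) R₂⊆ x₂)
              (λ x r → dj₁ x (inj₁ (inj₂ r))) (λ x r → dj₂ x (inj₁ (inj₂ r))) (λ x s → dj₂ x (inj₂ s)))
            (λ _ → id)
            (∪-least Rt (S₁′ ∪ S₂′) K (λ x → S₀⊆ x ∘ inj₁) (∪-least S₁′ S₂′ K S₁′⊆ S₂′⊆))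
            (λ { x o (inj₁ r) → dj x o (inj₁ r) ; x o (inj₂ (inj₁ s)) → dj₁ x (inj₁ (inj₁ o)) s ; x o (inj₂ (inj₂ s)) → dj₂ x (inj₁ (inj₁ o)) s }))

  record Added (h : ℕ) (R S : DSet n) (v : Fin n) : Set₁ where
    constructor added
    field
      {R′ S′} : DSet n
      tree    : Tr Bag h R′ S′
      R⊆      : R ⊆ R′
      S⊆      : S ⊆ S′
      v∈      : v ∈ S′
      only    : S′ ⊆ S ∪ ｛ v ｝

  addVertex : ∀ {h R S} → Tr Bag h R S → ∀ v → v ∉ S → Touch S ｛ v ｝ → Added h R S v
  addVertex {R = R} (leaf (refl , c)) v v∉ t = added (leaf (refl , Conn-touch c (Conn-single v) t))
    (λ _ → inj₁) (λ _ → inj₁) (inj₂ refl) (λ _ → id)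
  addVertex (node {R = R} {R₁} {S₁} {R₂} {S₂} c t₁ t₂ x₁ x₂ d₁ d₂ d₃) v v∉ (touch (inj₁ r) refl e) = added
    (node (Conn-touch c (Conn-single v) (touch r refl e)) t₁ t₂
      (Touch-mono (λ _ → inj₁) (λ _ → id) x₁) (Touch-mono (λ _ → inj₁) (λ _ → id) x₂)
      (Disj-∪ R ｛ v ｝ S₁ d₁ (λ { _ refl s → v∉ (inj₂ (inj₁ s)) }))
      (Disj-∪ R ｛ v ｝ S₂ d₂ (λ { _ refl s → v∉ (inj₂ (inj₂ s)) })) d₃)
    (λ _ → inj₁) (λ { _ (inj₁ r) → inj₁ (inj₁ r) ; _ (inj₂ s) → inj₂ s }) (inj₁ (inj₂ refl))
    (λ { _ (inj₁ (inj₁ r)) → inj₁ (inj₁ r) ; _ (inj₁ (inj₂ e)) → inj₂ e ; _ (inj₂ s) → inj₁ (inj₂ s) })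
  addVertex (node {R = R} {R₁} {S₁} {R₂} {S₂} c t₁ t₂ x₁ x₂ d₁ d₂ d₃) v v∉ (touch (inj₂ (inj₁ s)) refl e)
    with added {R₁′} {S₁′} t₁′ R⊆ S⊆ v∈ only ← addVertex t₁ v (v∉ ∘ inj₂ ∘ inj₁) (touch s refl e) = added
    (node c t₁′ t₂ (Touch-mono (λ _ → id) R⊆ x₁) x₂
      (λ x r s′ → [ d₁ x r , (λ { refl → v∉ (inj₁ r) }) ] (only x s′)) d₂
      (λ x s′ s₂ → [ (λ s₁ → d₃ x s₁ s₂) , (λ { refl → v∉ (inj₂ (inj₂ s₂)) }) ] (only x s′)))
    (λ _ → id) (λ { _ (inj₁ r) → inj₁ r ; x (inj₂ (inj₁ s)) → inj₂ (inj₁ (S⊆ x s)) ; _ (inj₂ (inj₂ s)) → inj₂ (inj₂ s) })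
    (inj₂ (inj₁ v∈))
    (λ { _ (inj₁ r) → inj₁ (inj₁ r) ; x (inj₂ (inj₁ s)) → [ inj₁ ∘ inj₂ ∘ inj₁ , inj₂ ] (only x s) ; _ (inj₂ (inj₂ s)) → inj₁ (inj₂ (inj₂ s)) })
  addVertex (node {R = R} {R₁} {S₁} {R₂} {S₂} c t₁ t₂ x₁ x₂ d₁ d₂ d₃) v v∉ (touch (inj₂ (inj₂ s)) refl e)
    with added {R₂′} {S₂′} t₂′ R⊆ S⊆ v∈ only ← addVertex t₂ v (v∉ ∘ inj₂ ∘ inj₂) (touch s refl e) = added
    (node c t₁ t₂′ x₁ (Touch-mono (λ _ → id) R⊆ x₂) d₁
      (λ x r s′ → [ d₂ x r , (λ { refl → v∉ (inj₁ r) }) ] (only x s′))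
      (λ x s₁ s′ → [ d₃ x s₁ , (λ { refl → v∉ (inj₂ (inj₁ s₁)) }) ] (only x s′)))
    (λ _ → id) (λ { _ (inj₁ r) → inj₁ r ; _ (inj₂ (inj₁ s)) → inj₂ (inj₁ s) ; x (inj₂ (inj₂ s)) → inj₂ (inj₂ (S⊆ x s)) })
    (inj₂ (inj₂ v∈))
    (λ { _ (inj₁ r) → inj₁ (inj₁ r) ; _ (inj₂ (inj₁ s)) → inj₁ (inj₂ (inj₁ s)) ; x (inj₂ (inj₂ s)) → [ inj₁ ∘ inj₂ ∘ inj₂ , inj₂ ] (only x s) })

  record TreeIn (O : DSet n) (h : ℕ) : Set₁ where
    constructor treeIn
    field
      {R S} : DSet n
      tree  : Tr Bag h R S
      S⊆    : S ⊆ O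

  abstract
    -- A vertex next to the support can be added to a bag it touches, so a model can be made to
    -- cover `O`. The complement of a subtree is then made up of other bags, which is how it becomes
    -- connected.
    spanning : ∀ {O h} → Conn O → TreeIn O h → ∃ λ (t : TreeIn O h) → O ⊆ TreeIn.S t
    spanning {O} {h} co t₀ = go (card (O ∖ TreeIn.S t₀)) t₀ ≤-refl
      where
      go : ∀ k (t : TreeIn O h) → card (O ∖ TreeIn.S t) ≤ k → ∃ λ (t : TreeIn O h) → O ⊆ TreeIn.S t
      go k t@(treeIn {R} {S} tr S⊆) le with any? (has? (O ∖ S))
      ... | no none = t , spans
        where
        spans : O ⊆ S
        spans x x∈ with x ∈? S
        ... | yes s = s
        ... | no ¬s = ⊥-elim (none (x , x∈ , ¬s))
      ... | yes (y , y∈ , y∉) with supp-conn (Tr-shape Bag-shape R S tr)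
      ...   | (s , s∈) , _ with exit O S (proj₂ co s y (S⊆ s s∈) y∈) s∈ y∉
      ...     | exiting {a} {v} a∈ v∈ v∉ e _ with addVertex tr v v∉ (touch a∈ refl e)
      go zero t@(treeIn {R} {S} tr S⊆) le | yes (y , y∈ , y∉) | (s , s∈) , _ | exiting {a} {v} a∈ v∈ v∉ e _ | _ = ⊥-elim (card-0 (O ∖ S) v (v∈ , v∉) le)
      go (suc k) t@(treeIn {R} {S} tr S⊆) le | yes (y , y∈ , y∉) | (s , s∈) , _ | exiting {a} {v} a∈ v∈ v∉ e _
        | added {R′} {S′} tr′ _ S⊆S′ v∈′ only =
        go k (treeIn tr′ (λ x s → [ S⊆ x , (λ { refl → v∈ }) ] (only x s)))
          (card-drop (O ∖ S′) (O ∖ S) (λ x z → proj₁ z , proj₂ z ∘ S⊆S′ x) v (v∈ , v∉) (λ z → proj₂ z v∈′) le)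

  -- `attached` is the invariant that preserves `rest` on the way down: the complement of a child's
  -- support consists of the complement of the parent's support, the parent's root bag and the
  -- sibling, which hangs on that root bag.
  record Branch (O : DSet n) (h : ℕ) : Set₁ where
    constructor branch
    field
      {R S}    : DSet n
      tree     : Tr Bag h R S
      S⊆       : S ⊆ O
      rest     : WConn (O ∖ S)
      attached : WConn ((O ∖ S) ∪ R)

  rootBranch : ∀ {O h} → Conn O → TreeIn O h → Branch O h
  rootBranch {O} co t₀ with spanning co t₀
  ... | treeIn {R} {S} tr S⊆ , spans = branch tr S⊆ (λ x y z → ⊥-elim (proj₂ z (spans x (proj₁ z))))
    (WConn-≐ R ((O ∖ S) ∪ R) (λ _ → inj₂) (λ { x (inj₁ z) → ⊥-elim (proj₂ z (spans x (proj₁ z))) ; x (inj₂ r) → r })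
      (proj₂ (root-conn (Tr-shape Bag-shape R S tr))))

  record Fork (O : DSet n) (h : ℕ) (U : DSet n) : Set₁ where
    constructor fork
    field
      left right : Branch O h
      left⊆      : Branch.S left ⊆ U
      right⊆     : Branch.S right ⊆ U
      apart      : Disj (Branch.S left) (Branch.S right)

  children : ∀ {O h} (b : Branch O (suc h)) → Fork O h (Branch.S b)
  children {O} (branch {R} (node {R₁ = R₁} {S₁} {R₂} {S₂} c t₁ t₂ x₁ x₂ d₁ d₂ d₃) S⊆ rest att) =
    fork (side t₁ t₂ x₁ x₂ d₁ d₃ att (λ x → S⊆ x ∘ inj₁) (λ x → S⊆ x ∘ inj₂ ∘ inj₁) (λ x → S⊆ x ∘ inj₂ ∘ inj₂))
         (side t₂ t₁ x₂ x₁ d₂ (λ x s s′ → d₃ x s′ s)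
           (WConn-≐ ((O ∖ (R ∪ (S₁ ∪ S₂))) ∪ R) ((O ∖ (R ∪ (S₂ ∪ S₁))) ∪ R)
             (λ { x (inj₁ (o , ¬z)) → inj₁ (o , ¬z ∘ swap∪) ; x (inj₂ r) → inj₂ r })
             (λ { x (inj₁ (o , ¬z)) → inj₁ (o , ¬z ∘ swap∪) ; x (inj₂ r) → inj₂ r }) att)
           (λ x → S⊆ x ∘ inj₁) (λ x → S⊆ x ∘ inj₂ ∘ inj₂) (λ x → S⊆ x ∘ inj₂ ∘ inj₁))
         (λ _ → inj₂ ∘ inj₁) (λ _ → inj₂ ∘ inj₂) d₃
    where
    swap∪ : ∀ {X Y Z : Set} → X ⊎ (Y ⊎ Z) → X ⊎ (Z ⊎ Y)
    swap∪ = [ inj₁ , [ inj₂ ∘ inj₂ , inj₂ ∘ inj₁ ] ]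
    side : ∀ {h R R₁ S₁ R₂ S₂} → Tr Bag h R₁ S₁ → Tr Bag h R₂ S₂ → Touch R R₁ → Touch R R₂ → Disj R S₁ → Disj S₁ S₂ →
           WConn ((O ∖ (R ∪ (S₁ ∪ S₂))) ∪ R) → R ⊆ O → S₁ ⊆ O → S₂ ⊆ O → Branch O h
    side {R = R} {R₁} {S₁} {R₂} {S₂} t₁ t₂ x₁ x₂ d₁ d₃ att R⊆ S₁⊆ S₂⊆ = branch t₁ S₁⊆ co
      (WConn-touch co (proj₂ (root-conn sh₁)) (Touch-mono (λ x r → R⊆ x r , d₁ x r) (λ _ → id) x₁))
      where
      sh₁ = Tr-shape Bag-shape R₁ S₁ t₁
      sh₂ = Tr-shape Bag-shape R₂ S₂ t₂
      Z = (O ∖ (R ∪ (S₁ ∪ S₂))) ∪ R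
      to : O ∖ S₁ ⊆ Z ∪ S₂
      to x (o , ¬s₁) with x ∈? R | x ∈? S₂
      ... | yes r | _ = inj₁ (inj₂ r)
      ... | no _ | yes s₂ = inj₂ s₂
      ... | no ¬r | no ¬s₂ = inj₁ (inj₁ (o , [ ¬r , [ ¬s₁ , ¬s₂ ] ]))
      co : WConn (O ∖ S₁)
      co = WConn-≐ (Z ∪ S₂) (O ∖ S₁)
        (λ { x (inj₁ (inj₁ (o , ¬z))) → o , ¬z ∘ inj₂ ∘ inj₁ ; x (inj₁ (inj₂ r)) → R⊆ x r , d₁ x r
           ; x (inj₂ s₂) → S₂⊆ x s₂ , λ s₁ → d₃ x s₁ s₂ }) to
        (WConn-touch att (proj₂ (supp-conn sh₂)) (Touch-mono (λ _ → inj₂) (root⊆ sh₂) x₂))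

  avoiding : ∀ {O h} (b : Branch O (suc h)) v → ∃ λ (b′ : Branch O h) → v ∉ Branch.S b′ × Branch.S b′ ⊆ Branch.S b
  avoiding b v with children b
  ... | fork l r l⊆ r⊆ ap with v ∈? Branch.S l
  ...   | no v∉  = l , v∉ , l⊆
  ...   | yes v∈ = r , ap v v∈ , r⊆

  avoidingTwo : ∀ {O h} (b : Branch O (2 + h)) p q →
                ∃ λ (b′ : Branch O h) → p ∉ Branch.S b′ × q ∉ Branch.S b′ × Branch.S b′ ⊆ Branch.S b
  avoidingTwo b p q with avoiding b p
  ... | b₁ , p∉ , s₁ with avoiding b₁ q
  ...   | b₂ , q∉ , s₂ = b₂ , p∉ ∘ s₂ p , q∉ , λ x → s₁ x ∘ s₂ x

  record HeavyIn (O U : DSet n) (h : ℕ) : Set₁ where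
    constructor heavyIn
    field
      B       : DSet n
      B⊆O     : B ⊆ O
      B⊆U     : B ⊆ U
      two     : TwoConn B
      tree    : TreeIn B h
      co-conn : Conn (O ∖ B)

  abstract
    -- The two halves are `S` and its complement, which `p` keeps non-empty and which becomes the
    -- apex in the first outcome. The model is cut at depth `ℓ`; the subtrees below have height
    -- `suc h`, and the three disjoint parts of such a subtree supply three vertices of the blob.
    heavyBlob : ∀ {O} ℓ h → TwoConn O → (b : Branch O (ℓ + suc h)) → ∀ p → p ∈ O → p ∉ Branch.S b →
                Apex ℓ ⊎ HeavyIn O (Branch.S b) (suc h)
    heavyBlob {O} ℓ h 2c (branch {R} {S} tr S⊆ rest att) p p∈ p∉
      with blobOrReach 2c halves (Tr-shape Bag-shape) ℓ (nest ℓ (suc h) tr) (λ _ → id) None (λ _ ()) (λ _ _ ())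
             (λ { x y (inj₂ a) (inj₂ b) → widen R (None ∪ R) (λ _ → inj₂) (proj₂ (root-conn sh) x y a b) }) (λ _ ())
      where
      sh : Shape R S
      sh = Tr-shape Bag-shape R S tr
      split : ∀ x → x ∈ O → x ∈ S ⊎ x ∈ O ∖ S
      split x x∈ with x ∈? S
      ... | yes s = inj₁ s
      ... | no ¬s = inj₂ (x∈ , ¬s)
      halves : Halves O S (O ∖ S)
      halves = record { K⊆ = S⊆ ; R⊆ = λ _ → proj₁ ; KR = λ _ s z → proj₂ z s ; spans = split
                      ; Kconn = supp-conn sh ; Rconn = (p , p∈ , p∉) , rest }
    ... | inj₁ (R′ , S′ , t′ , blob) = inj₂ (heavyIn B (λ x → S⊆ x ∘ B⊆ x) B⊆
            (record { conn = conn ; cut = cut ; third = third t′ U⊆ }) (treeIn t′ U⊆) co-conn)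
      where
      open Blob blob
      third : ∀ {R′ S′} → Tr Bag (suc h) R′ S′ → S′ ⊆ B → ∀ p q → ∃ λ r → r ∈ B × r ≢ p × r ≢ q
      third (node {R₁ = R₁} {S₁} {R₂} {S₂} ((a , a∈) , _) t₁ t₂ _ _ d₁ d₂ d₃) s
        with supp-conn (Tr-shape Bag-shape R₁ S₁ t₁) | supp-conn (Tr-shape Bag-shape R₂ S₂ t₂)
      ... | (b , b∈) , _ | (c , c∈) , _ = threeElements B (s a (inj₁ a∈)) (s b (inj₂ (inj₁ b∈))) (s c (inj₂ (inj₂ c∈)))
        (λ { refl → d₁ a a∈ b∈ }) (λ { refl → d₂ a a∈ c∈ }) (λ { refl → d₃ b b∈ c∈ })
    ... | inj₂ (reaching {R′} {S′} t′ _ S′⊆ _) = inj₁ (apex ((p , p∈ , p∉) , rest) (λ x s z → proj₂ z (S′⊆ x s)) t′)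

  -- Contracting blobs, ears

  -- The contracted graph keeps the vertex type: its nodes are the fixed points of `rep`, and `F`
  -- comes from the edges between fibres. Sets of nodes are thus sets of vertices, and on a `Thin`
  -- set, where fibres are single vertices, walks of the contraction are walks of the graph.
  module Quotient (O : DSet n) (rep : Fin n → Fin n) (idem : ∀ u → rep (rep u) ≡ rep u)
                  (stay : ∀ u → u ∈ O → rep u ∈ O) where

    record F (a b : Fin n) : Set where
      constructor lift
      field
        {u v} : Fin n
        u∈ : u ∈ O
        v∈ : v ∈ O
        ru : rep u ≡ a
        rv : rep v ≡ b
        e  : E u v

    F? : ∀ a b → Dec (F a b)
    F? a b = map′ (λ { (u , v , p , q , r , s , e) → lift {u = u} {v} p q r s e })
                  (λ { (lift {u} {v} p q r s e) → u , v , p , q , r , s , e })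
                  (any? λ u → any? λ v → (u ∈? O) ×-dec ((v ∈? O) ×-dec ((rep u ≟ a) ×-dec ((rep v ≟ b) ×-dec E? u v))))

    F-sym : ∀ {a b} → F a b → F b a
    F-sym (lift p q r s e) = lift q p s r (E-sym e)

    module Q = Separation F F? F-sym

    Nodes : DSet n
    has  Nodes a = a ∈ O × rep a ≡ a
    has? Nodes a = (a ∈? O) ×-dec (rep a ≟ a)

    Off : Fin n → DSet n
    has  (Off a) u = u ∈ O × rep u ≢ a
    has? (Off a) u = (u ∈? O) ×-dec ¬? (rep u ≟ a)

    project : ∀ a {u v} → Walk (Off a) u v → Q.Walk (Nodes - a) (rep u) (rep v)
    project a (stop (u∈ , ≢a)) = Q.stop ((stay _ u∈ , idem _) , ≢a)
    project a (step {x} (u∈ , ≢a) e w) =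
      Q.step ((stay _ u∈ , idem _) , ≢a) (lift u∈ (proj₁ (start∈ w)) refl refl e) (project a w)

    cut-Nodes : (∀ a → a ∈ Nodes → WConn (Off a)) → ∀ a → a ∈ Nodes → Q.WConn (Nodes - a)
    cut-Nodes f a a∈ b c ((b∈ , rb) , b≢) ((c∈ , rc) , c≢)
      with w ← project a (f a a∈ b c (b∈ , λ r → b≢ (trans (sym rb) r)) (c∈ , λ r → c≢ (trans (sym rc) r)))
      rewrite rb | rc = w

    Thin : DSet n → Set
    Thin A = ∀ a → a ∈ A → ∀ u → rep u ≡ a → u ≡ a

    unproject : ∀ A → Thin A → ∀ {x y} → Q.Walk A x y → Walk A x y
    unproject A t (Q.stop a) = stop a
    unproject A t (Q.step {y = y} a (lift {u} {v} _ _ ru rv e) w)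
      with refl ← t _ a u ru | refl ← t _ (Q.start∈ w) v rv = step a e (unproject A t w)

    unproject-WConn : ∀ A → Thin A → Q.WConn A → WConn A
    unproject-WConn A t c x y x∈ y∈ = unproject A t (c x y x∈ y∈)

  -- B₁ or B₂ may be empty; then b₁ or b₂ is irrelevant.
  module Contraction (O : DSet n) (2c : TwoConn O) (B₁ B₂ : DSet n) (B₁⊆ : B₁ ⊆ O) (B₂⊆ : B₂ ⊆ O) (d12 : Disj B₁ B₂)
                     (b₁ b₂ : Fin n) (b₁∈ : ∀ u → u ∈ B₁ → b₁ ∈ B₁) (b₂∈ : ∀ u → u ∈ B₂ → b₂ ∈ B₂)
                     (co₁ : ∀ u → u ∈ B₁ → WConn (O ∖ B₁)) (co₂ : ∀ u → u ∈ B₂ → WConn (O ∖ B₂)) where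

    data Place (u r : Fin n) : Set where
      first   : u ∈ B₁ → r ≡ b₁ → Place u r
      second  : u ∈ B₂ → r ≡ b₂ → Place u r
      neither : u ∉ B₁ → u ∉ B₂ → r ≡ u → Place u r

    abstract
      place : ∀ u → ∃ (Place u)
      place u with u ∈? B₁ | u ∈? B₂
      ... | yes i | _ = b₁ , first i refl
      ... | no _ | yes j = b₂ , second j refl
      ... | no ¬i | no ¬j = u , neither ¬i ¬j refl

    rep : Fin n → Fin n
    rep u = proj₁ (place u)

    in₁ : ∀ u → u ∈ B₁ → rep u ≡ b₁
    in₁ u i with place u
    ... | _ , first _ r = r
    ... | _ , second j _ = ⊥-elim (d12 u i j)
    ... | _ , neither ¬i _ _ = ⊥-elim (¬i i)

    in₂ : ∀ u → u ∈ B₂ → rep u ≡ b₂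
    in₂ u j with place u
    ... | _ , first i _ = ⊥-elim (d12 u i j)
    ... | _ , second _ r = r
    ... | _ , neither _ ¬j _ = ⊥-elim (¬j j)

    out : ∀ u → u ∉ B₁ → u ∉ B₂ → rep u ≡ u
    out u ¬i ¬j with place u
    ... | _ , first i _ = ⊥-elim (¬i i)
    ... | _ , second j _ = ⊥-elim (¬j j)
    ... | _ , neither _ _ r = r

    idem : ∀ u → rep (rep u) ≡ rep u
    idem u with place u
    ... | _ , first i refl = in₁ b₁ (b₁∈ u i)
    ... | _ , second j refl = in₂ b₂ (b₂∈ u j)
    ... | _ , neither ¬i ¬j refl = out u ¬i ¬j

    stay : ∀ u → u ∈ O → rep u ∈ O
    stay u o with place u
    ... | _ , first i refl = B₁⊆ b₁ (b₁∈ u i)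
    ... | _ , second j refl = B₂⊆ b₂ (b₂∈ u j)
    ... | _ , neither _ _ refl = o

    open Quotient O rep idem stay public

    fibre : ∀ a → a ∉ B₁ → a ∉ B₂ → ∀ u → rep u ≡ a → u ≡ a
    fibre a a∉₁ a∉₂ u r with place u
    ... | _ , first i refl = ⊥-elim (a∉₁ (subst (_∈ B₁) r (b₁∈ u i)))
    ... | _ , second j refl = ⊥-elim (a∉₂ (subst (_∈ B₂) r (b₂∈ u j)))
    ... | _ , neither _ _ refl = r

    into₁ : b₁ ∈ B₁ → ∀ u → rep u ≡ b₁ → u ∈ B₁
    into₁ b∈ u r with place u
    ... | _ , first i _ = i
    ... | _ , second j refl = ⊥-elim (d12 b₁ b∈ (subst (_∈ B₂) r (b₂∈ u j)))
    ... | _ , neither _ _ refl = subst (_∈ B₁) (sym r) b∈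

    into₂ : b₂ ∈ B₂ → ∀ u → rep u ≡ b₂ → u ∈ B₂
    into₂ b∈ u r with place u
    ... | _ , first i refl = ⊥-elim (d12 b₂ (subst (_∈ B₁) r (b₁∈ u i)) b∈)
    ... | _ , second j _ = j
    ... | _ , neither _ _ refl = subst (_∈ B₂) (sym r) b∈

    abstract
      -- Deleting a node lifts to deleting its fibre. If the fibre is a blob, the rest of `O` is
      -- connected by `co₁` or `co₂`; if it is a single vertex, by the 2-connectedness of `O`.
      cutN : ∀ a → a ∈ Nodes → Q.WConn (Nodes - a)
      cutN = cut-Nodes off
        where
        off : ∀ a → a ∈ Nodes → WConn (Off a)
        off a (a∈ , ra) = byPlace (proj₂ (place a))
          where
          byPlace : ∀ {r} → Place a r → WConn (Off a)
          byPlace (first i _) = WConn-≐ (O ∖ B₁) (Off a)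
                (λ u z → proj₁ z , λ r → proj₂ z (into₁ (b₁∈ a i) u (trans r (trans (sym ra) (in₁ a i)))))
                (λ u z → proj₁ z , λ b → proj₂ z (trans (in₁ u b) (trans (sym (in₁ a i)) ra))) (co₁ a i)
          byPlace (second j _) = WConn-≐ (O ∖ B₂) (Off a)
                (λ u z → proj₁ z , λ r → proj₂ z (into₂ (b₂∈ a j) u (trans r (trans (sym ra) (in₂ a j)))))
                (λ u z → proj₁ z , λ b → proj₂ z (trans (in₂ u b) (trans (sym (in₂ a j)) ra))) (co₂ a j)
          byPlace (neither ¬i ¬j _) = WConn-≐ (O - a) (Off a)
                (λ u z → proj₁ z , λ r → proj₂ z (fibre a ¬i ¬j u r)) (λ u z → proj₁ z , λ { refl → proj₂ z ra }) (TwoConn.cut 2c a a∈)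

  record Contacts (B Low High : DSet n) : Set where
    field
      {x y l h} : Fin n
      x∈ : x ∈ B
      y∈ : y ∈ B
      x≢y : x ≢ y
      l∈ : l ∈ Low
      h∈ : h ∈ High
      xl : E x l
      yh : E y h

  -- If both contacts sit at the same vertex `x`, connectedness of `O - x` gives an edge that leaves
  -- `B` at another vertex. Its outer end lies in `Low` or in `High`, and it replaces the contact on
  -- that side.
  contacts : ∀ {O B Low High} → TwoConn O → TwoConn B → B ⊆ O → ∀ p → p ∈ O → p ∉ B →
             (∀ u → u ∈ O → u ∉ B → u ∈ Low ⊎ u ∈ High) → Touch B Low → Touch B High → Contacts B Low High
  contacts {O} {B} 2c 2b B⊆ p p∈ p∉ spans (touch {x} x∈ l∈ xl) (touch {y} y∈ h∈ yh) with x ≟ y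
  ... | no x≢y = record { x∈ = x∈ ; y∈ = y∈ ; x≢y = x≢y ; l∈ = l∈ ; h∈ = h∈ ; xl = xl ; yh = yh }
  ... | yes refl with TwoConn.third 2b x x
  ...   | r , r∈ , r≢ , _ with exit (O - x) (B - x) (TwoConn.cut 2c x (B⊆ x x∈) r p (B⊆ r r∈ , r≢) (p∈ , λ { refl → p∉ x∈ }))
                                 (r∈ , r≢) (p∉ ∘ proj₁)
  ...     | exiting {y′} {u} y′∈ u∈ u∉ e _ with spans u (proj₁ u∈) (λ b → u∉ (b , proj₂ u∈))
  ...       | inj₁ low  = record { x∈ = proj₁ y′∈ ; y∈ = y∈ ; x≢y = proj₂ y′∈ ; l∈ = low ; h∈ = h∈ ; xl = e ; yh = yh }
  ...       | inj₂ high = record { x∈ = x∈ ; y∈ = proj₁ y′∈ ; x≢y = proj₂ y′∈ ∘ sym ; l∈ = l∈ ; h∈ = high ; xl = xl ; yh = e }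

  record Child (O U V : DSet n) (h : ℕ) : Set₁ where
    field
      B    : DSet n
      B⊆   : B ⊆ O
      two  : TwoConn B
      tree : TreeIn B h
      p q  : Fin n
      p∈   : p ∈ B
      q∈   : q ∈ B
      p≢q  : p ≢ q
      pU   : Touch ｛ p ｝ U
      qV   : Touch ｛ q ｝ V

  Child-mono : ∀ {O O′ U U′ V V′ h} → O ⊆ O′ → U ⊆ U′ → V ⊆ V′ → Child O U V h → Child O′ U′ V′ h
  Child-mono {U = U} {U′} {V} {V′} s t r c = record
    { B = B ; B⊆ = λ x → s x ∘ B⊆ x ; two = two ; tree = tree ; p = p ; q = q ; p∈ = p∈ ; q∈ = q∈ ; p≢q = p≢q
    ; pU = Touch-mono (λ _ → id) t pU ; qV = Touch-mono (λ _ → id) r qV }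
    where open Child c

  record Ear (O : DSet n) (x y : Fin n) (h : ℕ) : Set₁ where
    field
      L R    : DSet n
      x∈     : x ∈ L
      y∈     : y ∈ R
      L⊆     : L ⊆ O
      R⊆     : R ⊆ O
      L-conn : Conn L
      R-conn : Conn R
      LR     : Touch L R
      child  : Child O L R h
    open Child child public using (B)
    field
      dLR : Disj L R
      dLB : Disj L B
      dRB : Disj R B

  module _ (O : DSet n) (2c : TwoConn O) (x y : Fin n) (x∈ : x ∈ O) (y∈ : y ∈ O) (x≢y : x ≢ y) where
    abstract
      -- Contract `B` and number from `x` to `y`: `L` is what precedes the contracted node, `R` what
      -- follows it. They touch because `O ∖ B` is connected, and `B` touches both because the
      -- contracted node has neighbours on either side.
      earFromBlob : ∀ {U h} (b : HeavyIn O U h) → x ∉ HeavyIn.B b → y ∉ HeavyIn.B b → Ear O x y h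
      earFromBlob {h = h} (heavyIn B B⊆ _ twoB treeB co) x∉ y∉ = record
        { L = L ; R = R ; x∈ = L⊆ x refl ; y∈ = y∈R ; L⊆ = λ u → proj₁ ∘ L⁺⊆ u ; R⊆ = λ _ → proj₁ ∘ proj₁
        ; L-conn = Lconn ; R-conn = (y , y∈R) , Rconn ; LR = LR
        ; child = record { B = B ; B⊆ = B⊆ ; two = twoB ; tree = treeB ; p = cx ; q = cy ; p∈ = cx∈ ; q∈ = cy∈
                         ; p≢q = cx≢cy ; pU = touch refl l∈ xl ; qV = touch refl h∈ yh }
        ; dLR = λ u l r → proj₂ r l ; dLB = L∌B ; dRB = λ u r b → proj₂ (proj₁ r) b }
        where
        b₀ : Fin n
        b₀ = proj₁ (proj₁ (TwoConn.conn twoB))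
        b₀∈ : b₀ ∈ B
        b₀∈ = proj₂ (proj₁ (TwoConn.conn twoB))
        open Contraction O 2c B None B⊆ (λ _ ()) (λ _ _ ()) b₀ b₀ (λ _ _ → b₀∈) (λ _ ()) (λ _ _ → proj₂ co) (λ _ ())
        b₀∈N : b₀ ∈ Nodes
        b₀∈N = B⊆ b₀ b₀∈ , in₁ b₀ b₀∈
        node-out : ∀ u → u ∈ O → u ∉ B → u ∈ Nodes
        node-out u o ¬b = o , out u ¬b id
        open Q.Growing Nodes cutN x y (node-out y y∈ y∉)
        grown : Q.Grown Nodes ｛ x ｝ ｛ b₀ ｝ y
        grown = grow ｛ b₀ ｝ ｛ x ｝ (λ { _ refl → node-out x x∈ x∉ }) (Q.Conn-single x) refl (x≢y ∘ sym)
          (Q.WConn-≐ (Nodes - x) (Nodes ∖ ｛ x ｝) (λ _ → id) (λ _ → id) (cutN x (node-out x x∈ x∉)))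
          b₀ refl (b₀∈N , λ { refl → x∉ b₀∈ }) (λ { refl → y∉ b₀∈ })
        open Q.Grown grown using (L⁺; L⊆; L⁺⊆; v∈T) renaming (v to v₀)
        L R : DSet n
        L = L⁺
        R = (O ∖ B) ∖ L
        b₀∉L : b₀ ∉ L
        b₀∉L l = proj₂ (Q.Grown.v∈ grown) (subst (_∈ L) (sym v∈T) l)
        L∌B : Disj L B
        L∌B u l b = b₀∉L (subst (_∈ L) (trans (sym (proj₂ (L⁺⊆ u l))) (in₁ u b)) l)
        thin : ∀ A → Disj A B → Thin A
        thin A d a a∈ = fibre a (d a a∈) id
        y∈R : y ∈ R
        y∈R = (y∈ , y∉) , Q.Grown.q∉ grown
        Lconn : Conn L
        Lconn = (x , L⊆ x refl) , unproject-WConn L (thin L L∌B) (proj₂ (Q.Grown.conn grown))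
        R∌B : Disj R B
        R∌B u r b = proj₂ (proj₁ r) b
        Rconn : WConn R
        Rconn = unproject-WConn R (thin R R∌B) (Q.WConn-≐ ((Nodes ∖ L⁺) - v₀) R
          (λ u z → (proj₁ (proj₁ (proj₁ z)) , λ b → proj₂ z (trans (trans (sym (proj₂ (proj₁ (proj₁ z)))) (in₁ u b)) (sym v∈T))) , proj₂ (proj₁ z))
          (λ u z → (node-out u (proj₁ (proj₁ z)) (proj₂ (proj₁ z)) , proj₂ z) , λ { refl → proj₂ (proj₁ z) (subst (_∈ B) (sym v∈T) b₀∈) })
          (Q.Grown.co-conn-v grown))
        LR : Touch L R
        LR with exit (O ∖ B) L (proj₂ co x y (x∈ , x∉) (y∈ , y∉)) (L⊆ x refl) (Q.Grown.q∉ grown)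
        ... | exiting {a} {b} a∈ b∈ b∉ e _ = touch a∈ (b∈ , b∉) e
        lowTouch : Touch B L
        lowTouch with Q.Grown.touches grown
        ... | Q.touch {a} a∈ refl (lift {u} {v} _ _ ru rv e)
          with refl ← thin L L∌B a a∈ u ru = touch (into₁ b₀∈ v (trans rv v∈T)) a∈ (E-sym e)
        highTouch : Touch B R
        highTouch with Q.exit (Nodes ∖ L) ｛ b₀ ｝ (Q.Grown.co-conn grown b₀ y (b₀∈N , b₀∉L) (node-out y y∈ y∉ , Q.Grown.q∉ grown))
                         refl (λ { refl → y∉ b₀∈ })
        ... | Q.exiting {a} {b} refl ((b∈O , rb) , b∉L) b≢ (lift {u} {v} _ v∈ ru rv e) _ =
          touch (into₁ b₀∈ u ru) ((v∈ , v∉B) , λ l → b∉L (subst (_∈ L) (trans (sym (out v v∉B id)) rv) l)) e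
          where
          v∉B : v ∉ B
          v∉B vb = b≢ (trans (sym rv) (in₁ v vb))
        spans : ∀ u → u ∈ O → u ∉ B → u ∈ L ⊎ u ∈ R
        spans u o ¬b with u ∈? L
        ... | yes l = inj₁ l
        ... | no ¬l = inj₂ ((o , ¬b) , ¬l)
        open Contacts (contacts {Low = L} {R} 2c twoB B⊆ x x∈ x∉ spans lowTouch highTouch)
          renaming (x to cx; y to cy; x∈ to cx∈; y∈ to cy∈; x≢y to cx≢cy)

      ear : ∀ ℓ h → TreeIn O (2 + (ℓ + suc h)) → Apex ℓ ⊎ Ear O x y (suc h)
      ear ℓ h t with avoidingTwo (rootBranch (TwoConn.conn 2c) t) x y
      ... | b , x∉ , y∉ , _ with heavyBlob ℓ h 2c b x x∈ x∉
      ...   | inj₁ a = inj₁ a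
      ...   | inj₂ hb = inj₂ (earFromBlob hb (x∉ ∘ HeavyIn.B⊆U hb x) (y∉ ∘ HeavyIn.B⊆U hb y))

  -- Series and parallel

  -- `b`, `a` and `c` are the corners of the triangle in the recursion of ∇, with a blob in place of
  -- the copy at each of the edges `b a` and `a c`. The root edge between `b` and `c` comes from
  -- outside.
  record Series (O : DSet n) (p q : Fin n) (h : ℕ) : Set₁ where
    field
      b a c : DSet n
      p∈ : p ∈ b
      q∈ : q ∈ c
      b⊆ : b ⊆ O
      a⊆ : a ⊆ O
      c⊆ : c ⊆ O
      b-conn : Conn b
      a-conn : Conn a
      c-conn : Conn c
      ba : Touch b a
      ac : Touch a c
      child₁ : Child O b a h
      child₂ : Child O a c h
    open Child child₁ public using () renaming (B to B₁)
    open Child child₂ public using () renaming (B to B₂)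
    field
      dba : Disj b a
      dac : Disj a c
      dbc : Disj b c
      db1 : Disj b B₁
      da1 : Disj a B₁
      dc1 : Disj c B₁
      db2 : Disj b B₂
      da2 : Disj a B₂
      dc2 : Disj c B₂
      d12 : Disj B₁ B₂

  record Theta (O : DSet n) (p q : Fin n) (h : ℕ) : Set₁ where
    field
      L R : DSet n
      p∈ : p ∈ L
      q∈ : q ∈ R
      L⊆ : L ⊆ O
      R⊆ : R ⊆ O
      L-conn : Conn L
      R-conn : Conn R
      child₁ child₂ : Child O L R h
    open Child child₁ public using () renaming (B to B₁)
    open Child child₂ public using () renaming (B to B₂)
    field
      dLR : Disj L R
      dL1 : Disj L B₁
      dR1 : Disj R B₁
      dL2 : Disj L B₂
      dR2 : Disj R B₂
      d12 : Disj B₁ B₂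

  data Outcome (O : DSet n) (p q : Fin n) (h : ℕ) : Set₁ where
    series : Series O p q h → Outcome O p q h
    theta  : Theta O p q h → Outcome O p q h

  record BlobPair (O : DSet n) (h : ℕ) : Set₁ where
    field
      B₁ B₂ : DSet n
      B₁⊆ : B₁ ⊆ O
      B₂⊆ : B₂ ⊆ O
      two₁ : TwoConn B₁
      two₂ : TwoConn B₂
      tree₁ : TreeIn B₁ h
      tree₂ : TreeIn B₂ h
      d12 : Disj B₁ B₂

  -- O is cut into L, B₁, Mid, B₂, R in the order of an st-numbering of O with B₁ and B₂ contracted.
  record Sequence (O : DSet n) (p q : Fin n) (k : ℕ) : Set₁ where
    field
      blobs : BlobPair O k
    open BlobPair blobs public
    field
      L Mid R : DSet n
      L⊆ : L ⊆ O
      M⊆ : Mid ⊆ O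
      R⊆ : R ⊆ O
      p∈ : p ∈ L
      q∈ : q ∈ R
      L-conn : Conn L
      R-conn : Conn R
      dLM : Disj L Mid
      dLR : Disj L R
      dMR : Disj Mid R
      dL1 : Disj L B₁
      dL2 : Disj L B₂
      dM1 : Disj Mid B₁
      dM2 : Disj Mid B₂
      dR1 : Disj R B₁
      dR2 : Disj R B₂
      spans : ∀ u → u ∈ O → u ∉ B₁ → u ∉ B₂ → u ∈ (L ∪ Mid) ∪ R
      low₁  : Touch B₁ L
      high₁ : Touch B₁ ((Mid ∪ B₂) ∪ R)
      low₂  : Touch B₂ ((Mid ∪ B₁) ∪ L)
      high₂ : Touch B₂ R
      up    : ∀ u → u ∈ Mid → Touch (comp Mid u) (B₂ ∪ R)
      down  : ∀ u → u ∈ Mid → Touch (comp Mid u) (B₁ ∪ L)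

  -- A way out of a blob from its vertex `z` through `Mid`, up to `U` or to the other blob `B`. In
  -- the second case the vertex `w` of arrival is kept, since the outcome depends on whether it is
  -- already an end of the ear in `B`.
  record Reach (z : Fin n) (Mid U B : DSet n) : Set₁ where
    constructor reach
    field
      Y    : DSet n
      conn : Conn Y
      z∈   : z ∈ Y
      Y⊆   : Y ⊆ Mid ∪ ｛ z ｝
      ends : Touch Y U ⊎ ∃ λ w → w ∈ B × Touch Y ｛ w ｝

  reachFrom : ∀ {z h Mid U B} → (∀ u → u ∈ Mid → Touch (comp Mid u) (B ∪ U)) →
              h ∈ (Mid ∪ B) ∪ U → E z h → Reach z Mid U B
  reachFrom {z} {h} {Mid} {U} {B} f (inj₁ (inj₁ m)) e = reach (C ∪ ｛ z ｝)
    (Conn-touch (comp-conn Mid h m) (Conn-single z) (touch (stop m) refl (E-sym e))) (inj₂ refl)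
    (∪-least C ｛ z ｝ (Mid ∪ ｛ z ｝) (λ u w → inj₁ (end∈ w)) (λ _ → inj₂)) (end (f h m))
    where
    C = comp Mid h
    end : Touch C (B ∪ U) → Touch (C ∪ ｛ z ｝) U ⊎ ∃ λ w → w ∈ B × Touch (C ∪ ｛ z ｝) ｛ w ｝
    end (touch c (inj₁ b) e) = inj₂ (_ , b , touch (inj₁ c) refl e)
    end (touch c (inj₂ u) e) = inj₁ (touch (inj₁ c) u e)
  reachFrom {z} f (inj₁ (inj₂ b)) e = reach ｛ z ｝ (Conn-single z) refl (λ _ → inj₂) (inj₂ (_ , b , touch refl refl e))
  reachFrom {z} f (inj₂ u) e = reach ｛ z ｝ (Conn-single z) refl (λ _ → inj₂) (inj₁ (touch refl u e))

  module FromSequence {O p q k} (S : Sequence O p q k) where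
    open Sequence S hiding (tree₁; tree₂)

    -- `A` links the upper end `b₁` of one ear to the lower end `a₂` of the other. These two
    -- vertices already belong to the ears, so only the part of `A` in `Mid` is added to the middle
    -- set.
    mkSeries : ∀ {h a₁ b₁ a₂ b₂} → Ear B₁ a₁ b₁ h → Ear B₂ a₂ b₂ h → Touch ｛ a₁ ｝ L → Touch ｛ b₂ ｝ R →
               ∀ A → Conn A → b₁ ∈ A → a₂ ∈ A → A ⊆ (Mid ∪ ｛ b₁ ｝) ∪ ｛ a₂ ｝ → Series O p q h
    mkSeries {h} {a₁} {b₁} {a₂} {b₂} e₁ e₂ ta tb A cA b₁∈A a₂∈A A⊆ = record
      { b = b ; a = a ; c = c ; p∈ = inj₁ p∈ ; q∈ = inj₁ q∈
      ; b⊆ = ∪-least L X.L O L⊆ (λ x → B₁⊆ x ∘ X.L⊆ x)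
      ; a⊆ = ∪-least (X.R ∪ (A ∩ Mid)) Y.L O (∪-least X.R (A ∩ Mid) O (λ x → B₁⊆ x ∘ X.R⊆ x) (λ x → M⊆ x ∘ proj₂)) (λ x → B₂⊆ x ∘ Y.L⊆ x)
      ; c⊆ = ∪-least R Y.R O R⊆ (λ x → B₂⊆ x ∘ Y.R⊆ x)
      ; b-conn = Conn-touch L-conn X.L-conn (Touch-sym (Touch-from X.x∈ ta))
      ; a-conn = Conn-≐ ((X.R ∪ A) ∪ Y.L) a
          (λ { x (inj₁ (inj₁ r)) → inj₁ (inj₁ r) ; x (inj₁ (inj₂ z)) → back x z (A⊆ x z) ; x (inj₂ l) → inj₂ l })
          (λ { x (inj₁ (inj₁ r)) → inj₁ (inj₁ r) ; x (inj₁ (inj₂ z)) → inj₁ (inj₂ (proj₁ z)) ; x (inj₂ l) → inj₂ l })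
          (Conn-share (Conn-share X.R-conn cA b₁ X.y∈ b₁∈A) Y.L-conn a₂ (inj₂ a₂∈A) Y.x∈)
      ; c-conn = Conn-touch R-conn Y.R-conn (Touch-sym (Touch-from Y.y∈ tb))
      ; ba = Touch-mono (λ _ → inj₂) (λ _ → inj₁ ∘ inj₁) X.LR
      ; ac = Touch-mono (λ _ → inj₂) (λ _ → inj₂) Y.LR
      ; child₁ = Child-mono B₁⊆ (λ _ → inj₂) (λ _ → inj₁ ∘ inj₁) X.child
      ; child₂ = Child-mono B₂⊆ (λ _ → inj₂) (λ _ → inj₂) Y.child
      ; dba = λ { x (inj₁ l) (inj₁ (inj₁ r)) → dL1 x l (X.R⊆ x r) ; x (inj₁ l) (inj₁ (inj₂ m)) → dLM x l (proj₂ m)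
                ; x (inj₁ l) (inj₂ l₂) → dL2 x l (Y.L⊆ x l₂)
                ; x (inj₂ l) (inj₁ (inj₁ r)) → X.dLR x l r ; x (inj₂ l) (inj₁ (inj₂ m)) → dM1 x (proj₂ m) (X.L⊆ x l)
                ; x (inj₂ l) (inj₂ l₂) → d12 x (X.L⊆ x l) (Y.L⊆ x l₂) }
      ; dac = λ { x (inj₁ (inj₁ r)) (inj₁ r′) → dR1 x r′ (X.R⊆ x r) ; x (inj₁ (inj₂ m)) (inj₁ r′) → dMR x (proj₂ m) r′
                ; x (inj₂ l₂) (inj₁ r′) → dR2 x r′ (Y.L⊆ x l₂)
                ; x (inj₁ (inj₁ r)) (inj₂ r₂) → d12 x (X.R⊆ x r) (Y.R⊆ x r₂) ; x (inj₁ (inj₂ m)) (inj₂ r₂) → dM2 x (proj₂ m) (Y.R⊆ x r₂)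
                ; x (inj₂ l₂) (inj₂ r₂) → Y.dLR x l₂ r₂ }
      ; dbc = λ { x (inj₁ l) (inj₁ r) → dLR x l r ; x (inj₁ l) (inj₂ r₂) → dL2 x l (Y.R⊆ x r₂)
                ; x (inj₂ l) (inj₁ r) → dR1 x r (X.L⊆ x l) ; x (inj₂ l) (inj₂ r₂) → d12 x (X.L⊆ x l) (Y.R⊆ x r₂) }
      ; db1 = λ { x (inj₁ l) z → dL1 x l (X⊆ x z) ; x (inj₂ l) z → X.dLB x l z }
      ; da1 = λ { x (inj₁ (inj₁ r)) z → X.dRB x r z ; x (inj₁ (inj₂ m)) z → dM1 x (proj₂ m) (X⊆ x z) ; x (inj₂ l₂) z → d12 x (X⊆ x z) (Y.L⊆ x l₂) }
      ; dc1 = λ { x (inj₁ r) z → dR1 x r (X⊆ x z) ; x (inj₂ r₂) z → d12 x (X⊆ x z) (Y.R⊆ x r₂) }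
      ; db2 = λ { x (inj₁ l) z → dL2 x l (Y⊆ x z) ; x (inj₂ l) z → d12 x (X.L⊆ x l) (Y⊆ x z) }
      ; da2 = λ { x (inj₁ (inj₁ r)) z → d12 x (X.R⊆ x r) (Y⊆ x z) ; x (inj₁ (inj₂ m)) z → dM2 x (proj₂ m) (Y⊆ x z) ; x (inj₂ l₂) z → Y.dLB x l₂ z }
      ; dc2 = λ { x (inj₁ r) z → dR2 x r (Y⊆ x z) ; x (inj₂ r₂) z → Y.dRB x r₂ z }
      ; d12 = λ x z z′ → d12 x (X⊆ x z) (Y⊆ x z′) }
      where
      module X = Ear e₁
      module Y = Ear e₂
      X⊆ = Child.B⊆ X.child
      Y⊆ = Child.B⊆ Y.child
      b = L ∪ X.L
      a = (X.R ∪ (A ∩ Mid)) ∪ Y.L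
      c = R ∪ Y.R
      back : ∀ x → x ∈ A → x ∈ (Mid ∪ ｛ b₁ ｝) ∪ ｛ a₂ ｝ → x ∈ a
      back x z (inj₁ (inj₁ m)) = inj₁ (inj₂ (z , m))
      back x z (inj₁ (inj₂ refl)) = inj₁ (inj₁ X.y∈)
      back x z (inj₂ refl) = inj₂ Y.x∈

    -- The ears run side by side: `P` ties the lower end of the second ear to the left side, `Q`
    -- ties the upper end of the first ear to the right side, and both children lie between the same
    -- two sets. Touching `x₁` or `y₂` is as good as touching `L` or `R`, since the half of the ear
    -- containing it belongs to that side.
    mkTheta : ∀ {h x₁ y₁ x₂ y₂} → Ear B₁ x₁ y₁ h → Ear B₂ x₂ y₂ h → Touch ｛ x₁ ｝ L → Touch ｛ y₂ ｝ R →
              ∀ P → Conn P → x₂ ∈ P → P ⊆ Mid ∪ ｛ x₂ ｝ → Touch P L ⊎ Touch P ｛ x₁ ｝ →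
              ∀ Q → Conn Q → y₁ ∈ Q → Q ⊆ Mid ∪ ｛ y₁ ｝ → Touch Q R ⊎ Touch Q ｛ y₂ ｝ →
              Disj P Q → Theta O p q h
    mkTheta {h} {x₁} {y₁} {x₂} {y₂} e₁ e₂ tx ty P cP x₂∈P P⊆ tP Q cQ y₁∈Q Q⊆ tQ dPQ = record
      { L = L⁺ ; R = R⁺ ; p∈ = inj₁ (inj₁ (inj₁ p∈)) ; q∈ = inj₁ (inj₁ (inj₁ q∈))
      ; L⊆ = λ { x (inj₁ (inj₁ (inj₁ l))) → L⊆ x l ; x (inj₁ (inj₁ (inj₂ l))) → B₁⊆ x (X.L⊆ x l) ; x (inj₁ (inj₂ m)) → M⊆ x (proj₂ m) ; x (inj₂ l) → B₂⊆ x (Y.L⊆ x l) }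
      ; R⊆ = λ { x (inj₁ (inj₁ (inj₁ r))) → R⊆ x r ; x (inj₁ (inj₁ (inj₂ r))) → B₂⊆ x (Y.R⊆ x r) ; x (inj₁ (inj₂ m)) → M⊆ x (proj₂ m) ; x (inj₂ r) → B₁⊆ x (X.R⊆ x r) }
      ; L-conn = chain L X.L P Y.L x₁ x₂ L-conn X.L-conn cP Y.L-conn X.x∈ Y.x∈ x₂∈P tx P⊆ tP
      ; R-conn = chain R Y.R Q X.R y₂ y₁ R-conn Y.R-conn cQ X.R-conn Y.y∈ X.y∈ y₁∈Q ty Q⊆ tQ
      ; child₁ = Child-mono B₁⊆ (λ _ → inj₁ ∘ inj₁ ∘ inj₂) (λ _ → inj₂) X.child
      ; child₂ = Child-mono B₂⊆ (λ _ → inj₂) (λ _ → inj₁ ∘ inj₁ ∘ inj₂) Y.child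
      ; dLR = λ { x (inj₁ (inj₁ (inj₁ l))) (inj₁ (inj₁ (inj₁ r))) → dLR x l r
                ; x (inj₁ (inj₁ (inj₁ l))) (inj₁ (inj₁ (inj₂ r))) → dL2 x l (Y.R⊆ x r)
                ; x (inj₁ (inj₁ (inj₁ l))) (inj₁ (inj₂ m)) → dLM x l (proj₂ m)
                ; x (inj₁ (inj₁ (inj₁ l))) (inj₂ r) → dL1 x l (X.R⊆ x r)
                ; x (inj₁ (inj₁ (inj₂ l))) (inj₁ (inj₁ (inj₁ r))) → dR1 x r (X.L⊆ x l)
                ; x (inj₁ (inj₁ (inj₂ l))) (inj₁ (inj₁ (inj₂ r))) → d12 x (X.L⊆ x l) (Y.R⊆ x r)
                ; x (inj₁ (inj₁ (inj₂ l))) (inj₁ (inj₂ m)) → dM1 x (proj₂ m) (X.L⊆ x l)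
                ; x (inj₁ (inj₁ (inj₂ l))) (inj₂ r) → X.dLR x l r
                ; x (inj₁ (inj₂ m)) (inj₁ (inj₁ (inj₁ r))) → dMR x (proj₂ m) r
                ; x (inj₁ (inj₂ m)) (inj₁ (inj₁ (inj₂ r))) → dM2 x (proj₂ m) (Y.R⊆ x r)
                ; x (inj₁ (inj₂ m)) (inj₁ (inj₂ m′)) → dPQ x (proj₁ m) (proj₁ m′)
                ; x (inj₁ (inj₂ m)) (inj₂ r) → dM1 x (proj₂ m) (X.R⊆ x r)
                ; x (inj₂ l) (inj₁ (inj₁ (inj₁ r))) → dR2 x r (Y.L⊆ x l)
                ; x (inj₂ l) (inj₁ (inj₁ (inj₂ r))) → Y.dLR x l r
                ; x (inj₂ l) (inj₁ (inj₂ m)) → dM2 x (proj₂ m) (Y.L⊆ x l)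
                ; x (inj₂ l) (inj₂ r) → d12 x (X.R⊆ x r) (Y.L⊆ x l) }
      ; dL1 = λ { x (inj₁ (inj₁ (inj₁ l))) z → dL1 x l (X⊆ x z) ; x (inj₁ (inj₁ (inj₂ l))) z → X.dLB x l z
                ; x (inj₁ (inj₂ m)) z → dM1 x (proj₂ m) (X⊆ x z) ; x (inj₂ l) z → d12 x (X⊆ x z) (Y.L⊆ x l) }
      ; dR1 = λ { x (inj₁ (inj₁ (inj₁ r))) z → dR1 x r (X⊆ x z) ; x (inj₁ (inj₁ (inj₂ r))) z → d12 x (X⊆ x z) (Y.R⊆ x r)
                ; x (inj₁ (inj₂ m)) z → dM1 x (proj₂ m) (X⊆ x z) ; x (inj₂ r) z → X.dRB x r z }
      ; dL2 = λ { x (inj₁ (inj₁ (inj₁ l))) z → dL2 x l (Y⊆ x z) ; x (inj₁ (inj₁ (inj₂ l))) z → d12 x (X.L⊆ x l) (Y⊆ x z)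
                ; x (inj₁ (inj₂ m)) z → dM2 x (proj₂ m) (Y⊆ x z) ; x (inj₂ l) z → Y.dLB x l z }
      ; dR2 = λ { x (inj₁ (inj₁ (inj₁ r))) z → dR2 x r (Y⊆ x z) ; x (inj₁ (inj₁ (inj₂ r))) z → Y.dRB x r z
                ; x (inj₁ (inj₂ m)) z → dM2 x (proj₂ m) (Y⊆ x z) ; x (inj₂ r) z → d12 x (X.R⊆ x r) (Y⊆ x z) }
      ; d12 = λ x z z′ → d12 x (X⊆ x z) (Y⊆ x z′) }
      where
      module X = Ear e₁
      module Y = Ear e₂
      X⊆ = Child.B⊆ X.child
      Y⊆ = Child.B⊆ Y.child
      L⁺ = ((L ∪ X.L) ∪ (P ∩ Mid)) ∪ Y.L
      R⁺ = ((R ∪ Y.R) ∪ (Q ∩ Mid)) ∪ X.R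
      chain : ∀ A B C D u v → Conn A → Conn B → Conn C → Conn D → u ∈ B → v ∈ D → v ∈ C → Touch ｛ u ｝ A →
              C ⊆ Mid ∪ ｛ v ｝ → Touch C A ⊎ Touch C ｛ u ｝ → Conn (((A ∪ B) ∪ (C ∩ Mid)) ∪ D)
      chain A B C D u v cA cB cC cD u∈B v∈D v∈C t C⊆ t′ = Conn-≐ (((A ∪ B) ∪ C) ∪ D) (((A ∪ B) ∪ (C ∩ Mid)) ∪ D)
        (λ { x (inj₁ (inj₁ z)) → inj₁ (inj₁ z) ; x (inj₁ (inj₂ z)) → [ (λ m → inj₁ (inj₂ (z , m))) , (λ { refl → inj₂ v∈D }) ] (C⊆ x z) ; x (inj₂ z) → inj₂ z })
        (λ { x (inj₁ (inj₁ z)) → inj₁ (inj₁ z) ; x (inj₁ (inj₂ z)) → inj₁ (inj₂ (proj₁ z)) ; x (inj₂ z) → inj₂ z })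
        (Conn-share
          (Conn-touch (Conn-touch cA cB (Touch-sym (Touch-from u∈B t))) cC
            (Touch-sym ([ Touch-mono (λ _ → id) (λ _ → inj₁) , Touch-mono (λ _ → id) (λ { _ refl → inj₂ u∈B }) ] t′)))
          cD v (inj₂ v∈C) v∈D)

    -- `Q` leads upwards from the upper contact `y₁` of `B₁`, and `P` downwards from the lower
    -- contact `x₂` of `B₂`. If `Q` arrives in `B₂` away from `y₂`, or `P` in `B₁` away from `x₁`,
    -- the vertex of arrival can be an end of the ear and the blobs are in series. They are also in
    -- series if `P` and `Q` meet. Otherwise `P` and `Q` are disjoint and give a theta.
    outcome : ∀ ℓ h → TreeIn B₁ (2 + (ℓ + suc h)) → TreeIn B₂ (2 + (ℓ + suc h)) → TwoConn O → Apex ℓ ⊎ Outcome O p q (suc h)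
    outcome ℓ h tree₁ tree₂ 2c = decide (Reach.ends up₁) (Reach.ends down₂)
      where
      cover₁ : ∀ u → u ∈ O → u ∉ B₁ → u ∈ L ⊎ u ∈ (Mid ∪ B₂) ∪ R
      cover₁ u o ¬b with u ∈? B₂
      ... | yes b₂ = inj₂ (inj₁ (inj₂ b₂))
      ... | no ¬b₂ with spans u o ¬b ¬b₂
      ...   | inj₁ (inj₁ l) = inj₁ l
      ...   | inj₁ (inj₂ m) = inj₂ (inj₁ (inj₁ m))
      ...   | inj₂ r = inj₂ (inj₂ r)
      open Contacts (contacts {Low = L} {(Mid ∪ B₂) ∪ R} 2c two₁ B₁⊆ p (L⊆ p p∈) (dL1 p p∈)
             (λ u o ¬b → cover₁ u o ¬b) low₁ high₁)
           using () renaming (x to x₁; y to y₁; x∈ to x₁∈; y∈ to y₁∈; x≢y to x₁≢y₁; l∈ to l₁∈; h∈ to h₁∈; xl to xl₁; yh to yh₁)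
      cover₂ : ∀ u → u ∈ O → u ∉ B₂ → u ∈ (Mid ∪ B₁) ∪ L ⊎ u ∈ R
      cover₂ u o ¬b with u ∈? B₁
      ... | yes b₁ = inj₁ (inj₁ (inj₂ b₁))
      ... | no ¬b₁ with spans u o ¬b₁ ¬b
      ...   | inj₁ (inj₁ l) = inj₁ (inj₂ l)
      ...   | inj₁ (inj₂ m) = inj₁ (inj₁ (inj₁ m))
      ...   | inj₂ r = inj₂ r
      open Contacts (contacts {Low = (Mid ∪ B₁) ∪ L} {R} 2c two₂ B₂⊆ p (L⊆ p p∈) (dL2 p p∈)
             (λ u o ¬b → cover₂ u o ¬b) low₂ high₂)
           using () renaming (x to x₂; y to y₂; x∈ to x₂∈; y∈ to y₂∈; x≢y to x₂≢y₂; l∈ to l₂∈; h∈ to h₂∈; xl to xl₂; yh to yh₂)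
      up₁ : Reach y₁ Mid R B₂
      up₁ = reachFrom up h₁∈ yh₁
      down₂ : Reach x₂ Mid L B₁
      down₂ = reachFrom down l₂∈ xl₂
      open Reach up₁ using () renaming (Y to Q; conn to cQ; z∈ to y₁∈Q; Y⊆ to Q⊆)
      open Reach down₂ using () renaming (Y to P; conn to cP; z∈ to x₂∈P; Y⊆ to P⊆)
      tx : Touch ｛ x₁ ｝ L
      tx = touch refl l₁∈ xl₁
      ty : Touch ｛ y₂ ｝ R
      ty = touch refl h₂∈ yh₂
      ears : ∀ a₁ b₁ → a₁ ∈ B₁ → b₁ ∈ B₁ → a₁ ≢ b₁ → ∀ a₂ b₂ → a₂ ∈ B₂ → b₂ ∈ B₂ → a₂ ≢ b₂ →
             (Ear B₁ a₁ b₁ (suc h) → Ear B₂ a₂ b₂ (suc h) → Outcome O p q (suc h)) → Apex ℓ ⊎ Outcome O p q (suc h)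
      ears a₁ b₁ i j ne a₂ b₂ i′ j′ ne′ k with ear B₁ two₁ a₁ b₁ i j ne ℓ h tree₁ | ear B₂ two₂ a₂ b₂ i′ j′ ne′ ℓ h tree₂
      ... | inj₁ a | _ = inj₁ a
      ... | inj₂ _ | inj₁ a = inj₁ a
      ... | inj₂ e₁ | inj₂ e₂ = inj₂ (k e₁ e₂)
      theta-or-meet : Touch Q R ⊎ Touch Q ｛ y₂ ｝ → Touch P L ⊎ Touch P ｛ x₁ ｝ → Apex ℓ ⊎ Outcome O p q (suc h)
      theta-or-meet tQ tP with any? (λ z → (z ∈? P) ×-dec (z ∈? Q))
      ... | yes (z , zP , zQ) = ears x₁ y₁ x₁∈ y₁∈ x₁≢y₁ x₂ y₂ x₂∈ y₂∈ x₂≢y₂ λ e₁ e₂ → series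
              (mkSeries e₁ e₂ tx ty (Q ∪ P) (Conn-share cQ cP z zQ zP) (inj₁ y₁∈Q) (inj₂ x₂∈P)
                (∪-least Q P ((Mid ∪ ｛ y₁ ｝) ∪ ｛ x₂ ｝) (λ x → inj₁ ∘ Q⊆ x) (λ x y → [ inj₁ ∘ inj₁ , inj₂ ] (P⊆ x y))))
      ... | no none = ears x₁ y₁ x₁∈ y₁∈ x₁≢y₁ x₂ y₂ x₂∈ y₂∈ x₂≢y₂ λ e₁ e₂ → theta
              (mkTheta e₁ e₂ tx ty P cP x₂∈P P⊆ tP Q cQ y₁∈Q Q⊆ tQ (λ z a b → none (z , a , b)))
      decide : Touch Q R ⊎ (∃ λ w → w ∈ B₂ × Touch Q ｛ w ｝) → Touch P L ⊎ (∃ λ w → w ∈ B₁ × Touch P ｛ w ｝) →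
               Apex ℓ ⊎ Outcome O p q (suc h)
      decide₂ : Touch Q R ⊎ Touch Q ｛ y₂ ｝ → Touch P L ⊎ (∃ λ w → w ∈ B₁ × Touch P ｛ w ｝) →
                Apex ℓ ⊎ Outcome O p q (suc h)
      decide (inj₁ t) s = decide₂ (inj₁ t) s
      decide (inj₂ (w , w∈ , t)) s with w ≟ y₂
      ... | yes refl = decide₂ (inj₂ t) s
      ... | no w≢y₂ = ears x₁ y₁ x₁∈ y₁∈ x₁≢y₁ w y₂ w∈ y₂∈ w≢y₂ λ e₁ e₂ → series
              (mkSeries e₁ e₂ tx ty (Q ∪ ｛ w ｝) (Conn-touch cQ (Conn-single w) t) (inj₁ y₁∈Q) (inj₂ refl)
                (∪-least Q ｛ w ｝ ((Mid ∪ ｛ y₁ ｝) ∪ ｛ w ｝) (λ x → inj₁ ∘ Q⊆ x) (λ _ → inj₂)))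
      decide₂ s (inj₁ t) = theta-or-meet s (inj₁ t)
      decide₂ s (inj₂ (w , w∈ , t)) with w ≟ x₁
      ... | yes refl = theta-or-meet s (inj₂ t)
      ... | no w≢x₁ = ears x₁ w x₁∈ w∈ (w≢x₁ ∘ sym) x₂ y₂ x₂∈ y₂∈ x₂≢y₂ λ e₁ e₂ → series
              (mkSeries e₁ e₂ tx ty (P ∪ ｛ w ｝) (Conn-touch cP (Conn-single w) t) (inj₂ refl) (inj₁ x₂∈P)
                (∪-least P ｛ w ｝ ((Mid ∪ ｛ w ｝) ∪ ｛ x₂ ｝) (λ x y → [ inj₁ ∘ inj₁ , inj₂ ] (P⊆ x y)) (λ _ → inj₁ ∘ inj₂)))

  module Sequencing (O : DSet n) (2c : TwoConn O) (p q : Fin n) (p∈O : p ∈ O) (q∈O : q ∈ O) (p≢q : p ≢ q) (k : ℕ)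
                    (rep : Fin n → Fin n) (idem : ∀ u → rep (rep u) ≡ rep u) (stay : ∀ u → u ∈ O → rep u ∈ O) where
    open Quotient O rep idem stay

    -- These facts are symmetric in the two blobs. With `rep` fixed outside the record, `swapped`
    -- exchanges the blobs without changing the contracted graph.
    record Contracted (b₁ b₂ : Fin n) : Set₁ where
      field
        blobs : BlobPair O k
      open BlobPair blobs public
      field
        p∉₁ : p ∉ B₁
        p∉₂ : p ∉ B₂
        q∉₁ : q ∉ B₁
        q∉₂ : q ∉ B₂
        b₁∈ : b₁ ∈ B₁
        b₂∈ : b₂ ∈ B₂
        in₁ : ∀ u → u ∈ B₁ → rep u ≡ b₁
        in₂ : ∀ u → u ∈ B₂ → rep u ≡ b₂
        out : ∀ u → u ∉ B₁ → u ∉ B₂ → rep u ≡ u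
        into₁ : ∀ u → rep u ≡ b₁ → u ∈ B₁
        into₂ : ∀ u → rep u ≡ b₂ → u ∈ B₂
        fibre : ∀ a → a ∉ B₁ → a ∉ B₂ → ∀ u → rep u ≡ a → u ≡ a
        cutN : ∀ a → a ∈ Nodes → Q.WConn (Nodes - a)

    swapped : ∀ {b₁ b₂} → Contracted b₁ b₂ → Contracted b₂ b₁
    swapped C = record
      { blobs = record { B₁ = B₂ ; B₂ = B₁ ; B₁⊆ = B₂⊆ ; B₂⊆ = B₁⊆ ; two₁ = two₂ ; two₂ = two₁ ; tree₁ = tree₂ ; tree₂ = tree₁ ; d12 = λ x a b → d12 x b a }
      ; p∉₁ = p∉₂ ; p∉₂ = p∉₁ ; q∉₁ = q∉₂ ; q∉₂ = q∉₁ ; b₁∈ = b₂∈ ; b₂∈ = b₁∈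
      ; in₁ = in₂ ; in₂ = in₁ ; out = λ u a b → out u b a
      ; into₁ = into₂ ; into₂ = into₁ ; fibre = λ a i j → fibre a j i ; cutN = cutN }
      where open Contracted C

    module _ {b₁ b₂ : Fin n} (C : Contracted b₁ b₂) where
      open Contracted C

      isNode : ∀ u → u ∈ O → u ∉ B₁ → u ∉ B₂ → u ∈ Nodes
      isNode u o ¬a ¬b = o , out u ¬a ¬b

      b₁-node : b₁ ∈ Nodes
      b₁-node = B₁⊆ b₁ b₁∈ , in₁ b₁ b₁∈

      b₂-node : b₂ ∈ Nodes
      b₂-node = B₂⊆ b₂ b₂∈ , in₂ b₂ b₂∈

      thin : ∀ A → Disj A B₁ → Disj A B₂ → Thin A
      thin A d₁ d₂ a a∈ = fibre a (d₁ a a∈) (d₂ a a∈)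

      open Q.Growing Nodes cutN p q (isNode q q∈O q∉₁ q∉₂)

      abstract
        -- The numbering is cut twice, before `b₁` and before `b₂`. `low₁` and `low₂` come from the
        -- field `touches` at the two cuts; the remaining contacts come from walks in the connected
        -- final segments going up and in a connected initial segment going down.
        ordered : ∀ {T} (g : Q.Grown Nodes ｛ p ｝ T q) → Q.Grown.v g ≡ b₁ → b₂ ∉ Q.Grown.L⁺ g → Sequence O p q k
        ordered g v≡ b₂∉L = record
          { blobs = blobs ; L = L ; Mid = Mid ; R = R
          ; L⊆ = λ u → proj₁ ∘ L⊆N u ; M⊆ = λ u m → proj₁ (L₂⊆N u (proj₁ (proj₁ m))) ; R⊆ = λ u r → proj₁ (proj₁ (proj₁ r))
          ; p∈ = p∈L ; q∈ = q∈R
          ; L-conn = (p , p∈L) , unproject-WConn L thinL (proj₂ (Q.Grown.conn g))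
          ; R-conn = (q , q∈R) , unproject-WConn R thinR
              (Q.WConn-≐ ((Nodes ∖ L₂) - Q.Grown.v g₂) R
                (λ u z → proj₁ z , λ { refl → proj₂ z (sym (Q.Grown.v∈T g₂)) })
                (λ u z → proj₁ z , λ { refl → proj₂ z (Q.Grown.v∈T g₂) })
                (Q.Grown.co-conn-v g₂))
          ; dLM = λ u l m → proj₂ (proj₁ m) l ; dLR = λ u l r → proj₂ (proj₁ r) (L⊆L₂ u l) ; dMR = λ u m r → proj₂ (proj₁ r) (proj₁ (proj₁ m))
          ; dL1 = dL1 ; dL2 = dL2 ; dM1 = dM1 ; dM2 = dM2 ; dR1 = dR1 ; dR2 = dR2
          ; spans = spans ; low₁ = low₁ ; high₁ = high₁ ; low₂ = low₂ ; high₂ = high₂ ; up = up ; down = down }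
          where
          L : DSet n
          L = Q.Grown.L⁺ g
          L⊆N : L ⊆ Nodes
          L⊆N = Q.Grown.L⁺⊆ g
          p∈L : p ∈ L
          p∈L = Q.Grown.L⊆ g p refl
          b₁∉L : b₁ ∉ L
          b₁∉L l = proj₂ (Q.Grown.v∈ g) (subst (_∈ L) (sym v≡) l)
          q≢b₁ : q ≢ b₁
          q≢b₁ refl = q∉₁ b₁∈
          b₁≢b₂ : b₁ ≢ b₂
          b₁≢b₂ refl = d12 b₁ b₁∈ b₂∈
          touchesL : Q.Touch L ｛ b₁ ｝
          touchesL with Q.Grown.touches g
          ... | Q.touch a∈ refl e = Q.touch a∈ v≡ e
          co-conn-b₁ : Q.WConn ((Nodes ∖ L) - b₁)
          co-conn-b₁ = subst (λ z → Q.WConn ((Nodes ∖ L) - z)) v≡ (Q.Grown.co-conn-v g)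
          g₂ : Q.Grown Nodes (L ∪ ｛ b₁ ｝) ｛ b₂ ｝ q
          g₂ = grow ｛ b₂ ｝ (L ∪ ｛ b₁ ｝) (λ { u (inj₁ l) → L⊆N u l ; u (inj₂ refl) → b₁-node })
            (Q.Conn-touch (Q.Grown.conn g) (Q.Conn-single b₁) touchesL)
            (inj₁ p∈L) [ Q.Grown.q∉ g , q≢b₁ ]
            (Q.WConn-≐ ((Nodes ∖ L) - b₁) (Nodes ∖ (L ∪ ｛ b₁ ｝))
              (λ u z → proj₁ (proj₁ z) , [ proj₂ (proj₁ z) , proj₂ z ]) (λ u z → (proj₁ z , proj₂ z ∘ inj₁) , proj₂ z ∘ inj₂) co-conn-b₁)
            b₂ refl (b₂-node , [ b₂∉L , b₁≢b₂ ∘ sym ]) (λ { refl → q∉₂ b₂∈ })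
          L₂ Mid R : DSet n
          L₂ = Q.Grown.L⁺ g₂
          Mid = (L₂ ∖ L) - b₁
          R = (Nodes ∖ L₂) - b₂
          L₂⊆N : L₂ ⊆ Nodes
          L₂⊆N = Q.Grown.L⁺⊆ g₂
          L⊆L₂ : L ⊆ L₂
          L⊆L₂ u l = Q.Grown.L⊆ g₂ u (inj₁ l)
          b₁∈L₂ : b₁ ∈ L₂
          b₁∈L₂ = Q.Grown.L⊆ g₂ b₁ (inj₂ refl)
          b₂∉L₂ : b₂ ∉ L₂
          b₂∉L₂ l = proj₂ (Q.Grown.v∈ g₂) (subst (_∈ L₂) (sym (Q.Grown.v∈T g₂)) l)
          is-b₁ : ∀ u → u ∈ Nodes → u ∈ B₁ → u ≡ b₁
          is-b₁ u (_ , r) b = trans (sym r) (in₁ u b)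
          is-b₂ : ∀ u → u ∈ Nodes → u ∈ B₂ → u ≡ b₂
          is-b₂ u (_ , r) b = trans (sym r) (in₂ u b)
          dL1 : Disj L B₁
          dL1 u l b = b₁∉L (subst (_∈ L) (is-b₁ u (L⊆N u l) b) l)
          dL2 : Disj L B₂
          dL2 u l b = b₂∉L (subst (_∈ L) (is-b₂ u (L⊆N u l) b) l)
          dM1 : Disj Mid B₁
          dM1 u m b = proj₂ m (is-b₁ u (L₂⊆N u (proj₁ (proj₁ m))) b)
          dM2 : Disj Mid B₂
          dM2 u m b = b₂∉L₂ (subst (_∈ L₂) (is-b₂ u (L₂⊆N u (proj₁ (proj₁ m))) b) (proj₁ (proj₁ m)))
          dR1 : Disj R B₁
          dR1 u r b = proj₂ (proj₁ r) (subst (_∈ L₂) (sym (is-b₁ u (proj₁ (proj₁ r)) b)) b₁∈L₂)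
          dR2 : Disj R B₂
          dR2 u r b = proj₂ r (is-b₂ u (proj₁ (proj₁ r)) b)
          thinL : Thin L
          thinL = thin L dL1 dL2
          thinM : Thin Mid
          thinM = thin Mid dM1 dM2
          thinR : Thin R
          thinR = thin R dR1 dR2
          q-node : q ∈ Nodes
          q-node = isNode q q∈O q∉₁ q∉₂
          q∈R : q ∈ R
          q∈R = (q-node , Q.Grown.q∉ g₂) , λ { refl → q∉₂ b₂∈ }
          locate : ∀ {v b} → rep v ≡ b → b ∈ Nodes → b ∉ L → b ≢ b₁ → v ∈ (Mid ∪ B₂) ∪ R
          locate {v} {b} r bN b∉L b≢ with v ∈? B₁ | v ∈? B₂
          ... | yes m | _ = ⊥-elim (b≢ (trans (sym r) (in₁ v m)))
          ... | no _ | yes m = inj₁ (inj₂ m)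
          ... | no ¬m | no ¬m′ with refl ← trans (sym (out v ¬m ¬m′)) r | b ∈? L₂
          ...   | yes l = inj₁ (inj₁ ((l , b∉L) , b≢))
          ...   | no ¬l = inj₂ ((bN , ¬l) , λ { refl → ¬m′ b₂∈ })
          locate₂ : ∀ {v b} → rep v ≡ b → b ∈ L₂ → v ∈ (Mid ∪ B₁) ∪ L
          locate₂ {v} {b} r b∈ with v ∈? B₁ | v ∈? B₂
          ... | yes m | _ = inj₁ (inj₂ m)
          ... | no _ | yes m = ⊥-elim (b₂∉L₂ (subst (_∈ L₂) (trans (sym r) (in₂ v m)) b∈))
          ... | no ¬m | no ¬m′ with refl ← trans (sym (out v ¬m ¬m′)) r | b ∈? L
          ...   | yes l = inj₂ l
          ...   | no ¬l = inj₁ (inj₁ ((b∈ , ¬l) , λ { refl → ¬m b₁∈ }))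
          spans : ∀ u → u ∈ O → u ∉ B₁ → u ∉ B₂ → u ∈ (L ∪ Mid) ∪ R
          spans u o ¬a ¬b with u ∈? L | u ∈? L₂
          ... | yes l | _ = inj₁ (inj₁ l)
          ... | no ¬l | yes l₂ = inj₁ (inj₂ ((l₂ , ¬l) , λ { refl → ¬a b₁∈ }))
          ... | no _ | no ¬l₂ = inj₂ ((isNode u o ¬a ¬b , ¬l₂) , λ { refl → ¬b b₂∈ })
          low₁ : Touch B₁ L
          low₁ with touchesL
          ... | Q.touch {a} a∈ refl (lift {u} {v} _ _ ru rv e) with refl ← thinL a a∈ u ru = touch (into₁ v rv) a∈ (E-sym e)
          high₁ : Touch B₁ ((Mid ∪ B₂) ∪ R)
          high₁ with Q.exit (Nodes ∖ L) ｛ b₁ ｝ (Q.Grown.co-conn g b₁ q (b₁-node , b₁∉L) (q-node , Q.Grown.q∉ g)) refl q≢b₁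
          ... | Q.exiting {a} {b} refl (bN , b∉L) b≢ (lift {u} {v} _ _ ru rv e) _ = touch (into₁ u ru) (locate rv bN b∉L b≢) e
          low₂ : Touch B₂ ((Mid ∪ B₁) ∪ L)
          low₂ with Q.Grown.touches g₂
          ... | Q.touch {a} a∈ refl (lift {u} {v} _ _ ru rv e) =
            touch (into₂ v (trans rv (Q.Grown.v∈T g₂))) (locate₂ ru a∈) (E-sym e)
          high₂ : Touch B₂ R
          high₂ with Q.exit (Nodes ∖ L₂) ｛ b₂ ｝ (Q.Grown.co-conn g₂ b₂ q (b₂-node , b₂∉L₂) (q-node , Q.Grown.q∉ g₂)) refl (λ { refl → q∉₂ b₂∈ })
          ... | Q.exiting {a} {b} refl bNL b≢ (lift {u} {v} _ _ ru rv e) _ with refl ← thinR b (bNL , b≢) v rv = touch (into₂ u ru) (bNL , b≢) e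
          up : ∀ u → u ∈ Mid → Touch (comp Mid u) (B₂ ∪ R)
          -- In the final segment without `b₁` a walk cannot leave `Mid` through `B₁`.
          up u m with Q.exit ((Nodes ∖ L) - b₁) (comp Mid u)
              (co-conn-b₁ u q ((L₂⊆N u (proj₁ (proj₁ m)) , proj₂ (proj₁ m)) , proj₂ m) ((q-node , Q.Grown.q∉ g) , q≢b₁))
              (stop m) (λ w → proj₂ (proj₁ q∈R) (proj₁ (proj₁ (end∈ w))))
          ... | Q.exiting {a} {b} a∈ ((bN , b∉L) , b≢) b∉ (lift {u′} {v} _ _ ru rv e) _ with refl ← thinM a (end∈ a∈) u′ ru | locate rv bN b∉L b≢
          ...   | inj₁ (inj₁ mv) = ⊥-elim (b∉ (subst (_∈ comp Mid u) (trans (sym (out v (dM1 v mv) (dM2 v mv))) rv) (comp-closed Mid u a∈ mv e)))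
          ...   | inj₁ (inj₂ bv) = touch a∈ (inj₁ bv) e
          ...   | inj₂ rr = touch a∈ (inj₂ rr) e
          down : ∀ u → u ∈ Mid → Touch (comp Mid u) (B₁ ∪ L)
          down u m with Q.exit L₂ (comp Mid u) (proj₂ (Q.Grown.conn g₂) u p (proj₁ (proj₁ m)) (L⊆L₂ p p∈L))
              (stop m) (λ w → proj₂ (proj₁ (end∈ w)) p∈L)
          ... | Q.exiting {a} {b} a∈ b∈ b∉ (lift {u′} {v} _ _ ru rv e) _ with refl ← thinM a (end∈ a∈) u′ ru | locate₂ rv b∈
          ...   | inj₁ (inj₁ mv) = ⊥-elim (b∉ (subst (_∈ comp Mid u) (trans (sym (out v (dM1 v mv) (dM2 v mv))) rv) (comp-closed Mid u a∈ mv e)))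
          ...   | inj₁ (inj₂ bv) = touch a∈ (inj₁ bv) e
          ...   | inj₂ ll = touch a∈ (inj₂ ll) e

        firstBlob : Q.Grown Nodes ｛ p ｝ (｛ b₁ ｝ ∪ ｛ b₂ ｝) q
        firstBlob = grow (｛ b₁ ｝ ∪ ｛ b₂ ｝) ｛ p ｝ (λ { _ refl → p-node }) (Q.Conn-single p) refl (p≢q ∘ sym)
          (Q.WConn-≐ (Nodes - p) (Nodes ∖ ｛ p ｝) (λ _ → id) (λ _ → id) (cutN p p-node))
          b₁ (inj₁ refl) (b₁-node , λ { refl → p∉₁ b₁∈ }) (λ { refl → q∉₁ b₁∈ })
          where
          p-node : p ∈ Nodes
          p-node = isNode p p∈O p∉₁ p∉₂

    -- Growth stops at whichever blob comes earlier, and `no-new` shows that the other one has not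
    -- been passed. Up to `swapped`, the earlier blob is `B₁`.
    sequenceOf : ∀ {b₁ b₂} → Contracted b₁ b₂ → Sequence O p q k
    sequenceOf {b₁} {b₂} C = go (Q.Grown.v∈T g)
      where
      open Contracted C
      g = firstBlob C
      b₁∉ : b₁ ∉ Q.Grown.L⁺ g
      b₁∉ l = p∉₁ (subst (_∈ B₁) (Q.Grown.no-new g b₁ l (inj₁ refl)) b₁∈)
      b₂∉ : b₂ ∉ Q.Grown.L⁺ g
      b₂∉ l = p∉₂ (subst (_∈ B₂) (Q.Grown.no-new g b₂ l (inj₂ refl)) b₂∈)
      go : Q.Grown.v g ≡ b₁ ⊎ Q.Grown.v g ≡ b₂ → Sequence O p q k
      go (inj₁ v≡) = ordered C g v≡ b₂∉
      go (inj₂ v≡) = ordered (swapped C) g v≡ b₁∉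

  branching : ∀ {O p q} ℓ h → TwoConn O → p ∈ O → q ∈ O → p ≢ q →
              TreeIn O (3 + (ℓ + (2 + (ℓ + suc h)))) → Apex ℓ ⊎ Outcome O p q (suc h)
  branching {O} {p} {q} ℓ h 2c p∈ q∈ p≢q t with avoidingTwo (rootBranch (TwoConn.conn 2c) t) p q
  ... | b , p∉ , q∉ , _ with children b
  ...   | fork l r l⊆ r⊆ apart
    with heavyBlob ℓ (1 + (ℓ + suc h)) 2c l p p∈ (p∉ ∘ l⊆ p) | heavyBlob ℓ (1 + (ℓ + suc h)) 2c r p p∈ (p∉ ∘ r⊆ p)
  ...     | inj₁ a | _ = inj₁ a
  ...     | inj₂ _ | inj₁ a = inj₁ a
  ...     | inj₂ (heavyIn B₁ B₁⊆ B₁⊆l two₁ tree₁ co₁) | inj₂ (heavyIn B₂ B₂⊆ B₂⊆r two₂ tree₂ co₂) =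
    FromSequence.outcome S ℓ h (Sequence.tree₁ S) (Sequence.tree₂ S) 2c
    where
    d12 : Disj B₁ B₂
    d12 x i j = apart x (B₁⊆l x i) (B₂⊆r x j)
    b₁ = proj₁ (proj₁ (TwoConn.conn two₁))
    b₁∈ = proj₂ (proj₁ (TwoConn.conn two₁))
    b₂ = proj₁ (proj₁ (TwoConn.conn two₂))
    b₂∈ = proj₂ (proj₁ (TwoConn.conn two₂))
    open Contraction O 2c B₁ B₂ B₁⊆ B₂⊆ d12 b₁ b₂ (λ _ _ → b₁∈) (λ _ _ → b₂∈) (λ _ _ → proj₂ co₁) (λ _ _ → proj₂ co₂)
    module S′ = Sequencing O 2c p q p∈ q∈ p≢q (2 + (ℓ + suc h)) rep idem stay
    S : Sequence O p q (2 + (ℓ + suc h))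
    S = S′.sequenceOf {b₁} {b₂} (record
      { blobs = record { B₁ = B₁ ; B₂ = B₂ ; B₁⊆ = B₁⊆ ; B₂⊆ = B₂⊆ ; two₁ = two₁ ; two₂ = two₂ ; tree₁ = tree₁ ; tree₂ = tree₂ ; d12 = d12 }
      ; p∉₁ = p∉ ∘ l⊆ p ∘ B₁⊆l p ; p∉₂ = p∉ ∘ r⊆ p ∘ B₂⊆r p
      ; q∉₁ = q∉ ∘ l⊆ q ∘ B₁⊆l q ; q∉₂ = q∉ ∘ r⊆ q ∘ B₂⊆r q ; b₁∈ = b₁∈ ; b₂∈ = b₂∈ ; in₁ = in₁ ; in₂ = in₂ ; out = out
      ; into₁ = into₁ b₁∈ ; into₂ = into₂ b₂∈ ; fibre = fibre ; cutN = cutN })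

  -- Combining nested ears

  -- Nab k b c S: a model of ∇ₖ₊₁ minus its root edge, with root bags b and c and all other bags in S.
  data Nab : ℕ → DSet n → DSet n → DSet n → Set₁ where
    tip  : ∀ {b c S} → Conn S → Touch b S → Touch S c → Nab 0 b c S
    join : ∀ {k b c S} a S₁ S₂ → Conn a → Touch b a → Touch a c → Nab k a b S₁ → Nab k a c S₂ →
           Disj a S₁ → Disj a S₂ → Disj S₁ S₂ → a ⊆ S → S₁ ⊆ S → S₂ ⊆ S → Nab (suc k) b c S

  mirror : ∀ {k b c S} → Nab k b c S → Nab k c b S
  mirror (tip s t u) = tip s (Touch-sym u) (Touch-sym t)
  mirror (join a S₁ S₂ ca t u m₁ m₂ d₁ d₂ d₃ s s₁ s₂) =
    join a S₂ S₁ ca (Touch-sym u) (Touch-sym t) m₂ m₁ d₂ d₁ (λ x p q → d₃ x q p) s s₂ s₁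

  Nab-mono : ∀ {k b b′ c c′ S} → b ⊆ b′ → c ⊆ c′ → Nab k b c S → Nab k b′ c′ S
  Nab-mono f g (tip s t u) = tip s (Touch-mono f (λ _ → id) t) (Touch-mono (λ _ → id) g u)
  Nab-mono f g (join a S₁ S₂ ca t u m₁ m₂ d₁ d₂ d₃ s s₁ s₂) =
    join a S₁ S₂ ca (Touch-mono f (λ _ → id) t) (Touch-mono (λ _ → id) g u)
      (Nab-mono (λ _ → id) f m₁) (Nab-mono (λ _ → id) g m₂) d₁ d₂ d₃ s s₁ s₂

  -- A model of Γ_i⁺ pinned at two terminals: `p` in the root bag lets a parent bag be attached, and
  -- `q` in the apex bag lets the apexes of siblings be merged.
  record Red (i : ℕ) (O : DSet n) (p q : Fin n) : Set₁ where
    constructor red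
    field
      {A R S} : DSet n
      p∈   : p ∈ R
      q∈   : q ∈ A
      A⊆   : A ⊆ O
      S⊆   : S ⊆ O
      conn : Conn A
      tree : Tr (TouchBag A) i R S
      S∌A  : Disj S A

  record Blue (j : ℕ) (O : DSet n) (p q : Fin n) : Set₁ where
    constructor blue
    field
      {b c S} : DSet n
      p∈ : p ∈ b
      q∈ : q ∈ c
      b⊆ : b ⊆ O
      c⊆ : c ⊆ O
      S⊆ : S ⊆ O
      b-conn : Conn b
      c-conn : Conn c
      nab : Nab j b c S
      dbc : Disj b c
      dbS : Disj b S
      dcS : Disj c S

  -- The surroundings of a child `B`: `U` leads from `p` to the terminal `p₁` of the child, and `V`
  -- from `q` to `q₁`. A coloured model in `B` becomes one of the same index in `O`, with terminals
  -- `p` and `q`.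
  record Collar (O B : DSet n) (p q p₁ q₁ : Fin n) : Set₁ where
    field
      U V : DSet n
      p∈ : p ∈ U
      q∈ : q ∈ V
      U⊆ : U ⊆ O
      V⊆ : V ⊆ O
      B⊆ : B ⊆ O
      U-conn : Conn U
      V-conn : Conn V
      dUV : Disj U V
      dUB : Disj U B
      dVB : Disj V B
      pU : Touch ｛ p₁ ｝ U
      qV : Touch ｛ q₁ ｝ V

  growRoot : ∀ {A A′ U h R S} → A ⊆ A′ → Tr (TouchBag A) h R S → Conn U → Touch R U → Disj U S →
             ∃ λ S′ → Tr (TouchBag A′) h (R ∪ U) S′ × S′ ⊆ S ∪ U
  growRoot {A} {A′} {U} {R = R} f (leaf (refl , c , t)) cU tU d = R ∪ U ,
    leaf (refl , Conn-touch c cU tU , Touch-mono (λ _ → inj₁) f t) , λ _ → id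
  growRoot {A} {A′} {U} f (node {R = R} {R₁} {S₁} {R₂} {S₂} c t₁ t₂ x₁ x₂ d₁ d₂ d₃) cU tU d =
    (R ∪ U) ∪ (S₁ ∪ S₂) ,
    node (Conn-touch c cU tU) (Tr-map weaken t₁) (Tr-map weaken t₂)
      (Touch-mono (λ _ → inj₁) (λ _ → id) x₁) (Touch-mono (λ _ → inj₁) (λ _ → id) x₂)
      (Disj-∪ R U S₁ d₁ (λ x u s → d x u (inj₂ (inj₁ s)))) (Disj-∪ R U S₂ d₂ (λ x u s → d x u (inj₂ (inj₂ s)))) d₃ ,
    λ { _ (inj₁ (inj₁ r)) → inj₁ (inj₁ r) ; _ (inj₁ (inj₂ u)) → inj₂ u ; _ (inj₂ s) → inj₁ (inj₂ s) }
    where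
    weaken : ∀ R S → TouchBag A R S → TouchBag A′ R S
    weaken R S (e , c , t) = e , c , Touch-mono (λ _ → id) f t

  collarRed : ∀ {i O B p q p₁ q₁} → Collar O B p q p₁ q₁ → Red i B p₁ q₁ → Red i O p q
  collarRed {O = O} {p₁ = p₁} {q₁} C (red {A} {R} {S} p∈ q∈ A⊆ S⊆ conn tree S∌A)
    with growRoot {A′ = A ∪ Collar.V C} (λ _ → inj₁) tree (Collar.U-conn C)
           (Touch-from p∈ (Collar.pU C))
           (λ x u s → Collar.dUB C x u (S⊆ x s))
  ... | S′ , t , S′⊆ = red (inj₂ C.p∈) (inj₂ C.q∈) (∪-least A C.V O (λ x a → C.B⊆ x (A⊆ x a)) C.V⊆)
      (λ x s → [ (λ z → C.B⊆ x (S⊆ x z)) , C.U⊆ x ] (S′⊆ x s))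
      (Conn-touch conn C.V-conn (Touch-from q∈ C.qV))
      t (λ x s → λ { (inj₁ a) → [ (λ z → S∌A x z a) , (λ u → C.dUB x u (A⊆ x a)) ] (S′⊆ x s)
                   ; (inj₂ v) → [ (λ z → C.dVB x v (S⊆ x z)) , (λ u → C.dUV x u v) ] (S′⊆ x s) })
    where module C = Collar C

  collarBlue : ∀ {j O B p q p₁ q₁} → Collar O B p q p₁ q₁ → Blue j B p₁ q₁ → Blue j O p q
  collarBlue {O = O} {p₁ = p₁} {q₁} C (blue {b} {c} {S} p∈ q∈ b⊆ c⊆ S⊆ cb cc nab dbc dbS dcS) = blue
    (inj₂ C.p∈) (inj₂ C.q∈) (∪-least b C.U O (λ x z → C.B⊆ x (b⊆ x z)) C.U⊆) (∪-least c C.V O (λ x z → C.B⊆ x (c⊆ x z)) C.V⊆)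
    (λ x z → C.B⊆ x (S⊆ x z))
    (Conn-touch cb C.U-conn (Touch-from p∈ C.pU))
    (Conn-touch cc C.V-conn (Touch-from q∈ C.qV))
    (Nab-mono (λ _ → inj₁) (λ _ → inj₁) nab)
    (λ { x (inj₁ z) (inj₁ w) → dbc x z w ; x (inj₁ z) (inj₂ v) → C.dVB x v (b⊆ x z)
       ; x (inj₂ u) (inj₁ w) → C.dUB x u (c⊆ x w) ; x (inj₂ u) (inj₂ v) → C.dUV x u v })
    (λ { x (inj₁ z) s → dbS x z s ; x (inj₂ u) s → C.dUB x u (S⊆ x s) })
    (λ { x (inj₁ z) s → dcS x z s ; x (inj₂ v) s → C.dVB x v (S⊆ x s) })
    where module C = Collar C

  redBase : ∀ {O p q} → TwoConn O → p ∈ O → q ∈ O → p ≢ q → Red 0 O p q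
  redBase {O} {p} {q} 2c p∈ q∈ p≢q = red {A = O - p} refl (q∈ , p≢q ∘ sym) (λ _ → proj₁) (λ { _ refl → p∈ })
    ((q , q∈ , p≢q ∘ sym) , TwoConn.cut 2c p p∈)
    (leaf (refl , Conn-single p , nbr)) (λ { _ refl z → proj₂ z refl })
    where
    nbr : Touch ｛ p ｝ (O - p)
    nbr with exit O ｛ p ｝ (proj₂ (TwoConn.conn 2c) p q p∈ q∈) refl (p≢q ∘ sym)
    ... | exiting refl b∈ b≢ e _ = touch refl (b∈ , b≢) e

  -- The third bag of the triangle is a component of `O - p - q`. It touches `p` because `O - q` is
  -- connected, and `q` because `O - p` is.
  blueBase : ∀ {O p q} → TwoConn O → p ∈ O → q ∈ O → p ≢ q → Blue 0 O p q
  blueBase {O} {p} {q} 2c p∈ q∈ p≢q with TwoConn.third 2c p q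
  ... | r , r∈ , r≢p , r≢q = blue refl refl (λ { _ refl → p∈ }) (λ { _ refl → q∈ }) (λ x w → proj₁ (proj₁ (end∈ w)))
      (Conn-single p) (Conn-single q)
      (tip (comp-conn ((O - p) - q) r r′)
           (Touch-sym (toEnd q p q∈ p∈ p≢q r≢q (λ x w z → (proj₁ w , z) , proj₂ w) (λ w → proj₂ (proj₁ (end∈ w)) refl)))
           (toEnd p q p∈ q∈ (p≢q ∘ sym) r≢p (λ x w z → w , z) (λ w → proj₂ (end∈ w) refl)))
      (λ { _ refl z → p≢q z }) (λ { _ refl w → proj₂ (proj₁ (end∈ w)) refl }) (λ { _ refl w → proj₂ (end∈ w) refl })
    where
    r′ : r ∈ (O - p) - q
    r′ = (r∈ , r≢p) , r≢q
    toEnd : ∀ u v → u ∈ O → v ∈ O → v ≢ u → r ≢ u → (∀ x → x ∈ O - u → x ≢ v → x ∈ (O - p) - q) →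
            v ∉ comp ((O - p) - q) r → Touch (comp ((O - p) - q) r) ｛ v ｝
    toEnd u v u∈ v∈ v≢u r≢u inside v∉
      with exit (O - u) (comp ((O - p) - q) r) (TwoConn.cut 2c u u∈ r v (r∈ , r≢u) (v∈ , v≢u)) (stop r′) v∉
    ... | exiting {a} {b} a∈ b∈ b∉ e _ with b ≟ v
    ...   | yes b≡v = touch a∈ b≡v e
    ...   | no b≢v = ⊥-elim (b∉ (comp-closed ((O - p) - q) r a∈ (inside b b∈ b≢v) e))

  module _ {O p q h} (T : Theta O p q h) where
    open Theta T
    private
      module C₁ = Child child₁
      module C₂ = Child child₂

    thetaCollar₁ : Collar O B₁ p q C₁.p C₁.q
    thetaCollar₁ = record { U = L ; V = R ; p∈ = p∈ ; q∈ = q∈ ; U⊆ = L⊆ ; V⊆ = R⊆ ; B⊆ = C₁.B⊆ ; U-conn = L-conn ; V-conn = R-conn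
                          ; dUV = dLR ; dUB = dL1 ; dVB = dR1 ; pU = C₁.pU ; qV = C₁.qV }

    thetaCollar₂ : Collar O B₂ p q C₂.p C₂.q
    thetaCollar₂ = record { U = L ; V = R ; p∈ = p∈ ; q∈ = q∈ ; U⊆ = L⊆ ; V⊆ = R⊆ ; B⊆ = C₂.B⊆ ; U-conn = L-conn ; V-conn = R-conn
                          ; dUV = dLR ; dUB = dL2 ; dVB = dR2 ; pU = C₂.pU ; qV = C₂.qV }

    thetaRed : ∀ {i} → Red i B₁ C₁.p C₁.q → Red i B₂ C₂.p C₂.q → Red (suc i) O p q
    thetaRed (red {A₁} {R₁} {S₁} p₁ q₁ A₁⊆ S₁⊆ c₁ t₁ d₁) (red {A₂} {R₂} {S₂} p₂ q₂ A₂⊆ S₂⊆ c₂ t₂ d₂) =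
      red {A = A} p∈ (inj₁ (inj₁ q∈))
        (∪-least (R ∪ A₁) A₂ O (∪-least R A₁ O R⊆ (λ x a → C₁.B⊆ x (A₁⊆ x a))) (λ x a → C₂.B⊆ x (A₂⊆ x a)))
        (∪-least L (S₁ ∪ S₂) O L⊆ (∪-least S₁ S₂ O (λ x s → C₁.B⊆ x (S₁⊆ x s)) (λ x s → C₂.B⊆ x (S₂⊆ x s))))
        (Conn-touch (Conn-touch R-conn c₁ (Touch-sym (Touch-from q₁ C₁.qV))) c₂
          (Touch-sym (Touch-mono (λ { _ refl → q₂ }) (λ _ → inj₁) C₂.qV)))
        (node L-conn (Tr-map (weaken A₁ (λ _ → inj₁ ∘ inj₂)) t₁) (Tr-map (weaken A₂ (λ _ → inj₂)) t₂)
          (Touch-sym (Touch-from p₁ C₁.pU))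
          (Touch-sym (Touch-from p₂ C₂.pU))
          (λ x l s → dL1 x l (S₁⊆ x s)) (λ x l s → dL2 x l (S₂⊆ x s)) (λ x s s′ → d12 x (S₁⊆ x s) (S₂⊆ x s′)))
        (λ { x (inj₁ l) (inj₁ (inj₁ r)) → dLR x l r ; x (inj₁ l) (inj₁ (inj₂ a)) → dL1 x l (A₁⊆ x a) ; x (inj₁ l) (inj₂ a) → dL2 x l (A₂⊆ x a)
           ; x (inj₂ (inj₁ s)) (inj₁ (inj₁ r)) → dR1 x r (S₁⊆ x s) ; x (inj₂ (inj₁ s)) (inj₁ (inj₂ a)) → d₁ x s a
           ; x (inj₂ (inj₁ s)) (inj₂ a) → d12 x (S₁⊆ x s) (A₂⊆ x a)
           ; x (inj₂ (inj₂ s)) (inj₁ (inj₁ r)) → dR2 x r (S₂⊆ x s) ; x (inj₂ (inj₂ s)) (inj₁ (inj₂ a)) → d12 x (A₁⊆ x a) (S₂⊆ x s)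
           ; x (inj₂ (inj₂ s)) (inj₂ a) → d₂ x s a })
      where
      A = (R ∪ A₁) ∪ A₂
      weaken : ∀ A₀ → A₀ ⊆ A → ∀ R S → TouchBag A₀ R S → TouchBag A R S
      weaken A₀ f R S (e , c , t) = e , c , Touch-mono (λ _ → id) f t

  module _ {O p q h} (T : Series O p q h) where
    open Series T
    private
      module C₁ = Child child₁
      module C₂ = Child child₂

    seriesCollar₁ : Collar O B₁ p q C₁.p C₁.q
    seriesCollar₁ = record { U = b ; V = a ∪ c ; p∈ = p∈ ; q∈ = inj₂ q∈ ; U⊆ = b⊆ ; V⊆ = ∪-least a c O a⊆ c⊆ ; B⊆ = C₁.B⊆
      ; U-conn = b-conn ; V-conn = Conn-touch a-conn c-conn ac
      ; dUV = λ { x u (inj₁ z) → dba x u z ; x u (inj₂ z) → dbc x u z } ; dUB = db1 ; dVB = Disj-∪ a c B₁ da1 dc1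
      ; pU = C₁.pU ; qV = Touch-mono (λ _ → id) (λ _ → inj₁) C₁.qV }

    seriesCollar₂ : Collar O B₂ p q C₂.p C₂.q
    seriesCollar₂ = record { U = b ∪ a ; V = c ; p∈ = inj₁ p∈ ; q∈ = q∈ ; U⊆ = ∪-least b a O b⊆ a⊆ ; V⊆ = c⊆ ; B⊆ = C₂.B⊆
      ; U-conn = Conn-touch b-conn a-conn ba ; V-conn = c-conn
      ; dUV = Disj-∪ b a c dbc dac ; dUB = Disj-∪ b a B₂ db2 da2 ; dVB = dc2
      ; pU = Touch-mono (λ _ → id) (λ _ → inj₂) C₂.pU ; qV = C₂.qV }

    -- The new middle corner absorbs the corners `c₁` and `b₂` of the smaller models that face it.
    -- The contacts `ba` and `ac` supply the root edges that the two smaller models lack.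
    seriesBlue : ∀ {j} → Blue j B₁ C₁.p C₁.q → Blue j B₂ C₂.p C₂.q → Blue (suc j) O p q
    seriesBlue (blue {b₁} {c₁} {S₁} p₁ q₁ b₁⊆ c₁⊆ S₁⊆ cb₁ cc₁ nab₁ dbc₁ dbS₁ dcS₁)
               (blue {b₂} {c₂} {S₂} p₂ q₂ b₂⊆ c₂⊆ S₂⊆ cb₂ cc₂ nab₂ dbc₂ dbS₂ dcS₂) =
      blue {b = b′} {c′} {S′} (inj₁ p∈) (inj₁ q∈)
        (∪-least b b₁ O b⊆ (λ x z → C₁.B⊆ x (b₁⊆ x z))) (∪-least c c₂ O c⊆ (λ x z → C₂.B⊆ x (c₂⊆ x z)))
        (∪-least a′ (S₁ ∪ S₂) O
          (∪-least (a ∪ c₁) b₂ O (∪-least a c₁ O a⊆ (λ x z → C₁.B⊆ x (c₁⊆ x z))) (λ x z → C₂.B⊆ x (b₂⊆ x z)))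
          (∪-least S₁ S₂ O (λ x z → C₁.B⊆ x (S₁⊆ x z)) (λ x z → C₂.B⊆ x (S₂⊆ x z))))
        (Conn-touch b-conn cb₁ (Touch-sym (Touch-from p₁ C₁.pU)))
        (Conn-touch c-conn cc₂ (Touch-sym (Touch-from q₂ C₂.qV)))
        (join a′ S₁ S₂
          (Conn-touch (Conn-touch a-conn cc₁ (Touch-sym (Touch-from q₁ C₁.qV))) cb₂
            (Touch-sym (Touch-mono (λ { _ refl → p₂ }) (λ _ → inj₁) C₂.pU)))
          (Touch-mono (λ _ → inj₁) (λ _ → inj₁ ∘ inj₁) ba) (Touch-mono (λ _ → inj₁ ∘ inj₁) (λ _ → inj₁) ac)
          -- `join` takes the copy on this side from `a` to `b`, whereas `child₁` runs from `b` to
          -- `a`.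
          (Nab-mono (λ _ → inj₁ ∘ inj₂) (λ _ → inj₂) (mirror nab₁)) (Nab-mono (λ _ → inj₂) (λ _ → inj₂) nab₂)
          (λ { x (inj₁ (inj₁ z)) s → da1 x z (S₁⊆ x s) ; x (inj₁ (inj₂ z)) s → dcS₁ x z s ; x (inj₂ z) s → d12 x (S₁⊆ x s) (b₂⊆ x z) })
          (λ { x (inj₁ (inj₁ z)) s → da2 x z (S₂⊆ x s) ; x (inj₁ (inj₂ z)) s → d12 x (c₁⊆ x z) (S₂⊆ x s) ; x (inj₂ z) s → dbS₂ x z s })
          (λ x s s′ → d12 x (S₁⊆ x s) (S₂⊆ x s′))
          (λ _ → inj₁) (λ _ → inj₂ ∘ inj₁) (λ _ → inj₂ ∘ inj₂))
        (λ { x (inj₁ z) (inj₁ w) → dbc x z w ; x (inj₁ z) (inj₂ w) → db2 x z (c₂⊆ x w)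
           ; x (inj₂ z) (inj₁ w) → dc1 x w (b₁⊆ x z) ; x (inj₂ z) (inj₂ w) → d12 x (b₁⊆ x z) (c₂⊆ x w) })
        (λ { x (inj₁ z) (inj₁ (inj₁ (inj₁ w))) → dba x z w ; x (inj₁ z) (inj₁ (inj₁ (inj₂ w))) → db1 x z (c₁⊆ x w)
           ; x (inj₁ z) (inj₁ (inj₂ w)) → db2 x z (b₂⊆ x w)
           ; x (inj₁ z) (inj₂ (inj₁ s)) → db1 x z (S₁⊆ x s) ; x (inj₁ z) (inj₂ (inj₂ s)) → db2 x z (S₂⊆ x s)
           ; x (inj₂ z) (inj₁ (inj₁ (inj₁ w))) → da1 x w (b₁⊆ x z) ; x (inj₂ z) (inj₁ (inj₁ (inj₂ w))) → dbc₁ x z w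
           ; x (inj₂ z) (inj₁ (inj₂ w)) → d12 x (b₁⊆ x z) (b₂⊆ x w)
           ; x (inj₂ z) (inj₂ (inj₁ s)) → dbS₁ x z s ; x (inj₂ z) (inj₂ (inj₂ s)) → d12 x (b₁⊆ x z) (S₂⊆ x s) })
        (λ { x (inj₁ z) (inj₁ (inj₁ (inj₁ w))) → dac x w z ; x (inj₁ z) (inj₁ (inj₁ (inj₂ w))) → dc1 x z (c₁⊆ x w)
           ; x (inj₁ z) (inj₁ (inj₂ w)) → dc2 x z (b₂⊆ x w)
           ; x (inj₁ z) (inj₂ (inj₁ s)) → dc1 x z (S₁⊆ x s) ; x (inj₁ z) (inj₂ (inj₂ s)) → dc2 x z (S₂⊆ x s)
           ; x (inj₂ z) (inj₁ (inj₁ (inj₁ w))) → da2 x w (c₂⊆ x z) ; x (inj₂ z) (inj₁ (inj₁ (inj₂ w))) → d12 x (c₁⊆ x w) (c₂⊆ x z)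
           ; x (inj₂ z) (inj₁ (inj₂ w)) → dbc₂ x w z
           ; x (inj₂ z) (inj₂ (inj₁ s)) → d12 x (S₁⊆ x s) (c₂⊆ x z) ; x (inj₂ z) (inj₂ (inj₂ s)) → dcS₂ x z s })
      where
      b′ = b ∪ b₁
      c′ = c ∪ c₂
      a′ = (a ∪ c₁) ∪ b₂
      S′ = a′ ∪ (S₁ ∪ S₂)

  private
    pair : {Z A B C D X : Set₁} → Z ⊎ (A ⊎ B) → Z ⊎ (C ⊎ D) → (A → C → X) → (B → X) → (D → X) → Z ⊎ X
    pair (inj₁ z) _ f g h = inj₁ z
    pair (inj₂ _) (inj₁ z) f g h = inj₁ z
    pair (inj₂ (inj₁ a)) (inj₂ (inj₁ c)) f g h = inj₂ (f a c)
    pair (inj₂ (inj₂ b)) (inj₂ _) f g h = inj₂ (g b)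
    pair (inj₂ (inj₁ _)) (inj₂ (inj₂ d)) f g h = inj₂ (h d)

  -- The Ramsey argument as an induction: a theta lowers the demand on `Red`, a series that on
  -- `Blue`. Progress takes both children; if one of them yields the other colour instead, it does
  -- so at the full index, and a collar carries it to `O`. By `i + j ≤ suc k` one demand is zero
  -- once `k` is.
  redOrBlue : ∀ ℓ k i j → i + j ≤ suc k → ∀ {O p q} → TwoConn O → p ∈ O → q ∈ O → p ≢ q →
              TreeIn O (suc (depth ℓ k)) → Apex ℓ ⊎ (Red i O p q ⊎ Blue j O p q)
  redOrBlue ℓ k zero j _ 2c p∈ q∈ p≢q t = inj₂ (inj₁ (redBase 2c p∈ q∈ p≢q))
  redOrBlue ℓ k (suc i) zero _ 2c p∈ q∈ p≢q t = inj₂ (inj₂ (blueBase 2c p∈ q∈ p≢q))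
  redOrBlue ℓ zero (suc i) (suc j) (s≤s le) with () ← ≤-trans (≤-reflexive (sym (+-suc i j))) le
  redOrBlue ℓ (suc k) (suc i) (suc j) (s≤s le) {O} {p} {q} 2c p∈ q∈ p≢q t with branching ℓ (depth ℓ k) 2c p∈ q∈ p≢q t
  ... | inj₁ a = inj₁ a
  ... | inj₂ (theta T) = pair
          (redOrBlue ℓ k i (suc j) le C₁.two C₁.p∈ C₁.q∈ C₁.p≢q C₁.tree)
          (redOrBlue ℓ k i (suc j) le C₂.two C₂.p∈ C₂.q∈ C₂.p≢q C₂.tree)
          (λ r₁ r₂ → inj₁ (thetaRed T r₁ r₂)) (inj₂ ∘ collarBlue (thetaCollar₁ T)) (inj₂ ∘ collarBlue (thetaCollar₂ T))
    where
    module C₁ = Child (Theta.child₁ T)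
    module C₂ = Child (Theta.child₂ T)
  ... | inj₂ (series T) = pair
          (map₂ swap (redOrBlue ℓ k (suc i) j (≤-trans (≤-reflexive (sym (+-suc i j))) le) C₁.two C₁.p∈ C₁.q∈ C₁.p≢q C₁.tree))
          (map₂ swap (redOrBlue ℓ k (suc i) j (≤-trans (≤-reflexive (sym (+-suc i j))) le) C₂.two C₂.p∈ C₂.q∈ C₂.p≢q C₂.tree))
          (λ b₁ b₂ → inj₂ (seriesBlue T b₁ b₂)) (inj₁ ∘ collarRed (seriesCollar₁ T)) (inj₁ ∘ collarRed (seriesCollar₂ T))
    where
    module C₁ = Child (Series.child₁ T)
    module C₂ = Child (Series.child₂ T)

  -- Menger's theorem

  -- Arcs are directed, so that a single direction of an edge can be deleted. Numbering the pairs
  -- makes them a `DSet`, whose `card` bounds the recursion of `menger`.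
  Arcs : Set₁
  Arcs = DSet (n * n)

  Arc : Arcs → Fin n → Fin n → Set
  Arc D u v = combine u v ∈ D

  ∂ : Arcs → DSet n → DSet n
  has  (∂ D U) u = u ∈ U × ∃ λ v → v ∉ U × Arc D u v
  has? (∂ D U) u = (u ∈? U) ×-dec any? λ v → ¬? (v ∈? U) ×-dec (combine u v ∈? D)

  ∂-ext : ∀ D U V → U ⊆ V → V ⊆ U → ∂ D U ⊆ ∂ D V
  ∂-ext D U V f g u (u∈ , v , v∉ , e) = f u u∈ , v , v∉ ∘ g v , e

  record Linkage (D : Arcs) (X Y : DSet n) : Set₁ where
    field
      P      : ∀ a → a ∈ ∂ D X → DSet n
      conn   : ∀ a i → Conn (P a i)
      start  : ∀ a i → a ∈ P a i
      inside : ∀ a i → P a i ⊆ Y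
      only   : ∀ a i x → x ∈ P a i → x ∈ X → x ≡ a
      apart  : ∀ a b i j → a ≢ b → Disj (P a i) (P b j)
      end    : ∀ a i → ∃ λ b → b ∈ P a i × b ∈ ∂ D Y

  private
    trivial : ∀ D X Y → X ⊆ Y → ∂ D X ⊆ ∂ D Y → Linkage D X Y
    trivial D X Y X⊆Y s = record
      { P = λ a _ → ｛ a ｝ ; conn = λ a _ → Conn-single a ; start = λ _ _ → refl ; inside = λ { a i _ refl → X⊆Y a (proj₁ i) }
      ; only = λ { _ _ _ refl _ → refl } ; apart = λ { _ _ _ _ a≢b _ refl refl → a≢b refl } ; end = λ a i → a , refl , s a i }

    compose : ∀ D X U Y → X ⊆ U → U ⊆ Y → Linkage D X U → Linkage D U Y → Linkage D X Y
    compose D X U Y X⊆U U⊆Y L M = record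
      { P = λ a i → L.P a i ∪ M.P (b a i) (b∂ a i)
      ; conn = λ a i → Conn-share (L.conn a i) (M.conn (b a i) (b∂ a i)) (b a i) (b∈ a i) (M.start (b a i) (b∂ a i))
      ; start = λ a i → inj₁ (L.start a i)
      ; inside = λ { a i x (inj₁ z) → U⊆Y x (L.inside a i x z) ; a i x (inj₂ z) → M.inside _ _ x z }
      ; only = λ { a i x (inj₁ z) x∈ → L.only a i x z x∈
                 ; a i x (inj₂ z) x∈ → L.only a i x (subst (_∈ L.P a i) (sym (M.only _ _ x z (X⊆U x x∈))) (b∈ a i)) x∈ }
      ; apart = apart
      ; end = λ a i → let (c , c∈ , c∂) = M.end (b a i) (b∂ a i) in c , inj₂ c∈ , c∂ }
      where
      module L = Linkage L
      module M = Linkage M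
      b : ∀ a → a ∈ ∂ D X → Fin n
      b a i = proj₁ (L.end a i)
      b∈ : ∀ a i → b a i ∈ L.P a i
      b∈ a i = proj₁ (proj₂ (L.end a i))
      b∂ : ∀ a i → b a i ∈ ∂ D U
      b∂ a i = proj₂ (proj₂ (L.end a i))
      apart : ∀ a a′ i j → a ≢ a′ → Disj (L.P a i ∪ M.P (b a i) (b∂ a i)) (L.P a′ j ∪ M.P (b a′ j) (b∂ a′ j))
      apart a a′ i j ne x (inj₁ z) (inj₁ w) = L.apart a a′ i j ne x z w
      apart a a′ i j ne x (inj₁ z) (inj₂ w) =
        L.apart a a′ i j ne x z (subst (_∈ L.P a′ j) (sym (M.only _ _ x w (L.inside a i x z))) (b∈ a′ j))
      apart a a′ i j ne x (inj₂ z) (inj₁ w) =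
        L.apart a a′ i j ne x (subst (_∈ L.P a i) (sym (M.only _ _ x z (L.inside a′ j x w))) (b∈ a i)) w
      apart a a′ i j ne x (inj₂ z) (inj₂ w) =
        M.apart _ _ _ _ (λ eq → L.apart a a′ i j ne (b a i) (b∈ a i) (subst (_∈ L.P a′ j) (sym eq) (b∈ a′ j))) x z w

    -- Y = X ∪ {y}: y replaces the only vertex a of ∂ X that leaves the boundary.
    single : ∀ D → (∀ u v → Arc D u v → E u v) → ∀ X Y → X ⊆ Y → card (∂ D X) ≤ card (∂ D Y) →
             ∀ a y → a ∈ ∂ D X → a ∉ ∂ D Y → y ∈ Y → y ∉ X → Arc D a y → (∀ z → z ∈ Y → z ∉ X → z ≡ y) → Linkage D X Y
    single D D⊆E X Y X⊆Y le a y a∂ a∉ y∈Y y∉X ay uniq = record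
      { P = λ c _ → P c ; conn = λ c _ → P-conn c ; start = λ _ _ → inj₁ refl
      ; inside = λ { c i _ (inj₁ refl) → X⊆Y c (proj₁ i) ; c i _ (inj₂ (refl , _)) → y∈Y }
      ; only = λ { c i _ (inj₁ refl) _ → refl ; c i _ (inj₂ (refl , _)) y∈ → ⊥-elim (y∉X y∈) }
      ; apart = λ { c d i j c≢d x (inj₁ refl) (inj₁ refl) → c≢d refl ; c d i j c≢d x (inj₁ refl) (inj₂ (refl , _)) → y∉X (proj₁ i)
                  ; c d i j c≢d x (inj₂ (refl , _)) (inj₁ refl) → y∉X (proj₁ j) ; c d i j c≢d x (inj₂ (_ , refl)) (inj₂ (_ , refl)) → c≢d refl }
      ; end = end }
      where
      P : Fin n → DSet n
      has  (P c) x = x ≡ c ⊎ (x ≡ y × c ≡ a)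
      has? (P c) x = (x ≟ c) ⊎-dec ((x ≟ y) ×-dec (c ≟ a))
      P-conn : ∀ c → Conn (P c)
      P-conn c = hub (P c) c (inj₁ refl) λ { _ (inj₁ refl) → stop (inj₁ refl) ; _ (inj₂ (refl , refl)) → edge (inj₂ (refl , refl)) (inj₁ refl) (E-sym (D⊆E a y ay)) }
      toX : ∀ x → x ∈ ∂ D Y → x ≢ y → x ∈ ∂ D X
      toX x (x∈ , v , v∉ , e) x≢y with x ∈? X
      ... | yes x∈X = x∈X , v , v∉ ∘ X⊆Y v , e
      ... | no x∉X = ⊥-elim (x≢y (uniq x x∈ x∉X))
      y∂ : y ∈ ∂ D Y
      y∂ with y ∈? ∂ D Y
      ... | yes z = z
      ... | no ¬z = ⊥-elim (<⇒≱ (card-strict (∂ D Y) (∂ D X) (λ x b → toX x b (λ { refl → ¬z b })) a a∂ a∉) le)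
      end : ∀ c → c ∈ ∂ D X → ∃ λ b → b ∈ P c × b ∈ ∂ D Y
      end c c∂ with c ≟ a | c ∈? ∂ D Y
      ... | yes c≡a | _ = y , inj₂ (refl , c≡a) , y∂
      ... | no _ | yes z = c , inj₁ refl , z
      ... | no c≢a | no ¬z = ⊥-elim (<⇒≱ (≤-<-trans
              (card-add ((∂ D X - a) - c) (∂ D Y) y (λ x b x≢y → (toX x b x≢y , λ { refl → a∉ b }) , λ { refl → ¬z b }))
              (≤-<-trans (card-minus (∂ D X - a) c (c∂ , c≢a))
                         (card-minus (∂ D X) a a∂))) le)

    Between : Arcs → DSet n → DSet n → DSet n → Set
    Between D X Y U = X ⊆ U × U ⊆ Y × (∃ λ v → v ∈ U × v ∉ X) × (∃ λ v → v ∈ Y × v ∉ U) × card (∂ D U) ≤ card (∂ D X)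

    between : ∀ D X Y → Σ (DSet n) (Between D X Y) ⊎ (∀ U → ¬ Between D X Y U)
    between D X Y = searchSets (Between D X Y)
      (λ U → (X ⊆? U) ×-dec ((U ⊆? Y) ×-dec ((any? λ v → (v ∈? U) ×-dec ¬? (v ∈? X)) ×-dec
             ((any? λ v → (v ∈? Y) ×-dec ¬? (v ∈? U)) ×-dec (card (∂ D U) ≤? card (∂ D X))))))
      (λ { U V f g (p , q , (v , v∈ , v∉) , (w , w∈ , w∉) , le) →
           (λ x → f x ∘ p x) , (λ x → q x ∘ g x) , (v , f v v∈ , v∉) , (w , w∈ , w∉ ∘ g w) ,
           ≤-trans (card-mono (∂ D V) (∂ D U) (∂-ext D V U g f)) le })

  -- If no set strictly between X and Y has a boundary as small as ∂ X, then an arc from X into Y ∖ X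
  -- can be deleted; otherwise such a set splits the problem.
  abstract
    menger : ∀ k m D → (∀ u v → Arc D u v → E u v) → ∀ X Y → card (Y ∖ X) ≤ k → card D ≤ m → X ⊆ Y →
             (∀ U → X ⊆ U → U ⊆ Y → card (∂ D X) ≤ card (∂ D U)) → Linkage D X Y
    menger k m D D⊆E X Y lk lm X⊆Y H with any? (λ a → (a ∈? ∂ D X) ×-dec ¬? (a ∈? ∂ D Y))
    ... | no none = trivial D X Y X⊆Y sub
      where
      sub : ∂ D X ⊆ ∂ D Y
      sub a i with a ∈? ∂ D Y
      ... | yes z = z
      ... | no ¬z = ⊥-elim (none (a , i , ¬z))
    ... | yes (a , a∂@(a∈X , y , y∉X , ay) , a∉) with y ∈? Y
    ...   | no y∉Y = ⊥-elim (a∉ (X⊆Y a a∈X , y , y∉Y , ay))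
    ...   | yes y∈Y with any? (λ z → ((z ∈? Y) ×-dec ¬? (z ∈? X)) ×-dec ¬? (z ≟ y))
    ...     | no lone = single D D⊆E X Y X⊆Y (H Y X⊆Y (λ _ → id)) a y a∂ a∉ y∈Y y∉X ay uniq
      where
      uniq : ∀ z → z ∈ Y → z ∉ X → z ≡ y
      uniq z z∈ z∉ with z ≟ y
      ... | yes eq = eq
      ... | no ne = ⊥-elim (lone (z , (z∈ , z∉) , ne))
    ...     | yes (z , (z∈Y , z∉X) , z≢y) with between D X Y
    ...       | inj₁ (U , X⊆U , U⊆Y , (v , v∈U , v∉X) , (w , w∈Y , w∉U) , le) = halve k lk
      where
      halve : ∀ k → card (Y ∖ X) ≤ k → Linkage D X Y
      halve zero lk = ⊥-elim (card-0 (Y ∖ X) y (y∈Y , y∉X) lk)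
      -- The recursion is lexicographic: splitting lowers `k` and resets the arc count, pruning
      -- keeps `k` and lowers the arc count.
      halve (suc k) lk = compose D X U Y X⊆U U⊆Y
        (menger k (card D) D D⊆E X U
          (card-drop (U ∖ X) (Y ∖ X) (λ x p → U⊆Y x (proj₁ p) , proj₂ p) w (w∈Y , w∉U ∘ X⊆U w) (w∉U ∘ proj₁) lk)
          ≤-refl X⊆U (λ V f g → H V f (λ x → U⊆Y x ∘ g x)))
        (menger k (card D) D D⊆E U Y
          (card-drop (Y ∖ U) (Y ∖ X) (λ x p → proj₁ p , proj₂ p ∘ X⊆U x) v (U⊆Y v v∈U , v∉X) (λ p → proj₂ p v∈U) lk)
          ≤-refl U⊆Y (λ V f g → ≤-trans le (H V (λ x → f x ∘ X⊆U x) g)))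
    ...       | inj₂ none = record
      { P = λ b i → M.P b (keepX b i) ; conn = λ b i → M.conn b (keepX b i) ; start = λ b i → M.start b (keepX b i)
      ; inside = λ b i → M.inside b (keepX b i) ; only = λ b i → M.only b (keepX b i)
      ; apart = λ b c i j → M.apart b c (keepX b i) (keepX c j)
      ; end = λ b i → let (c , c∈ , c∂) = M.end b (keepX b i) in c , c∈ , fewer Y c c∂ }
      where
      D′ : Arcs
      D′ = D - combine a y
      keep : ∀ u v → Arc D u v → u ≢ a → Arc D′ u v
      keep u v e u≢a = e , λ eq → u≢a (proj₁ (combine-injective u v a y eq))
      fewer : ∀ U → ∂ D′ U ⊆ ∂ D U
      fewer U u (u∈ , v , v∉ , e) = u∈ , v , v∉ , proj₁ e
      most : ∀ U u → u ∈ ∂ D U → u ≢ a → u ∈ ∂ D′ U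
      most U u (u∈ , v , v∉ , e) u≢a = u∈ , v , v∉ , keep u v e u≢a
      strict : ∀ U → X ⊆ U → U ⊆ Y → ∀ v → v ∈ U → v ∉ X → ∀ w → w ∈ Y → w ∉ U → card (∂ D X) < card (∂ D U)
      strict U f g v v∈ v∉ w w∈ w∉ = ≰⇒> λ le → none U (f , g , (v , v∈ , v∉) , (w , w∈ , w∉) , le)
      -- Deleting one arc costs a boundary at most one vertex. A set strictly between `X` and `Y`
      -- has one to spare; for `X` itself the bound is trivial; the boundary of `Y` does not contain
      -- `a` and so loses nothing.
      H′ : ∀ U → X ⊆ U → U ⊆ Y → card (∂ D′ X) ≤ card (∂ D′ U)
      H′ U f g with any? (λ v → (v ∈? U) ×-dec ¬? (v ∈? X)) | any? (λ w → (w ∈? Y) ×-dec ¬? (w ∈? U))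
      ... | no noV | _ = card-mono (∂ D′ X) (∂ D′ U) (∂-ext D′ X U f back)
        where
        back : U ⊆ X
        back u u∈ with u ∈? X
        ... | yes p = p
        ... | no ¬p = ⊥-elim (noV (u , u∈ , ¬p))
      ... | yes (v , v∈ , v∉) | yes (w , w∈ , w∉) =
        ≤-trans (card-mono (∂ D′ X) (∂ D X) (fewer X))
          (≤-pred (≤-trans (strict U f g v v∈ v∉ w w∈ w∉) (card-add (∂ D′ U) (∂ D U) a (most U))))
      ... | yes _ | no noW =
        ≤-trans (card-mono (∂ D′ X) (∂ D X) (fewer X))
          (≤-trans (H U f g) (card-mono (∂ D U) (∂ D′ U) λ u u∂ → most U u u∂ (λ { refl → a∉ (∂-ext D U Y g back u u∂) })))
        where
        back : Y ⊆ U
        back u u∈ with u ∈? U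
        ... | yes p = p
        ... | no ¬p = ⊥-elim (noW (u , u∈ , ¬p))
      -- If the deleted arc were the only one from `a` out of `X`, adding `y` to `X` would trade `a`
      -- for at most `y` in the boundary. But `X ∪ ｛ y ｝` omits `z`, so it lies strictly between and
      -- has a larger boundary.
      a-stays : a ∈ ∂ D′ X
      a-stays with a ∈? ∂ D′ X
      ... | yes p = p
      ... | no ¬p = ⊥-elim (<⇒≱
              (strict (X ∪ ｛ y ｝) (λ _ → inj₁) (λ { x (inj₁ i) → X⊆Y x i ; x (inj₂ refl) → y∈Y }) y (inj₂ refl) y∉X z z∈Y [ z∉X , z≢y ])
              (≤-trans (card-add (∂ D X - a) (∂ D (X ∪ ｛ y ｝)) y leaving)
                       (card-minus (∂ D X) a a∂)))
        where
        leaving : ∀ x → x ∈ ∂ D (X ∪ ｛ y ｝) → x ≢ y → x ∈ ∂ D X - a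
        leaving x (inj₂ x≡y , _) x≢y = ⊥-elim (x≢y x≡y)
        leaving x (inj₁ x∈ , v , v∉ , e) x≢y = (x∈ , v , v∉ ∘ inj₁ , e) ,
          λ { refl → ¬p (x∈ , v , v∉ ∘ inj₁ , e , λ eq → v∉ (inj₂ (proj₂ (combine-injective a v a y eq)))) }
      keepX : ∀ b → b ∈ ∂ D X → b ∈ ∂ D′ X
      keepX b i with b ≟ a
      ... | yes refl = a-stays
      ... | no b≢a = most X b i b≢a
      prune : ∀ m → card D ≤ m → Linkage D′ X Y
      prune zero lm = ⊥-elim (card-0 D (combine a y) ay lm)
      prune (suc m) lm = menger k m D′ (λ u v e → D⊆E u v (proj₁ e)) X Y lk
        (card-drop D′ D (λ _ → proj₁) (combine a y) ay (λ p → proj₂ p refl) lm) X⊆Y H′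
      module M = Linkage (prune m lm)

  -- Trees from large pathwidth

  arcs : Arcs
  has  arcs e = E (proj₁ (remQuot {n} n e)) (proj₂ (remQuot {n} n e))
  has? arcs e = E? (proj₁ (remQuot {n} n e)) (proj₂ (remQuot {n} n e))

  arc⁺ : ∀ {u v} → E u v → Arc arcs u v
  arc⁺ {u} {v} e = subst (λ p → E (proj₁ p) (proj₂ p)) (sym (remQuot-combine u v)) e

  arc⁻ : ∀ u v → Arc arcs u v → E u v
  arc⁻ u v e = subst (λ p → E (proj₁ p) (proj₂ p)) (remQuot-combine u v) e

  bd : DSet n → DSet n
  bd = ∂ arcs

  -- The last bag of a path decomposition of X contains ∂ X, so that further vertices can be appended.
  record PD (w : ℕ) (X : DSet n) : Set₁ where
    field
      final      : ℕ
      part      : ℕ → DSet n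
      small    : ∀ t → t ≤ final → card (part t) ≤ w
      within   : ∀ t → t ≤ final → part t ⊆ X
      convex : ∀ v i j k → i ≤ j → j ≤ k → k ≤ final → v ∈ part i → v ∈ part k → v ∈ part j
      spans   : ∀ v → v ∈ X → ∃ λ t → t ≤ final × v ∈ part t
      edges    : ∀ u v → u ∈ X → v ∈ X → E u v → ∃ λ t → t ≤ final × u ∈ part t × v ∈ part t
      last     : bd X ⊆ part final

  emptyPD : ∀ w → PD w None
  emptyPD w = record
    { final = 0 ; part = λ _ → None ; small = λ _ _ → ≤-trans (≤-reflexive (card-None n)) z≤n ; within = λ _ _ _ ()
    ; convex = λ _ _ _ _ _ _ _ () ; spans = λ _ () ; edges = λ _ _ () ; last = λ _ → proj₁ }

  -- The appended bag is `∂ X` together with `y`: it covers every edge from `y` into `X` and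
  -- contains the new boundary.
  extendPD : ∀ {w X} → PD w X → card (bd X) < w → ∀ y → y ∉ X → PD w (X ∪ ｛ y ｝)
  extendPD {w} {X} D lt y y∉ = record
    { final = suc final ; part = part′ ; small = small′ ; within = within′ ; convex = convex′ ; spans = spans′ ; edges = edges′
    ; last = last′ }
    where
    open PD D
    part′ : ℕ → DSet n
    part′ t with t ≤? final
    ... | yes _ = part t
    ... | no _  = bd X ∪ ｛ y ｝
    old : ∀ {t v} → t ≤ final → v ∈ part t → v ∈ part′ t
    old {t} le b with t ≤? final
    ... | yes _ = b
    ... | no ¬le = ⊥-elim (¬le le)
    new : ∀ {v} → v ∈ bd X ∪ ｛ y ｝ → v ∈ part′ (suc final)
    new b with suc final ≤? final
    ... | yes le = ⊥-elim (ℕₚ.1+n≰n le)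
    ... | no _ = b
    small′ : ∀ t → t ≤ suc final → card (part′ t) ≤ w
    small′ t _ with t ≤? final
    ... | yes le = small t le
    ... | no _ = ≤-trans (card-add (bd X) (bd X ∪ ｛ y ｝) y (λ { x (inj₁ b) _ → b ; x (inj₂ e) ne → ⊥-elim (ne e) })) lt
    within′ : ∀ t → t ≤ suc final → part′ t ⊆ X ∪ ｛ y ｝
    within′ t _ v b with t ≤? final
    ... | yes le = inj₁ (within t le v b)
    within′ t _ v (inj₁ b) | no _ = inj₁ (proj₁ b)
    within′ t _ v (inj₂ e) | no _ = inj₂ e
    convex′ : ∀ v i j k → i ≤ j → j ≤ k → k ≤ suc final → v ∈ part′ i → v ∈ part′ k → v ∈ part′ j
    convex′ v i j k ij jk kl bi bk with i ≤? final | j ≤? final | k ≤? final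
    ... | yes il | yes jl | yes kl′ = convex v i j k ij jk kl′ bi bk
    -- A vertex of an earlier bag that recurs in the new bag lies in `∂ X`, hence in the last bag
    -- before it.
    ... | yes il | yes jl | no _ = convex v i j final ij jl ≤-refl bi (last v ([ id , (λ { refl → ⊥-elim (y∉ (within i il v bi)) }) ] bk))
    ... | _ | no j≰ | yes kl′ = ⊥-elim (j≰ (≤-trans jk kl′))
    ... | _ | no j≰ | no _ = bk
    ... | no i≰ | yes jl | _ = ⊥-elim (i≰ (≤-trans ij jl))
    spans′ : ∀ v → v ∈ X ∪ ｛ y ｝ → ∃ λ t → t ≤ suc final × v ∈ part′ t
    spans′ v (inj₁ x) = let (t , le , b) = spans v x in t , m≤n⇒m≤1+n le , old le b
    spans′ v (inj₂ refl) = suc final , ≤-refl , new (inj₂ refl)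
    edges′ : ∀ u v → u ∈ X ∪ ｛ y ｝ → v ∈ X ∪ ｛ y ｝ → E u v → ∃ λ t → t ≤ suc final × u ∈ part′ t × v ∈ part′ t
    edges′ u v (inj₁ a) (inj₁ b) e = let (t , le , p , q) = edges u v a b e in t , m≤n⇒m≤1+n le , old le p , old le q
    edges′ u v (inj₁ a) (inj₂ refl) e = suc final , ≤-refl , new (inj₁ (a , v , y∉ , arc⁺ e)) , new (inj₂ refl)
    edges′ u v (inj₂ refl) (inj₁ b) e = suc final , ≤-refl , new (inj₂ refl) , new (inj₁ (b , u , y∉ , arc⁺ (E-sym e)))
    edges′ u v (inj₂ refl) (inj₂ refl) e = suc final , ≤-refl , new (inj₂ refl) , new (inj₂ refl)
    last′ : bd (X ∪ ｛ y ｝) ⊆ part′ (suc final)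
    last′ u (inj₁ x , v , v∉ , e) = new (inj₁ (x , v , v∉ ∘ inj₁ , e))
    last′ u (inj₂ e , _) = new (inj₂ e)

  -- In `Linkage` the sets depend on a proof of membership in the boundary. Here they depend on the
  -- vertex alone, with default values off the boundary, so that they can occur inside decidable
  -- sets and be indexed by `mark`.
  record Linked (X Y : DSet n) : Set₁ where
    field
      P      : Fin n → DSet n
      end    : Fin n → Fin n
      conn   : ∀ a → a ∈ bd X → Conn (P a)
      start  : ∀ a → a ∈ bd X → a ∈ P a
      inside : ∀ a → a ∈ bd X → P a ⊆ Y
      only   : ∀ a → a ∈ bd X → ∀ x → x ∈ P a → x ∈ X → x ≡ a
      apart  : ∀ a b → a ∈ bd X → b ∈ bd X → a ≢ b → Disj (P a) (P b)
      end∈P  : ∀ a → a ∈ bd X → end a ∈ P a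
      end∂   : ∀ a → a ∈ bd X → end a ∈ bd Y

  linked : ∀ X Y → X ⊆ Y → (∀ U → X ⊆ U → U ⊆ Y → card (bd X) ≤ card (bd U)) → Linked X Y
  linked X Y s H = record
    { P = λ a → P a (a ∈? bd X) ; end = λ a → end a (a ∈? bd X)
    ; conn = λ a i → with-∂ a i (λ d → Conn (P a d)) (L.conn a)
    ; start = λ a i → with-∂ a i (λ d → a ∈ P a d) (L.start a)
    ; inside = λ a i → with-∂ a i (λ d → P a d ⊆ Y) (L.inside a)
    ; only = λ a i → with-∂ a i (λ d → ∀ x → x ∈ P a d → x ∈ X → x ≡ a) (L.only a)
    ; apart = λ a b i j ne → with-∂ a i (λ d → Disj (P a d) (P b (b ∈? bd X)))
        (λ i′ → with-∂ b j (λ d → Disj (L.P a i′) (P b d)) (λ j′ → L.apart a b i′ j′ ne))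
    ; end∈P = λ a i → with-∂ a i (λ d → end a d ∈ P a d) (λ i′ → proj₁ (proj₂ (L.end a i′)))
    ; end∂ = λ a i → with-∂ a i (λ d → end a d ∈ bd Y) (λ i′ → proj₂ (proj₂ (L.end a i′))) }
    where
    L : Linkage arcs X Y
    L = menger (card (Y ∖ X)) (card arcs) arcs arc⁻ X Y ≤-refl ≤-refl s H
    module L = Linkage L
    P : ∀ a → Dec (a ∈ bd X) → DSet n
    P a (yes i) = L.P a i
    P a (no _)  = None
    end : ∀ a → Dec (a ∈ bd X) → Fin n
    end a (yes i) = proj₁ (L.end a i)
    end a (no _)  = a
    with-∂ : ∀ {ℓ} a → a ∈ bd X → (Q : Dec (a ∈ bd X) → Set ℓ) → (∀ i → Q (yes i)) → Q (a ∈? bd X)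
    with-∂ a i Q f with a ∈? bd X
    ... | yes i′ = f i′
    ... | no ¬i = ⊥-elim (¬i i)

  -- Contracting each path of the linkage to its first vertex turns a decomposition of Y into one of U.
  shrinkPD : ∀ {w U Y} → U ⊆ Y → Linked U Y → PD w Y → PD w U
  shrinkPD {w} {U} {Y} U⊆Y L D = record
    { final = final ; part = part′ ; small = small′ ; within = λ { t _ v (inj₁ (_ , u)) → u ; t _ v (inj₂ (b , _)) → proj₁ b }
    ; convex = convex′
    ; spans = λ v u → let (t , le , b) = spans v (U⊆Y v u) in t , le , inj₁ (b , u)
    ; edges = λ u v a b e → let (t , le , p , q) = edges u v (U⊆Y u a) (U⊆Y v b) e in t , le , inj₁ (p , a) , inj₁ (q , b)
    ; last = λ v b → inj₂ (b , L.end v , L.end∈P v b , last (L.end v) (L.end∂ v b)) }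
    where
    open PD D
    module L = Linked L
    part′ : ℕ → DSet n
    has  (part′ t) x = (x ∈ part t × x ∈ U) ⊎ (x ∈ bd U × ∃ λ z → z ∈ L.P x × z ∈ part t)
    has? (part′ t) x = ((x ∈? part t) ×-dec (x ∈? U)) ⊎-dec ((x ∈? bd U) ×-dec any? λ z → (z ∈? L.P x) ×-dec (z ∈? part t))
    -- A boundary vertex that stands for its path is charged to a vertex of the path in the given
    -- bag. This is injective because the paths are disjoint and meet `U` only at their starts.
    small′ : ∀ t → t ≤ final → card (part′ t) ≤ w
    small′ t le = ≤-trans (card-inj (part′ t) (part t) f into inj) (small t le)
      where
      f : ∀ x → x ∈ part′ t → Fin n
      f x (inj₁ _) = x
      f x (inj₂ (_ , z , _)) = z
      into : ∀ x a → f x a ∈ part t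
      into x (inj₁ (b , _)) = b
      into x (inj₂ (_ , z , _ , b)) = b
      inj : ∀ x y a b → f x a ≡ f y b → x ≡ y
      inj x y (inj₁ _) (inj₁ _) eq = eq
      inj x y (inj₁ (_ , u)) (inj₂ (i , z , zP , _)) refl = L.only y i x zP u
      inj x y (inj₂ (i , z , zP , _)) (inj₁ (_ , u)) refl = sym (L.only x i y zP u)
      inj x y (inj₂ (i , z , zP , _)) (inj₂ (j , z′ , zP′ , _)) refl with x ≟ y
      ... | yes eq = eq
      ... | no ne = ⊥-elim (L.apart x y i j ne z zP zP′)
    -- Either a bag of the next edge is at or before `j`, and the walk continues from there, or it
    -- is beyond `j`, and convexity puts the current vertex into bag `j`.
    hits : ∀ P → P ⊆ Y → ∀ {u v} → Walk P u v → ∀ i j k → i ≤ j → j ≤ k → k ≤ final → u ∈ part i → v ∈ part k → ∃ λ z → z ∈ P × z ∈ part j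
    hits P s (stop p) i j k ij jk kl bi bk = _ , p , convex _ i j k ij jk kl bi bk
    hits P s (step {u} {u′} p e w) i j k ij jk kl bi bk with u ∈? part j
    ... | yes b = u , p , b
    ... | no ¬b with edges u u′ (s u p) (s u′ (start∈ w)) e
    ...   | t , tl , bt , bt′ with t ≤? j
    ...     | yes tj = hits P s w t j k tj jk kl bt′ bk
    ...     | no t≰j = ⊥-elim (¬b (convex u i j t ij (<⇒≤ (≰⇒> t≰j)) tl bi bt))
    convex′ : ∀ v i j k → i ≤ j → j ≤ k → k ≤ final → v ∈ part′ i → v ∈ part′ k → v ∈ part′ j
    convex′ v i j k ij jk kl bi bk with v ∈? bd U
    ... | yes v∂ = let (a , aP , ai) = hit i bi ; (c , cP , ck) = hit k bk
                   in inj₂ (v∂ , hits (L.P v) (L.inside v v∂) (proj₂ (L.conn v v∂) a c aP cP) i j k ij jk kl ai ck)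
      where
      hit : ∀ t → v ∈ part′ t → ∃ λ z → z ∈ L.P v × z ∈ part t
      hit t (inj₁ (b , _)) = v , L.start v v∂ , b
      hit t (inj₂ (_ , z , zP , b)) = z , zP , b
    convex′ v i j k ij jk kl (inj₂ (v∂ , _)) bk | no ¬v∂ = ⊥-elim (¬v∂ v∂)
    convex′ v i j k ij jk kl (inj₁ _) (inj₂ (v∂ , _)) | no ¬v∂ = ⊥-elim (¬v∂ v∂)
    convex′ v i j k ij jk kl (inj₁ (bi , u)) (inj₁ (bk , _)) | no ¬v∂ = inj₁ (convex v i j k ij jk kl bi bk , u)

  -- The last property of the set found is the hypothesis of `linked`, so a decomposition of `Y` can
  -- be shrunk to it.
  lowest : ∀ m Y U → card (bd U) ≤ m → U ⊆ Y →
           ∃ λ V → U ⊆ V × V ⊆ Y × card (bd V) ≤ card (bd U) × (∀ W → V ⊆ W → W ⊆ Y → card (bd V) ≤ card (bd W))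
  lowest m Y U le U⊆ with searchSets (λ W → U ⊆ W × W ⊆ Y × card (bd W) < card (bd U))
      (λ W → (U ⊆? W) ×-dec ((W ⊆? Y) ×-dec (card (bd W) <? card (bd U))))
      (λ { W V f g (p , q , lt) → (λ x → f x ∘ p x) , (λ x → q x ∘ g x) , ≤-<-trans (card-mono (bd V) (bd W) (∂-ext arcs V W g f)) lt })
  ... | inj₂ none = U , (λ _ → id) , U⊆ , ≤-refl , λ W f g → ℕₚ.≮⇒≥ (λ lt → none W (f , g , lt))
  lowest zero Y U le U⊆ | inj₁ (W , _ , _ , lt) with () ← <-≤-trans lt le
  lowest (suc m) Y U le U⊆ | inj₁ (W , U⊆W , W⊆Y , lt) with lowest m Y W (≤-pred (<-≤-trans lt le)) W⊆Y
  ... | V , W⊆V , V⊆Y , le′ , min = V , (λ x → W⊆V x ∘ U⊆W x) , V⊆Y , ≤-trans le′ (<⇒≤ lt) , min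

  parent : ℕ → ℕ
  parent i = ⌊ pred i /2⌋

  parent< : ∀ i → 0 < i → parent i < i
  parent< (suc i) _ = s≤s (ℕₚ.⌊n/2⌋≤n i)

  -- A model of the initial segment of length `N` of the infinite binary tree in heap order; it can
  -- grow by single tree nodes.
  record Heap (N : ℕ) : Set₁ where
    field
      β    : ℕ → DSet n
      conn : ∀ j → j < N → Conn (β j)
      disj : ∀ j k → j < N → k < N → j ≢ k → Disj (β j) (β k)
      tree : ∀ j → 0 < j → j < N → Touch (β (parent j)) (β j)

  module _ (w : ℕ) (noPD : ¬ PD w All) (v₀ : Fin n) where
    private
      Goal : Set₁
      Goal = Heap (suc w)

    -- The marks lie in disjoint bags, so they are `i` distinct boundary vertices and `bound` is
    -- tight. `low` expresses minimality in continuation form: a decomposable superset with smaller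
    -- boundary is not excluded but leads to the goal. The existence of a decomposition thus never
    -- has to be decided.
    record State (i : ℕ) (X : DSet n) : Set₁ where
      field
        pd     : PD w X
        heap   : Heap i
      open Heap heap public
      field
        β⊆     : ∀ j → j < i → β j ⊆ X
        mark   : ℕ → Fin n
        mark∈  : ∀ j → j < i → mark j ∈ β j
        mark∂  : ∀ j → j < i → mark j ∈ bd X
        bound  : card (bd X) ≤ i
        low    : ∀ Y → PD w Y → X ⊆ Y → card (bd Y) < i → Goal

    newVertex : ∀ {i X} (S : State i X) → ∃ λ y → y ∉ X × (0 < i → Touch (State.β S (parent i)) ｛ y ｝)
    newVertex {zero} {X} S with any? (λ y → ¬? (y ∈? X))
    ... | yes (y , y∉) = y , y∉ , λ ()
    -- Large pathwidth enters here: if `X` were everything, its decomposition would be one of the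
    -- whole graph.
    ... | no full = ⊥-elim (noPD (record
            { final = final ; part = part ; small = small ; within = λ _ _ _ _ → refl ; convex = convex
            ; spans = λ v _ → spans v (all v) ; edges = λ u v _ _ → edges u v (all u) (all v) ; last = λ { v (_ , u , u∉ , _) → ⊥-elim (u∉ refl) } }))
      where
      open PD (State.pd S)
      all : ∀ v → v ∈ X
      all v with v ∈? X
      ... | yes x = x
      ... | no ¬x = ⊥-elim (full (v , ¬x))
    newVertex {suc i} {X} S with State.mark∂ S (parent (suc i)) (parent< (suc i) (s≤s z≤n))
    ... | _ , y , y∉ , e = y , y∉ , λ _ → touch (State.mark∈ S (parent (suc i)) (parent< (suc i) (s≤s z≤n))) refl (arc⁻ _ _ e)

    abstract
      append : ∀ {i X} (S : State i X) y → y ∉ X → (0 < i → Touch (State.β S (parent i)) ｛ y ｝) →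
               Σ (Heap (suc i)) λ H → (∀ j → j < i → Heap.β H j ≡ State.β S j) × Heap.β H i ≡ ｛ y ｝
      append {i} {X} S y y∉ t = record { β = β′ ; conn = conn′ ; disj = disj′ ; tree = tree′ } , (λ j → old j) , new
        where
        open State S
        β′ : ℕ → DSet n
        β′ j with j ℕₚ.≟ i
        ... | yes _ = ｛ y ｝
        ... | no _  = β j
        new : β′ i ≡ ｛ y ｝
        new with i ℕₚ.≟ i
        ... | yes _ = refl
        ... | no ¬eq = ⊥-elim (¬eq refl)
        old : ∀ j → j < i → β′ j ≡ β j
        old j lt with j ℕₚ.≟ i
        ... | yes refl = ⊥-elim (ℕₚ.<-irrefl refl lt)
        ... | no _ = refl
        below : ∀ {j} → j < suc i → j ≢ i → j < i
        below (s≤s le) ne = ℕₚ.≤∧≢⇒< le ne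
        conn′ : ∀ j → j < suc i → Conn (β′ j)
        conn′ j lt with j ℕₚ.≟ i
        ... | yes _ = Conn-single y
        ... | no ne = conn j (below lt ne)
        disj′ : ∀ j k → j < suc i → k < suc i → j ≢ k → Disj (β′ j) (β′ k)
        disj′ j k lj lk ne x p q with j ℕₚ.≟ i | k ℕₚ.≟ i
        ... | yes refl | yes refl = ne refl
        disj′ j k lj lk ne x refl q | yes refl | no k≢ = y∉ (β⊆ k (below lk k≢) x q)
        disj′ j k lj lk ne x p refl | no j≢ | yes refl = y∉ (β⊆ j (below lj j≢) x p)
        ... | no j≢ | no k≢ = disj j k (below lj j≢) (below lk k≢) ne x p q
        tree′ : ∀ j → 0 < j → j < suc i → Touch (β′ (parent j)) (β′ j)
        tree′ j 0<j lt rewrite old (parent j) (<-≤-trans (parent< j 0<j) (≤-pred lt)) with j ℕₚ.≟ i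
        ... | yes refl = t 0<j
        ... | no ne = tree j 0<j (below lt ne)

    carry : ∀ {i X Y} → State i X → PD w Y → X ⊆ Y → card (bd Y) ≤ i → Linked X Y → State i Y
    carry {i} {X} {Y} S pdY X⊆Y le L = record
      { pd = pdY
      ; heap = record { β = β′
          ; conn = λ j lt → Conn-share (conn j lt) (L.conn _ (mark∂ j lt)) (mark j) (mark∈ j lt) (L.start _ (mark∂ j lt))
          ; disj = disj′
          ; tree = λ j 0<j lt → Touch-mono (λ _ → inj₁) (λ _ → inj₁) (tree j 0<j lt) }
      ; β⊆ = λ { j lt x (inj₁ b) → X⊆Y x (β⊆ j lt x b) ; j lt x (inj₂ p) → L.inside _ (mark∂ j lt) x p }
      ; mark = λ j → L.end (mark j) ; mark∈ = λ j lt → inj₂ (L.end∈P _ (mark∂ j lt)) ; mark∂ = λ j lt → L.end∂ _ (mark∂ j lt)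
      ; bound = le ; low = λ Z pdZ Y⊆Z → low Z pdZ (λ x → Y⊆Z x ∘ X⊆Y x) }
      where
      open State S
      module L = Linked L
      β′ : ℕ → DSet n
      β′ j = β j ∪ L.P (mark j)
      mixed : ∀ j k → j < i → k < i → j ≢ k → Disj (β j) (L.P (mark k))
      mixed j k lj lk ne x b p = disj j k lj lk ne x b (subst (_∈ β k) (sym (L.only _ (mark∂ k lk) x p (β⊆ j lj x b))) (mark∈ k lk))
      disj′ : ∀ j k → j < i → k < i → j ≢ k → Disj (β′ j) (β′ k)
      disj′ j k lj lk ne x (inj₁ a) (inj₁ b) = disj j k lj lk ne x a b
      disj′ j k lj lk ne x (inj₁ a) (inj₂ q) = mixed j k lj lk ne x a q
      disj′ j k lj lk ne x (inj₂ p) (inj₁ b) = mixed k j lk lj (ne ∘ sym) x b p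
      disj′ j k lj lk ne x (inj₂ p) (inj₂ q) = L.apart _ _ (mark∂ j lj) (mark∂ k lk)
        (λ eq → disj j k lj lk ne (mark j) (mark∈ j lj) (subst (_∈ β k) (sym eq) (mark∈ k lk))) x p q

    -- If `y` does not push the boundary above `i`, the model moves on to a larger `X` with the same
    -- `i`. Otherwise no boundary vertex is lost and `y` joins the boundary, so `y` becomes both the
    -- bag and the mark of node `i`.
    advance : ∀ {i X} → i < w → (∀ Y → card (All ∖ Y) < card (All ∖ X) → State i Y → Goal) →
              (∀ Y → State (suc i) Y → Goal) → State i X → Goal
    advance {i} {X} i<w again next S = finish (card (bd X′) ≤? i)
      where
      open State S
      y : Fin n
      y = proj₁ (newVertex S)
      y∉ : y ∉ X
      y∉ = proj₁ (proj₂ (newVertex S))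
      X′ : DSet n
      X′ = X ∪ ｛ y ｝
      appended : Σ (Heap (suc i)) λ H → (∀ j → j < i → Heap.β H j ≡ β j) × Heap.β H i ≡ ｛ y ｝
      appended = append S y y∉ (proj₂ (proj₂ (newVertex S)))
      H : Heap (suc i)
      H = proj₁ appended
      β-old : ∀ j → j < i → Heap.β H j ≡ β j
      β-old = proj₁ (proj₂ appended)
      β-new : Heap.β H i ≡ ｛ y ｝
      β-new = proj₂ (proj₂ appended)
      pd′ : PD w X′
      pd′ = extendPD pd (≤-<-trans bound i<w) y y∉
      -- A decomposable Y ⊋ X with |∂ Y| ≤ i either carries the current model or contains a set contradicting low.
      noLarger : ∀ Y → PD w Y → X ⊆ Y → (∃ λ z → z ∈ Y × z ∉ X) → card (bd Y) ≤ i → Goal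
      noLarger Y pdY X⊆Y (z , z∈ , z∉) leY
        with searchSets (λ U → X ⊆ U × U ⊆ Y × card (bd U) < i)
               (λ U → (X ⊆? U) ×-dec ((U ⊆? Y) ×-dec (card (bd U) <? i)))
               (λ { U V f g (p , q , lt) → (λ x → f x ∘ p x) , (λ x → q x ∘ g x) , ≤-<-trans (card-mono (bd V) (bd U) (∂-ext arcs V U g f)) lt })
      ... | inj₁ (U , X⊆U , U⊆Y , lt) with lowest (card (bd U)) Y U ≤-refl U⊆Y
      ...   | V , U⊆V , V⊆Y , leV , min = low V (shrinkPD V⊆Y (linked V Y V⊆Y min) pdY) (λ x → U⊆V x ∘ X⊆U x) (≤-<-trans leV lt)
      noLarger Y pdY X⊆Y (z , z∈ , z∉) leY | inj₂ none = again Y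
        (card-strict (All ∖ Y) (All ∖ X) (λ x p → refl , proj₂ p ∘ X⊆Y x) z (refl , z∉) (λ p → proj₂ p z∈))
        (carry S pdY X⊆Y leY (linked X Y X⊆Y (λ U f g → ≤-trans bound (ℕₚ.≮⇒≥ (λ lt → none U (f , g , lt))))))
      finish : Dec (card (bd X′) ≤ i) → Goal
      finish (yes le′) = noLarger X′ pd′ (λ _ → inj₁) (y , inj₂ refl , y∉) le′
      finish (no big) = next X′ (record
        { pd = pd′ ; heap = H
        ; β⊆ = β⊆′ ; mark = mark′ ; mark∈ = mark∈′ ; mark∂ = mark∂′
        ; bound = ≤-trans (card-add (bd X) (bd X′) y shrinkBd) (s≤s bound)
        ; low = λ Y pdY X′⊆Y lt → noLarger Y pdY (λ x → X′⊆Y x ∘ inj₁) (y , X′⊆Y y (inj₂ refl) , y∉) (≤-pred lt) })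
        where
        shrinkBd : ∀ x → x ∈ bd X′ → x ≢ y → x ∈ bd X
        shrinkBd x (inj₁ x∈ , v , v∉ , e) _ = x∈ , v , v∉ ∘ inj₁ , e
        shrinkBd x (inj₂ x≡ , _) x≢ = ⊥-elim (x≢ x≡)
        y∂ : y ∈ bd X′
        y∂ with y ∈? bd X′
        ... | yes p = p
        ... | no ¬p = ⊥-elim (big (≤-trans (card-mono (bd X′) (bd X) (λ x b → shrinkBd x b (λ { refl → ¬p b }))) bound))
        stays : ∀ b → b ∈ bd X → b ∈ bd X′
        stays b b∂ with b ∈? bd X′
        ... | yes p = p
        ... | no ¬p = ⊥-elim (big (≤-trans (card-add (bd X - b) (bd X′) y (λ x z x≢ → shrinkBd x z x≢ , λ { refl → ¬p z }))
                        (≤-trans (card-minus (bd X) b b∂) bound)))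
        below : ∀ {j} → j < suc i → j ≢ i → j < i
        below (s≤s le) ne = ℕₚ.≤∧≢⇒< le ne
        module H = Heap H
        β⊆′ : ∀ j → j < suc i → H.β j ⊆ X′
        β⊆′ j lt x b with j ℕₚ.≟ i
        ... | yes refl = inj₂ (subst (x ∈_) β-new b)
        ... | no ne = inj₁ (β⊆ j (below lt ne) x (subst (x ∈_) (β-old j (below lt ne)) b))
        mark′ : ℕ → Fin n
        mark′ j with j ℕₚ.≟ i
        ... | yes _ = y
        ... | no _  = mark j
        mark∈′ : ∀ j → j < suc i → mark′ j ∈ H.β j
        mark∈′ j lt with j ℕₚ.≟ i
        ... | yes refl = subst (y ∈_) (sym β-new) refl
        ... | no ne = subst (mark j ∈_) (sym (β-old j (below lt ne))) (mark∈ j (below lt ne))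
        mark∂′ : ∀ j → j < suc i → mark′ j ∈ bd X′
        mark∂′ j lt with j ℕₚ.≟ i
        ... | yes refl = y∂
        ... | no ne = stays _ (mark∂ j (below lt ne))

    build : ∀ r i → r + i ≡ w → ∀ X → State i X → Goal
    -- The last node is added without extending the decomposition: a boundary of `w` vertices leaves
    -- no room for `y` in a bag.
    build zero i refl X S = let (y , y∉ , t) = newVertex S in proj₁ (append S y y∉ t)
    build (suc r) i eq X = enlarge (card (All ∖ X)) X ≤-refl
      where
      i<w : i < w
      i<w = ≤-trans (s≤s (ℕₚ.m≤n+m i r)) (≤-reflexive eq)
      enlarge : ∀ k X → card (All ∖ X) ≤ k → State i X → Goal
      enlarge zero X le = advance i<w (λ Y lt _ → ⊥-elim (<⇒≱ lt (≤-trans le z≤n))) (build r (suc i) (trans (+-suc r i) eq))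
      enlarge (suc k) X le = advance i<w (λ Y lt → enlarge k Y (≤-pred (<-≤-trans lt le))) (build r (suc i) (trans (+-suc r i) eq))

    heapModel : Heap (suc w)
    heapModel = build w 0 (ℕₚ.+-identityʳ w) None (record
      { pd = emptyPD w ; heap = record { β = λ _ → None ; conn = λ _ () ; disj = λ _ _ () ; tree = λ _ _ () }
      ; β⊆ = λ _ () ; mark = λ _ → v₀ ; mark∈ = λ _ () ; mark∂ = λ _ ()
      ; bound = ≤-trans (card-mono (bd None) None (λ _ → proj₁)) (≤-reflexive (card-None n)) ; low = λ _ _ _ () })

  -- Complete binary trees inside a heap model

  data Desc (v : ℕ) : ℕ → Set where
    here : Desc v v
    up   : ∀ {w} → 0 < w → Desc v (parent w) → Desc v w

  Desc≤ : ∀ {v w} → Desc v w → v ≤ w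
  Desc≤ here = ≤-refl
  Desc≤ (up {w} p d) = ≤-trans (Desc≤ d) (<⇒≤ (parent< w p))

  v<kid : ∀ b v → v < kid b v
  v<kid false v = s≤s (m≤m+n v v)
  v<kid true v = s≤s (m≤n⇒m≤1+n (m≤m+n v v))

  Desc-apart : ∀ v {w} → Desc (kid false v) w → Desc (kid true v) w → ⊥
  Desc-apart v here d = ℕₚ.1+n≰n (Desc≤ d)
  Desc-apart v (up p d) here = <⇒≱ (v<kid false v) (≤-trans (Desc≤ d) (≤-reflexive (half-kid true v)))
  Desc-apart v (up p d) (up q e) = Desc-apart v d e

  Desc-kid : ∀ b v {w} → Desc (kid b v) w → Desc v w
  Desc-kid b v here = up (≤-<-trans z≤n (v<kid b v)) (subst (Desc v) (sym (half-kid b v)) here)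
  Desc-kid b v (up p d) = up p (Desc-kid b v d)

  module _ {N : ℕ} (H : Heap N) where
    open Heap H

    record Sub (h v : ℕ) : Set₁ where
      constructor sub
      field
        {S}   : DSet n
        tree  : Tr Bag h (β v) S
        traces : ∀ x → x ∈ S → ∃ λ w → Desc v w × w < N × x ∈ β w

    room : ∀ b v m → (2 + v) * (2 * m) ≤ suc N → (2 + kid b v) * m ≤ suc N
    room b v m le = ≤-trans (≤-trans (ℕₚ.*-monoˡ-≤ m (fits b)) (≤-reflexive eq)) le
      where
      fits : ∀ b → 2 + kid b v ≤ 2 * (2 + v)
      fits false = ≤-trans (n≤1+n _) (fits true)
      fits true = ≤-reflexive (sym (trans (cong (λ z → 2 + (v + (2 + z))) (ℕₚ.+-identityʳ v))
                                (cong (2 +_) (trans (+-suc v (suc v)) (cong suc (+-suc v v))))))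
      eq : 2 * (2 + v) * m ≡ (2 + v) * (2 * m)
      eq = trans (cong (_* m) (ℕₚ.*-comm 2 (2 + v))) (ℕₚ.*-assoc (2 + v) 2 m)

    -- The rightmost descendant of `v` at depth `h` has number `(2 + v) * 2 ^ h - 2`, and the
    -- hypothesis says that it is below `N`. Tracing each support back to heap nodes makes siblings
    -- disjoint by `Desc-apart`.
    subtree : ∀ h v → (2 + v) * 2 ^ h ≤ suc N → Sub h v
    subtree h v le = go h le
      where
      v<N : ∀ h → (2 + v) * 2 ^ h ≤ suc N → v < N
      v<N h le = ≤-pred (≤-trans (ℕₚ.m≤m*n (2 + v) (2 ^ h) {{ℕₚ.m^n≢0 2 h}}) le)
      go : ∀ h → (2 + v) * 2 ^ h ≤ suc N → Sub h v
      go zero le = sub (leaf (refl , conn v (v<N zero le))) (λ x b → v , here , v<N zero le , b)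
      go (suc h) le with subtree h (kid false v) (room false v (2 ^ h) le) | subtree h (kid true v) (room true v (2 ^ h) le)
      ... | sub {S₁} t₁ f₁ | sub {S₂} t₂ f₂ = sub
          (node (conn v v<) t₁ t₂ (toKid false le₁) (toKid true le₂) (below false S₁ f₁) (below true S₂ f₂) apart) trace
        where
        v< : v < N
        v< = v<N (suc h) le
        kid<N : ∀ b → v < kid b v × kid b v < N
        kid<N b = v<kid b v , ≤-pred (≤-trans (ℕₚ.m≤m*n (2 + kid b v) (2 ^ h) {{ℕₚ.m^n≢0 2 h}}) (room b v (2 ^ h) le))
        le₁ : kid false v < N
        le₁ = proj₂ (kid<N false)
        le₂ : kid true v < N
        le₂ = proj₂ (kid<N true)
        toKid : ∀ b → kid b v < N → Touch (β v) (β (kid b v))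
        toKid b lt = subst (λ z → Touch (β z) (β (kid b v))) (half-kid b v) (tree (kid b v) (≤-<-trans z≤n (v<kid b v)) lt)
        below : ∀ b S → (∀ x → x ∈ S → ∃ λ w → Desc (kid b v) w × w < N × x ∈ β w) → Disj (β v) S
        below b S f x r s = let (w , d , lt , y) = f x s in
          disj v w v< lt (λ eq → <⇒≱ (v<kid b v) (≤-trans (Desc≤ d) (≤-reflexive (sym eq)))) x r y
        apart : Disj S₁ S₂
        apart x s s′ with f₁ x s | f₂ x s′
        ... | w , d , lt , y | w′ , d′ , lt′ , y′ with w ℕₚ.≟ w′
        ...   | yes refl = Desc-apart v d d′
        ...   | no ne = disj w w′ lt lt′ ne x y y′
        trace : ∀ x → x ∈ β v ∪ (S₁ ∪ S₂) → ∃ λ w → Desc v w × w < N × x ∈ β w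
        trace x (inj₁ b) = v , here , v< , b
        trace x (inj₂ (inj₁ s)) = let (w , d , lt , y) = f₁ x s in w , Desc-kid false v d , lt , y
        trace x (inj₂ (inj₂ s)) = let (w , d , lt , y) = f₂ x s in w , Desc-kid true v d , lt , y

  -- Reading off the minors

  at : ∀ {P h R S} → Tr P h R S → List Bool → DSet n
  at {R = R} t [] = R
  at (leaf _) (_ ∷ _) = None
  at (node _ t₁ t₂ _ _ _ _ _) (false ∷ p) = at t₁ p
  at (node _ t₁ t₂ _ _ _ _ _) (true ∷ p)  = at t₂ p

  module _ {A : DSet n} where
    at⊆ : ∀ {h R S} (t : Tr (TouchBag A) h R S) p → at t p ⊆ S
    at⊆ t [] x r = root⊆ (Tr-shape (TouchBag-shape A) _ _ t) x r
    at⊆ (node _ t₁ t₂ _ _ _ _ _) (false ∷ p) x r = inj₂ (inj₁ (at⊆ t₁ p x r))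
    at⊆ (node _ t₁ t₂ _ _ _ _ _) (true ∷ p) x r = inj₂ (inj₂ (at⊆ t₂ p x r))

    at-conn : ∀ {h R S} (t : Tr (TouchBag A) h R S) p → length p ≤ h → Conn (at t p)
    at-conn t [] _ = root-conn (Tr-shape (TouchBag-shape A) _ _ t)
    at-conn (node _ t₁ t₂ _ _ _ _ _) (false ∷ p) (s≤s le) = at-conn t₁ p le
    at-conn (node _ t₁ t₂ _ _ _ _ _) (true ∷ p) (s≤s le) = at-conn t₂ p le

    at-disj : ∀ {h R S} (t : Tr (TouchBag A) h R S) p q → p ≢ q → Disj (at t p) (at t q)
    at-disj t [] [] ne = ⊥-elim (ne refl)
    at-disj (node _ t₁ t₂ _ _ d₁ d₂ d₃) [] (false ∷ q) ne x r s = d₁ x r (at⊆ t₁ q x s)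
    at-disj (node _ t₁ t₂ _ _ d₁ d₂ d₃) [] (true ∷ q) ne x r s = d₂ x r (at⊆ t₂ q x s)
    at-disj (node _ t₁ t₂ _ _ d₁ d₂ d₃) (false ∷ p) [] ne x s r = d₁ x r (at⊆ t₁ p x s)
    at-disj (node _ t₁ t₂ _ _ d₁ d₂ d₃) (true ∷ p) [] ne x s r = d₂ x r (at⊆ t₂ p x s)
    at-disj (node _ t₁ t₂ _ _ d₁ d₂ d₃) (false ∷ p) (false ∷ q) ne = at-disj t₁ p q (ne ∘ cong (false ∷_))
    at-disj (node _ t₁ t₂ _ _ d₁ d₂ d₃) (true ∷ p) (true ∷ q) ne = at-disj t₂ p q (ne ∘ cong (true ∷_))
    at-disj (node _ t₁ t₂ _ _ d₁ d₂ d₃) (false ∷ p) (true ∷ q) ne x r s = d₃ x (at⊆ t₁ p x r) (at⊆ t₂ q x s)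
    at-disj (node _ t₁ t₂ _ _ d₁ d₂ d₃) (true ∷ p) (false ∷ q) ne x r s = d₃ x (at⊆ t₁ q x s) (at⊆ t₂ p x r)
    at-disj (leaf _) [] (_ ∷ _) ne x _ ()
    at-disj (leaf _) (_ ∷ _) q ne x ()

    at-kid : ∀ {h R S} (t : Tr (TouchBag A) h R S) p b → length p < h → Touch (at t p) (at t (p ++ (b ∷ [])))
    at-kid (node _ t₁ t₂ x₁ x₂ _ _ _) [] false _ = x₁
    at-kid (node _ t₁ t₂ x₁ x₂ _ _ _) [] true _ = x₂
    at-kid (node _ t₁ t₂ _ _ _ _ _) (false ∷ p) b (s≤s lt) = at-kid t₁ p b lt
    at-kid (node _ t₁ t₂ _ _ _ _ _) (true ∷ p) b (s≤s lt) = at-kid t₂ p b lt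

    at-leaf : ∀ {h R S} (t : Tr (TouchBag A) h R S) p → length p ≡ h → Touch (at t p) A
    at-leaf (leaf (refl , _ , t)) [] _ = t
    at-leaf (node _ t₁ t₂ _ _ _ _ _) (false ∷ p) eq = at-leaf t₁ p (ℕₚ.suc-injective eq)
    at-leaf (node _ t₁ t₂ _ _ _ _ _) (true ∷ p) eq = at-leaf t₂ p (ℕₚ.suc-injective eq)

  -- The vertices 3, …, nablaSize k of ∇ₖ₊₂ come from the first copy of ∇ₖ₊₁, the later ones from the second.
  cell : ∀ {k b c S} → Nab k b c S → ℕ → DSet n
  cell {b = b} m 0 = b
  cell {c = c} m 1 = c
  cell {S = S} (tip _ _ _) (suc (suc _)) = S
  cell (join a _ _ _ _ _ _ _ _ _ _ _ _ _) 2 = a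
  cell {suc k} (join _ _ _ _ _ _ m₁ m₂ _ _ _ _ _ _) (suc (suc (suc v))) with 3 + v ≤? nablaSize k
  ... | yes _ = cell m₁ (2 + v)
  ... | no _  = cell m₂ (2 + ((2 + v) ∸ nablaSize k))

  second< : ∀ k {v} → ¬ 3 + v ≤ nablaSize k → 3 + v < nablaSize (suc k) → 2 + ((2 + v) ∸ nablaSize k) < nablaSize k
  second< k {v} high lt = subst (_< nablaSize k) (ℕₚ.+-∸-assoc 2 (≤-pred (≰⇒> high)))
    (ℕₚ.m<n+o⇒m∸n<o (4 + v) (nablaSize k) {{>-nonZero (≤-trans (s≤s z≤n) (3≤nablaSize k))}} (≤-trans (s≤s lt) (≤-reflexive (suc-nablaSize k))))

  cell-inner : ∀ {k b c S} (m : Nab k b c S) i → cell m (2 + i) ⊆ S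
  cell-inner (tip _ _ _) i x z = z
  cell-inner (join _ _ _ _ _ _ _ _ _ _ _ a⊆ _ _) zero = a⊆
  cell-inner {suc k} (join _ _ _ _ _ _ m₁ m₂ _ _ _ _ s₁ s₂) (suc v) x z with 3 + v ≤? nablaSize k
  ... | yes _ = s₁ x (cell-inner m₁ v x z)
  ... | no _  = s₂ x (cell-inner m₂ ((2 + v) ∸ nablaSize k) x z)

  cell-0 : ∀ {k b c S} (m : Nab k b c S) → cell m 0 ≡ b
  cell-0 (tip _ _ _) = refl
  cell-0 (join _ _ _ _ _ _ _ _ _ _ _ _ _ _) = refl

  cell-1 : ∀ {k b c S} (m : Nab k b c S) → cell m 1 ≡ c
  cell-1 (tip _ _ _) = refl
  cell-1 (join _ _ _ _ _ _ _ _ _ _ _ _ _ _) = refl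

  cell-conn : ∀ {k b c S} (m : Nab k b c S) → Conn b → Conn c → ∀ i → i < nablaSize k → Conn (cell m i)
  cell-conn m cb cc 0 lt = subst Conn (sym (cell-0 m)) cb
  cell-conn m cb cc 1 lt = subst Conn (sym (cell-1 m)) cc
  cell-conn (tip cS _ _) cb cc (suc (suc _)) lt = cS
  cell-conn (join _ _ _ ca _ _ _ _ _ _ _ _ _ _) cb cc 2 lt = ca
  cell-conn {suc k} (join _ _ _ ca _ _ m₁ m₂ _ _ _ _ _ _) cb cc (suc (suc (suc v))) lt with 3 + v ≤? nablaSize k
  ... | yes low = cell-conn m₁ ca cb (2 + v) low
  ... | no high = cell-conn m₂ ca cc (2 + ((2 + v) ∸ nablaSize k)) (second< k high lt)

  cell-disj : ∀ {k b c S} (m : Nab k b c S) → Disj b c → Disj b S → Disj c S →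
              ∀ i j → i < nablaSize k → j < nablaSize k → i < j → Disj (cell m i) (cell m j)
  cell-disj m dbc dbS dcS 0 1 li lj ij x p q = dbc x (subst (x ∈_) (cell-0 m) p) (subst (x ∈_) (cell-1 m) q)
  cell-disj m dbc dbS dcS 0 (suc (suc j)) li lj ij x p q = dbS x (subst (x ∈_) (cell-0 m) p) (cell-inner m j x q)
  cell-disj m dbc dbS dcS 1 1 li lj (s≤s ())
  cell-disj m dbc dbS dcS 1 (suc (suc j)) li lj ij x p q = dcS x (subst (x ∈_) (cell-1 m) p) (cell-inner m j x q)
  cell-disj m dbc dbS dcS (suc (suc i)) 1 li lj (s≤s ())
  cell-disj {zero} m dbc dbS dcS (suc (suc i)) (suc (suc j)) li lj ij = ⊥-elim (<⇒≱ (≤-trans (s≤s (s≤s (s≤s z≤n))) ij) (≤-pred lj))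
  cell-disj {suc k} (join _ _ _ _ _ _ m₁ m₂ d₁ d₂ _ _ _ _) dbc dbS dcS 2 2 li lj (s≤s (s≤s ()))
  cell-disj {suc k} (join _ _ _ _ _ _ m₁ m₂ d₁ d₂ _ _ _ _) dbc dbS dcS 2 (suc (suc (suc v))) li lj ij x p q with 3 + v ≤? nablaSize k
  ... | yes _ = d₁ x p (cell-inner m₁ v x q)
  ... | no _  = d₂ x p (cell-inner m₂ ((2 + v) ∸ nablaSize k) x q)
  cell-disj {suc k} (join _ _ _ _ _ _ m₁ m₂ _ _ _ _ _ _) dbc dbS dcS (suc (suc (suc v))) 2 li lj (s≤s (s≤s ()))
  cell-disj {suc k} (join _ _ _ _ _ _ m₁ m₂ d₁ d₂ d₃ a⊆ s₁ s₂) dbc dbS dcS (suc (suc (suc v))) (suc (suc (suc w))) li lj ij x p q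
    with 3 + v ≤? nablaSize k | 3 + w ≤? nablaSize k
  ... | yes lv | yes lw = cell-disj m₁ (λ y a b → dbS y b (a⊆ y a)) d₁ (λ y b s → dbS y b (s₁ y s)) (2 + v) (2 + w) lv lw (≤-pred ij) x p q
  ... | yes _ | no _ = d₃ x (cell-inner m₁ v x p) (cell-inner m₂ ((2 + w) ∸ nablaSize k) x q)
  ... | no hv | yes lw = ⊥-elim (hv (≤-trans (<⇒≤ ij) lw))
  ... | no hv | no hw = cell-disj m₂ (λ y a c → dcS y c (a⊆ y a)) d₂ (λ y c s → dcS y c (s₂ y s)) _ _ (second< k hv li) (second< k hw lj)
          (s≤s (s≤s (ℕₚ.∸-monoˡ-< (≤-pred ij) (≤-pred (≰⇒> hv))))) x p q

  module _ {k b c S} (a S₁ S₂ : DSet n) (ca : Conn a) (t : Touch b a) (u : Touch a c) (m₁ : Nab k a b S₁) (m₂ : Nab k a c S₂)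
           (d₁ : Disj a S₁) (d₂ : Disj a S₂) (d₃ : Disj S₁ S₂) (s : a ⊆ S) (s₁ : S₁ ⊆ S) (s₂ : S₂ ⊆ S) where
    private
      m : Nab (suc k) b c S
      m = join a S₁ S₂ ca t u m₁ m₂ d₁ d₂ d₃ s s₁ s₂

    cell-copy₁ : ∀ v → v < nablaSize k → cell m (copy₁ v) ≡ cell m₁ v
    cell-copy₁ 0 lt = sym (cell-0 m₁)
    cell-copy₁ 1 lt = sym (cell-1 m₁)
    cell-copy₁ (suc (suc v)) lt with 3 + v ≤? nablaSize k
    ... | yes _ = refl
    ... | no high = ⊥-elim (high lt)

    cell-copy₂ : ∀ v → cell m (copy₂ (nablaSize k) v) ≡ cell m₂ v
    cell-copy₂ 0 = sym (cell-0 m₂)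
    cell-copy₂ 1 = sym (cell-1 m₂)
    -- `copy₂` sends this vertex to the successor of `v + nablaSize k`. Giving that sum a name
    -- exposes the successors on which `cell` matches.
    cell-copy₂ (suc (suc v)) = high (v + nablaSize k) (≤-trans (3≤nablaSize k) (ℕₚ.m≤n+m (nablaSize k) v)) refl
      where
      high : ∀ i → 3 ≤ i → i ≡ v + nablaSize k → cell m (suc i) ≡ cell m₂ (suc (suc v))
      high (suc zero) (s≤s ())
      high (suc (suc i)) _ eq with 3 + i ≤? nablaSize k
      ... | yes le = ⊥-elim (<⇒≱ (s≤s (≤-trans (ℕₚ.m≤n+m (nablaSize k) v) (≤-reflexive (sym eq)))) le)
      ... | no _ = cong (λ z → cell m₂ (2 + z)) (trans (cong (_∸ nablaSize k) eq) (ℕₚ.m+n∸n≡m v (nablaSize k)))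

  cell-edges : ∀ {k b c S} (m : Nab k b c S) → Touch b c → ∀ e → e ∈ˡ nablaEdges k → Touch (cell m (proj₁ e)) (cell m (proj₂ e))
  cell-edges (tip cS t u) bc _ (here refl) = bc
  cell-edges (tip cS t u) bc _ (there (here refl)) = Touch-sym u
  cell-edges (tip cS t u) bc _ (there (there (here refl))) = t
  cell-edges (join a S₁ S₂ ca t u m₁ m₂ d₁ d₂ d₃ s s₁ s₂) bc _ (here refl) = bc
  cell-edges (join a S₁ S₂ ca t u m₁ m₂ d₁ d₂ d₃ s s₁ s₂) bc _ (there (here refl)) = t
  cell-edges (join a S₁ S₂ ca t u m₁ m₂ d₁ d₂ d₃ s s₁ s₂) bc _ (there (there (here refl))) = Touch-sym u
  cell-edges {suc k} (join a S₁ S₂ ca t u m₁ m₂ d₁ d₂ d₃ s s₁ s₂) bc _ (there (there (there i)))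
    with ∈-++⁻ (map (λ e → (copy₁ (proj₁ e) , copy₁ (proj₂ e))) (nablaEdges k)) i
  ... | inj₁ j with ∈-map⁻ _ j
  ...   | e , e∈ , refl = let (p , q) = nablaEdges< k e e∈ in
          subst₂ Touch (sym (cell-copy₁ a S₁ S₂ ca t u m₁ m₂ d₁ d₂ d₃ s s₁ s₂ _ p)) (sym (cell-copy₁ a S₁ S₂ ca t u m₁ m₂ d₁ d₂ d₃ s s₁ s₂ _ q))
            (cell-edges m₁ (Touch-sym t) e e∈)
  cell-edges {suc k} (join a S₁ S₂ ca t u m₁ m₂ d₁ d₂ d₃ s s₁ s₂) bc _ (there (there (there i))) | inj₂ j with ∈-map⁻ _ j
  ...   | e , e∈ , refl =
          subst₂ Touch (sym (cell-copy₂ a S₁ S₂ ca t u m₁ m₂ d₁ d₂ d₃ s s₁ s₂ (proj₁ e))) (sym (cell-copy₂ a S₁ S₂ ca t u m₁ m₂ d₁ d₂ d₃ s s₁ s₂ (proj₂ e)))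
            (cell-edges m₂ u e e∈)

-- Height bookkeeping and the theorem

depth≡ : ∀ ℓ k → depth ℓ k ≡ k * (ℓ + ℓ + 5)
depth≡ ℓ zero = refl
depth≡ ℓ (suc k) rewrite depth≡ ℓ k = solve 2 (λ ℓ d → con 2 :+ (ℓ :+ (con 2 :+ (ℓ :+ (con 1 :+ d)))) := ℓ :+ ℓ :+ con 5 :+ d) refl ℓ (k * (ℓ + ℓ + 5))
  where open +-*-Solver

-- The Ramsey argument uses height `suc (depth (suc m) (m + m))`, which is 4m² + 14m + 1. The other
-- summand is the surplus that `lowerTree` discards.
heightSplit : ∀ m → 9 * suc m * suc m ∸ 3 * suc m + 1 ≡ (5 * m * m + m + 6) + suc (depth (suc m) (m + m))
heightSplit m = trans (cong (λ z → z ∸ 3 * suc m + 1) square) (trans (cong (_+ 1) (ℕₚ.m+n∸m≡n (3 * suc m) rest))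
  (trans (+-comm rest 1) (trans (sym (+-suc (5 * m * m + m + 6) _)) (cong (λ z → (5 * m * m + m + 6) + suc z) (sym (depth≡ (suc m) (m + m)))))))
  where
  rest = (5 * m * m + m + 6) + (m + m) * (suc m + suc m + 5)
  square : 9 * suc m * suc m ≡ 3 * suc m + rest
  square = solve 1 (λ m → con 9 :* (con 1 :+ m) :* (con 1 :+ m) := con 3 :* (con 1 :+ m) :+ ((con 5 :* m :* m :+ m :+ con 6) :+ (m :+ m) :* (con 1 :+ m :+ (con 1 :+ m) :+ con 5))) refl m
    where open +-*-Solver

module MinorsOf (G : Graph) (simple : IsSimple G) where

  E : Fin (size G) → Fin (size G) → Set
  E = Adj G

  E? : ∀ u v → Dec (E u v)
  E? u v = adj G u v Bool.≟ true

  E-sym : ∀ {u v} → E u v → E v u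
  E-sym {u} {v} e = trans (proj₁ simple v u) e

  open Structure E E? E-sym

  toWalkIn : ∀ {A x y} → Walk A x y → WalkIn G (toSubset A) x y
  toWalkIn {A} (Walk.stop a) = WalkIn.stop (toSubset⁺ A a)
  toWalkIn {A} (Walk.step a e w) = WalkIn.step (toSubset⁺ A a) e (toWalkIn w)

  fromWalkIn : ∀ {S} A → (∀ x → x FS.∈ S → x ∈ A) → ∀ {x y} → WalkIn G S x y → Walk A x y
  fromWalkIn A f (WalkIn.stop a) = Walk.stop (f _ a)
  fromWalkIn A f (WalkIn.step a e w) = Walk.step (f _ a) e (fromWalkIn A f w)

  toConnectedSet : ∀ A → Conn A → ConnectedSet G (toSubset A)
  toConnectedSet A ((a , a∈) , c) = (a , toSubset⁺ A a∈) , λ x y x∈ y∈ → toWalkIn (c x y (toSubset⁻ A x∈) (toSubset⁻ A y∈))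

  twoConn : TwoConnected G → TwoConn All
  twoConn (3≤ , (nonempty , conn) , cut) = record
    { conn = (proj₁ nonempty , refl) , λ x y _ _ → fromWalkIn All (λ _ _ → refl) (conn x y FSₚ.∈⊤ FSₚ.∈⊤)
    ; cut = λ v _ x y x∈ y∈ → fromWalkIn (All - v) (λ z z∈ → refl , λ { refl → FSₚ.x∈∁p⇒x∉p z∈ (FSₚ.x∈⁅x⁆ v) })
              (proj₂ (cut v) x y (FSₚ.x∉p⇒x∈∁p (proj₂ x∈ ∘ FSₚ.x∈⁅y⁆⇒x≡y v)) (FSₚ.x∉p⇒x∈∁p (proj₂ y∈ ∘ FSₚ.x∈⁅y⁆⇒x≡y v)))
    ; third = third 3≤ }
    where
    third : ∀ {n} → 3 ≤ n → ∀ (p q : Fin n) → ∃ λ r → r ∈ All × r ≢ p × r ≢ q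
    third (s≤s (s≤s (s≤s _))) = threeElements All {zero} {suc zero} {suc (suc zero)} refl refl refl (λ ()) (λ ()) (λ ())

  minorFromEdges : ∀ m es (β : ℕ → DSet (size G)) → (∀ i → i < m → Conn (β i)) →
                   (∀ i j → i < m → j < m → i < j → Disj (β i) (β j)) →
                   (∀ e → e ∈ˡ es → Touch (β (proj₁ e)) (β (proj₂ e))) → Minor (fromEdges m es) G
  minorFromEdges m es β conn disj touches = record
    { branch = λ u → toSubset (β (toℕ u))
    ; connected = λ u → toConnectedSet (β (toℕ u)) (conn (toℕ u) (toℕ<n u))
    ; disjoint = disjoint
    ; edges = λ u v a → edges u v (splitAdj u v a) }
    where
    disjoint : ∀ (u v : Fin m) → u ≢ v → ∀ x → x FS.∈ toSubset (β (toℕ u)) → x FS.∈ toSubset (β (toℕ v)) → ⊥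
    disjoint u v ne x p q with ℕₚ.<-cmp (toℕ u) (toℕ v)
    ... | tri< lt _ _ = disj _ _ (toℕ<n u) (toℕ<n v) lt x (toSubset⁻ (β (toℕ u)) p) (toSubset⁻ (β (toℕ v)) q)
    ... | tri≈ _ eq _ = ne (toℕ-injective eq)
    ... | tri> _ _ gt = disj _ _ (toℕ<n v) (toℕ<n u) gt x (toSubset⁻ (β (toℕ v)) q) (toSubset⁻ (β (toℕ u)) p)
    splitAdj : ∀ (u v : Fin m) → Adj (fromEdges m es) u v → ∃ λ e → e ∈ˡ es × ((toℕ u ≡ proj₁ e × toℕ v ≡ proj₂ e) ⊎ (toℕ u ≡ proj₂ e × toℕ v ≡ proj₁ e))
    splitAdj u v a with find (any⁻ _ es (proj₂ (Equivalence.to T-∧ (Equivalence.from T-≡ a))))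
    ... | e , e∈ , t with Equivalence.to T-∨ t
    ...   | inj₁ s = let (p , q) = Equivalence.to T-∧ s in e , e∈ , inj₁ (ℕₚ.≡ᵇ⇒≡ _ _ p , ℕₚ.≡ᵇ⇒≡ _ _ q)
    ...   | inj₂ s = let (p , q) = Equivalence.to T-∧ s in e , e∈ , inj₂ (ℕₚ.≡ᵇ⇒≡ _ _ p , ℕₚ.≡ᵇ⇒≡ _ _ q)
    witness : ∀ A B → Touch A B → Σ (Fin (size G)) λ x → Σ (Fin (size G)) λ y → x FS.∈ toSubset A × y FS.∈ toSubset B × Adj G x y
    witness A B (touch {x} {y} a b e) = x , y , toSubset⁺ A a , toSubset⁺ B b , e
    edges : ∀ (u v : Fin m) → (∃ λ e → e ∈ˡ es × ((toℕ u ≡ proj₁ e × toℕ v ≡ proj₂ e) ⊎ (toℕ u ≡ proj₂ e × toℕ v ≡ proj₁ e))) →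
            Σ (Fin (size G)) λ x → Σ (Fin (size G)) λ y → x FS.∈ toSubset (β (toℕ u)) × y FS.∈ toSubset (β (toℕ v)) × Adj G x y
    edges u v (e , e∈ , inj₁ (p , q)) rewrite p | q = witness _ _ (touches e e∈)
    edges u v (e , e∈ , inj₂ (p , q)) rewrite p | q = witness _ _ (Touch-sym (touches e e∈))

  gammaMinor : ∀ m → Apex (suc m) → Minor (GammaPlus (suc m)) G
  gammaMinor m (apex {A} {R} {S} A-conn S∌A t) = minorFromEdges (2 ^ suc ℓ) (GammaPlusEdges ℓ) β conn disj touches
    where
    ℓ = suc m
    top = 2 ^ suc ℓ ∸ 1
    1≤2^ : ∀ k → 1 ≤ 2 ^ k
    1≤2^ k = ℕₚ.m^n>0 2 k
    suc-top : suc top ≡ 2 ^ suc ℓ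
    suc-top = ℕₚ.m+[n∸m]≡n (1≤2^ (suc ℓ))
    β : ℕ → DSet (size G)
    β v with v ℕₚ.≟ top
    ... | yes _ = A
    ... | no _  = at t (addr v)
    β-top : β top ≡ A
    β-top with top ℕₚ.≟ top
    ... | yes _ = refl
    ... | no ne = ⊥-elim (ne refl)
    β-low : ∀ v → suc v < 2 ^ suc ℓ → β v ≡ at t (addr v)
    β-low v lt with v ℕₚ.≟ top
    ... | yes refl = ⊥-elim (ℕₚ.<-irrefl suc-top lt)
    ... | no _ = refl
    short : ∀ v → suc v < 2 ^ suc ℓ → length (addr v) ≤ ℓ
    short v lt = pow-cancel (length (addr v)) ℓ (proj₁ (addr-length v)) lt
    below-top : ∀ {v} → v < 2 ^ suc ℓ → v ≢ top → suc v < 2 ^ suc ℓ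
    below-top lt ne = ℕₚ.≤∧≢⇒< lt (λ eq → ne (ℕₚ.suc-injective (trans eq (sym suc-top))))
    conn : ∀ i → i < 2 ^ suc ℓ → Conn (β i)
    conn i lt with i ℕₚ.≟ top
    ... | yes _ = A-conn
    ... | no ne = at-conn t (addr i) (short i (below-top lt ne))
    disj : ∀ i j → i < 2 ^ suc ℓ → j < 2 ^ suc ℓ → i < j → Disj (β i) (β j)
    disj i j li lj ij x p q with i ℕₚ.≟ top | j ℕₚ.≟ top
    ... | yes refl | _ = <⇒≱ lj (≤-trans (≤-reflexive (sym suc-top)) ij)
    ... | no _ | yes _ = S∌A x (at⊆ t (addr i) x p) q
    ... | no _ | no _ = at-disj t (addr i) (addr j) (λ eq → ℕₚ.<-irrefl (addr-injective i j eq) ij) x p q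
    tree-edge : ∀ b v → suc v < 2 ^ ℓ → Touch (β v) (β (kid b v))
    tree-edge b v lt = subst₂ Touch
      (sym (β-low v (<-≤-trans lt (ℕₚ.^-monoʳ-≤ 2 (n≤1+n ℓ)))))
      (trans (cong (at t) (sym (addr-kid b v))) (sym (β-low (kid b v) kid<)))
      (at-kid t (addr v) b (s≤s (pow-cancel (length (addr v)) m (proj₁ (addr-length v)) lt)))
      where
      kid≤ : ∀ b → suc (kid b v) ≤ suc (2 * suc v)
      kid≤ false = ≤-trans (≤-reflexive (trans (cong suc (sym (+-suc v v))) (cong (λ z → suc v + suc z) (sym (ℕₚ.+-identityʳ v))))) (n≤1+n _)
      kid≤ true = s≤s (≤-reflexive (trans (cong suc (sym (+-suc v v))) (cong (λ z → suc v + suc z) (sym (ℕₚ.+-identityʳ v)))))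
      kid< : suc (kid b v) < 2 ^ suc ℓ
      kid< = ≤-trans (s≤s (kid≤ b)) (≤-trans (≤-reflexive (sym (ℕₚ.*-suc 2 (suc v)))) (ℕₚ.*-monoʳ-≤ 2 lt))
    leaf-edge : ∀ j → j < 2 ^ ℓ → Touch (β (2 ^ ℓ ∸ 1 + j)) (β top)
    leaf-edge j lt = subst₂ Touch (sym (β-low v v<)) (sym β-top)
      (at-leaf t (addr v) (ℕₚ.≤-antisym (short v v<) (pow-cancel ℓ (length (addr v)) (≤-trans (m≤m+n (2 ^ ℓ) j) (≤-reflexive (sym suc-v))) (proj₂ (addr-length v)))))
      where
      v = 2 ^ ℓ ∸ 1 + j
      suc-v : suc v ≡ 2 ^ ℓ + j
      suc-v = cong (_+ j) (ℕₚ.m+[n∸m]≡n (1≤2^ ℓ))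
      v< : suc v < 2 ^ suc ℓ
      v< = ≤-trans (s≤s (≤-reflexive suc-v)) (≤-trans (≤-reflexive (sym (+-suc (2 ^ ℓ) j))) (+-monoʳ-≤ (2 ^ ℓ) (≤-trans lt (≤-reflexive (sym (ℕₚ.+-identityʳ (2 ^ ℓ)))))))
    inner : ∀ i → i ∈ˡ upTo (2 ^ ℓ ∸ 1) → suc i < 2 ^ ℓ
    inner i i∈ = ≤-trans (s≤s (∈-upTo⁻ i∈)) (≤-reflexive (ℕₚ.m+[n∸m]≡n (1≤2^ ℓ)))
    touches : ∀ e → e ∈ˡ GammaPlusEdges ℓ → Touch (β (proj₁ e)) (β (proj₂ e))
    touches e e∈ with ∈-++⁻ (concatMap (λ i → (i , 2 * i + 1) ∷ (i , 2 * i + 2) ∷ []) (upTo (2 ^ ℓ ∸ 1))) e∈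
    ... | inj₂ l with ∈-map⁻ (λ j → (2 ^ ℓ ∸ 1 + j , 2 ^ suc ℓ ∸ 1)) l
    ...   | j , j∈ , refl = leaf-edge j (∈-upTo⁻ j∈)
    touches e e∈ | inj₁ c with find (∈-concatMap⁻ (λ i → (i , 2 * i + 1) ∷ (i , 2 * i + 2) ∷ []) {xs = upTo (2 ^ ℓ ∸ 1)} c)
    ...   | i , i∈ , here refl = subst (λ z → Touch (β i) (β z)) (trans (cong (λ z → suc (i + z)) (sym (ℕₚ.+-identityʳ i))) (+-comm 1 (2 * i)))
              (tree-edge false i (inner i i∈))
    ...   | i , i∈ , there (here refl) = subst (λ z → Touch (β i) (β z)) (trans (cong (λ z → 2 + (i + z)) (sym (ℕₚ.+-identityʳ i))) (+-comm 2 (2 * i)))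
              (tree-edge true i (inner i i∈))

  nablaMinor : ∀ {j p q} (hℓ : 1 ≤ suc j) → Adj G p q → Blue j All p q → Minor (Nabla (suc j) hℓ) G
  nablaMinor {j} hℓ pq (blue {b} {c} {S} p∈ q∈ _ _ _ cb cc m dbc dbS dcS) =
    minorFromEdges (nablaSize j) (nablaEdges j) (cell m) (cell-conn m cb cc) (cell-disj m dbc dbS dcS)
      (cell-edges m (touch p∈ q∈ pq))

  -- `PD` bounds the sizes of bags, and width is one less. With `1 ≤ w` the truncated difference
  -- `w ∸ 1` is smaller than `w`.
  noDecomposition : ∀ w → 1 ≤ w → PathwidthAtLeast G w → ¬ PD w All
  noDecomposition w 1≤w pw D = <⇒≱ (ℕₚ.∸-monoʳ-< {w} {1} {0} (s≤s z≤n) 1≤w) (≤-trans (pw D′) (ℕₚ.∸-monoˡ-≤ 1 (bounded (allFin (suc final)))))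
    where
    open PD D
    D′ : PathDecomposition G
    D′ = record
      { len = suc final ; bag = λ i → toSubset (part (toℕ i))
      ; covers = λ v → let (t , le , b) = spans v refl in place t le , toSubset⁺ (part (toℕ (place t le))) (at-place (v ∈_) t le b)
      ; interval = λ v i j k ij jk p q → toSubset⁺ (part (toℕ j))
          (convex v (toℕ i) (toℕ j) (toℕ k) ij jk (≤-pred (toℕ<n k)) (toSubset⁻ (part (toℕ i)) p) (toSubset⁻ (part (toℕ k)) q))
      ; edgeIn = λ u v e → let (t , le , p , q) = edges u v refl refl e in
          place t le , toSubset⁺ (part (toℕ (place t le))) (at-place (u ∈_) t le p) , toSubset⁺ (part (toℕ (place t le))) (at-place (v ∈_) t le q) }
      where
      place : ∀ t → t ≤ final → Fin (suc final)
      place t le = Fin.fromℕ< (s≤s le)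
      at-place : (P : DSet (size G) → Set) → ∀ t le → P (part t) → P (part (toℕ (place t le)))
      at-place P t le = subst (P ∘ part) (sym (toℕ-fromℕ< (s≤s le)))
    bounded : ∀ is → foldr _⊔_ 0 (map (λ i → FS.∣ toSubset (part (toℕ i)) ∣) is) ≤ w
    bounded [] = z≤n
    bounded (i ∷ is) = ℕₚ.⊔-lub (≤-trans (≤-reflexive (∣toSubset∣ (part (toℕ i)))) (small (toℕ i) (≤-pred (toℕ<n i)))) (bounded is)

  lowerTree : ∀ {O h} k → TreeIn O (k + h) → TreeIn O h
  lowerTree zero t = t
  lowerTree (suc k) (treeIn (node _ t₁ _ _ _ _ _ _) s) = lowerTree k (treeIn t₁ (λ x → s x ∘ inj₂ ∘ inj₁))

theorem6p2 : (ℓ : ℕ) → (hℓ : 1 ≤ ℓ) → (G : Graph) → IsSimple G → TwoConnected G →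
    PathwidthAtLeast G (2 ^ (9 * ℓ * ℓ ∸ 3 * ℓ + 2) ∸ 2) →
    Minor (GammaPlus ℓ) G ⊎ Minor (Nabla ℓ hℓ) G
theorem6p2 (suc m) hℓ G simple two pw =
  conclude (redOrBlue ℓ (m + m) ℓ m ≤-refl (twoConn two) refl refl p≢q tree)
  where
  open MinorsOf G simple
  open Structure E E? E-sym
  ℓ = suc m
  h = 9 * ℓ * ℓ ∸ 3 * ℓ + 1
  exponent : 9 * ℓ * ℓ ∸ 3 * ℓ + 2 ≡ suc h
  exponent = +-suc (9 * ℓ * ℓ ∸ 3 * ℓ) 1
  -- A heap model with `suc w` nodes is exactly a model of Γ_h, which has 2^(h+1) - 1 vertices.
  w = 2 ^ suc h ∸ 2
  4≤ : 4 ≤ 2 ^ suc h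
  4≤ = ℕₚ.^-monoʳ-≤ 2 {2} {suc h} (s≤s (ℕₚ.m≤n+m 1 _))
  1≤w : 1 ≤ w
  1≤w = ≤-trans (s≤s z≤n) (ℕₚ.∸-monoˡ-≤ 2 4≤)
  -- `Blue` lacks the root edge of ∇, so the terminals are chosen adjacent.
  adjacentPair : ∃₂ λ p q → Adj G p q
  adjacentPair with proj₁ (TwoConn.conn (twoConn two))
  ... | v , _ with TwoConn.third (twoConn two) v v
  ...   | r , _ , r≢v , _ with exit All ｛ v ｝ (proj₂ (TwoConn.conn (twoConn two)) v r refl refl) refl r≢v
  ...     | exiting {p} {q} _ _ _ e _ = p , q , e
  p q : Fin (size G)
  p = proj₁ adjacentPair
  q = proj₁ (proj₂ adjacentPair)
  pq : Adj G p q
  pq = proj₂ (proj₂ adjacentPair)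
  p≢q : p ≢ q
  p≢q eq with () ← trans (sym (proj₂ simple q)) (subst (λ z → Adj G z q) eq pq)
  heap : Heap (suc w)
  heap = heapModel w (noDecomposition w 1≤w (subst (λ e → PathwidthAtLeast G (2 ^ e ∸ 2)) exponent pw)) p
  wholeTree : TreeIn All h
  wholeTree with subtree heap h 0 (≤-reflexive (sym (ℕₚ.m+[n∸m]≡n (≤-trans (s≤s (s≤s z≤n)) 4≤))))
  ... | sub t _ = treeIn t (λ _ _ → refl)
  tree : TreeIn All (suc (depth ℓ (m + m)))
  tree = lowerTree (5 * m * m + m + 6) (subst (TreeIn All) (heightSplit m) wholeTree)
  conclude : Apex ℓ ⊎ (Red ℓ All p q ⊎ Blue m All p q) → Minor (GammaPlus ℓ) G ⊎ Minor (Nabla ℓ hℓ) G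
  conclude (inj₁ a) = inj₁ (gammaMinor m a)
  conclude (inj₂ (inj₁ (red _ _ _ _ c t d))) = inj₁ (gammaMinor m (apex c d t))
  conclude (inj₂ (inj₂ b)) = inj₂ (nablaMinor hℓ pq b)
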